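{- Let $m \equiv 0 \pmod{4}$ be a positive integer, and let $e$ be an integer with $2 \leq e \leq \lfloor m/2\rfloor$ and $\gcd(m,e)=2$. Let $\alpha$ be a generator of $\mathbb{F}_{2^m}^*$, let $\mathcal{C}_E$ be the binary cyclic code of length $2^m-1$ with generator polynomial $\operatorname{lcm}\big(\mathbb{M}_{\alpha}(x),\mathbb{M}_{\alpha^{1+2^e}}(x)\big)$, and let $\overline{\mathcal{C}_E}$ be its extended code, with coordinates indexed by $V=\{0,1,\dots,2^m-1\}$. Then the supports of the codewords of Hamming weight $8$ in $\overline{\mathcal{C}_E}$ form a $2$-$(2^m,8,\lambda)$ design on $V$ with $$\lambda=\frac{2^{4m-4}-27\cdot 2^{3m-4}+23\cdot 2^{2m-1}+261\cdot 2^{m-2}+403}{45}.$$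
   Context: $\mathbb{M}_{\beta}(x)$ denotes the minimal polynomial of $\beta\in\mathbb{F}_{2^m}$ over $\mathbb{F}_2$. A binary cyclic code of length $n$ with generator polynomial $g(x)$ is the ideal generated by $g(x)$ in $\mathbb{F}_2[x]/(x^n-1)$, identified with vectors in $\mathbb{F}_2^n$. The extended code is obtained by appending an overall parity-check coordinate (sum of all coordinates) to each codeword. The support of a codeword is the set of coordinates where it is nonzero. A $2$-$(v,k,\lambda)$ design is a pair $(V,\mathcal{B})$ with $|V|=v$ and $\mathcal{B}$ a set of $k$-subsets of $V$ such that every $2$-subset of $V$ is contained in exactly $\lambda$ members of $\mathcal{B}$. -}

module Defs where

open import Data.Nat using (ℕ; zero; suc; _≤_; _<_; _∸_) renaming (_+_ to _+ℕ_; _*_ to _*ℕ_; _^_ to _^ℕ_)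
open import Data.Bool using (Bool; true; false; _xor_; if_then_else_)
open import Data.List using (List; []; _∷_; replicate; _++_; length)
import Data.List as L
open import Data.List.Membership.Propositional using (_∈_)
open import Data.List.Relation.Unary.Unique.Propositional using (Unique)
open import Data.Fin using (Fin)
import Data.Fin as Fin
open import Data.Fin.Subset using (Subset; ∣_∣) renaming (_∈_ to _∈ₛ_)
open import Data.Vec using (tabulate)
open import Data.Product using (Σ; ∃; _×_; _,_)
open import Relation.Binary.PropositionalEquality using (_≡_)
open import Relation.Nullary using (¬_)
open import Algebra.Structures using (IsCommutativeRing)
open import Function.Bundles using (_↔_; _⇔_)

-- Binary polynomials: coefficient lists, lowest degree first.
-- Trailing zero coefficients are allowed; equality is coefficientwise.

Poly₂ : Set
Poly₂ = List Bool

coeff : Poly₂ → ℕ → Bool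
coeff []      _       = false
coeff (a ∷ p) zero    = a
coeff (a ∷ p) (suc i) = coeff p i

_≈ₚ_ : Poly₂ → Poly₂ → Set
p ≈ₚ q = ∀ i → coeff p i ≡ coeff q i

infixl 6 _⊕_
infixl 7 _⊛_

_⊕_ : Poly₂ → Poly₂ → Poly₂
[]      ⊕ q       = q
(a ∷ p) ⊕ []      = a ∷ p
(a ∷ p) ⊕ (b ∷ q) = (a xor b) ∷ (p ⊕ q)

_⊛_ : Poly₂ → Poly₂ → Poly₂
[]      ⊛ q = []
(a ∷ p) ⊛ q = (if a then q else []) ⊕ (false ∷ (p ⊛ q))

Deg : Poly₂ → ℕ → Set
Deg p d = (coeff p d ≡ true) × (∀ i → d < i → coeff p i ≡ false)

_∣ₚ_ : Poly₂ → Poly₂ → Set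
p ∣ₚ q = ∃ λ r → q ≈ₚ (r ⊛ p)

xⁿ+1 : ℕ → Poly₂
xⁿ+1 n = (replicate n false ++ (true ∷ [])) ⊕ (true ∷ [])

-- l is the lcm of p and q (a nonzero common multiple dividing every
-- common multiple; over F₂ every nonzero polynomial is monic, so this
-- pins down the lcm uniquely up to ≈ₚ)
IsLcm : Poly₂ → Poly₂ → Poly₂ → Set
IsLcm p q l = (∃ λ d → Deg l d) × (p ∣ₚ l) × (q ∣ₚ l)
            × (∀ l′ → p ∣ₚ l′ → q ∣ₚ l′ → l ∣ₚ l′)

-- The finite field F_{2^m} (a field whose carrier is in bijection with
-- Fin (2^m); any two such are isomorphic).

record GF2^ (m : ℕ) : Set₁ where
  infixl 6 _+_
  infixl 7 _*_
  field
    F     : Set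
    _+_   : F → F → F
    _*_   : F → F → F
    -_    : F → F
    0#    : F
    1#    : F
    isCommutativeRing : IsCommutativeRing _≡_ _+_ _*_ -_ 0# 1#
    0≢1   : ¬ (0# ≡ 1#)
    inverse : ∀ x → ¬ (x ≡ 0#) → ∃ λ y → x * y ≡ 1#
    size  : F ↔ Fin (2 ^ℕ m)

  _^_ : F → ℕ → F
  x ^ zero  = 1#
  x ^ suc k = x * (x ^ k)

  ι : Bool → F
  ι true  = 1#
  ι false = 0#

  eval : Poly₂ → F → F
  eval []      x = 0#
  eval (a ∷ p) x = ι a + x * eval p x

  IsGenerator : F → Set
  IsGenerator α = ∀ x → ¬ (x ≡ 0#) → ∃ λ k → α ^ k ≡ x

  -- p is the minimal polynomial 𝕄_β(x) of β over F₂: a nonzero (hence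
  -- monic) binary polynomial with root β of least degree.
  IsMinPoly : F → Poly₂ → Set
  IsMinPoly β p = (∃ λ d → Deg p d × ((∀ q d′ → Deg q d′ → eval q β ≡ 0# → d ≤ d′)))
                × (eval p β ≡ 0#)

vecPoly : ∀ {n} → (Fin n → Bool) → Poly₂
vecPoly {n} c = L.tabulate c

-- c lies in the ideal generated by g in F₂[x]/(x^n - 1)
-- (vectors identified with polynomials of degree < n)
InCyclicCode : (n : ℕ) → Poly₂ → (Fin n → Bool) → Set
InCyclicCode n g c = ∃ λ a → ∃ λ b → vecPoly c ≈ₚ (a ⊛ g ⊕ b ⊛ xⁿ+1 n)

parity : ∀ {n} → (Fin n → Bool) → Bool
parity {n} c = L.foldr _xor_ false (L.tabulate c)

-- appending the overall parity bit: coordinates 0..n-1 carry c,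
-- coordinate n carries the sum of all coordinates of c
extendWith : (k : ℕ) → (Fin k → Bool) → Bool → Fin (suc k) → Bool
extendWith zero    c p Fin.zero    = p
extendWith (suc k) c p Fin.zero    = c Fin.zero
extendWith (suc k) c p (Fin.suc i) = extendWith k (λ j → c (Fin.suc j)) p i

extend : ∀ {n} → (Fin n → Bool) → Fin (suc n) → Bool
extend {n} c = extendWith n c (parity c)

InExtendedCode : (n : ℕ) → Poly₂ → (Fin (suc n) → Bool) → Set
InExtendedCode n g v = ∃ λ c → InCyclicCode n g c × (∀ i → v i ≡ extend c i)

support : ∀ {N} → (Fin N → Bool) → Subset N
support v = tabulate v

SupportBlock : (n : ℕ) → Poly₂ → ℕ → Subset (suc n) → Set
SupportBlock n g w B = ∃ λ v → InExtendedCode n g v × support v ≡ B × ∣ B ∣ ≡ w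

-- 2-(v,k,λ) designs on the point set Fin v, blocks given by a predicate
-- (a set of subsets). "Exactly λ blocks contain {i,j}" is expressed by
-- a duplicate-free list enumerating exactly those blocks, of length λ.

Is2Design : (v k λ′ : ℕ) → (Subset v → Set) → Set
Is2Design v k λ′ Block =
    (∀ B → Block B → ∣ B ∣ ≡ k)
  × (∀ (i j : Fin v) → ¬ (i ≡ j) →
       ∃ λ (xs : List (Subset v)) → Unique xs × length xs ≡ λ′
         × (∀ B → (B ∈ xs) ⇔ (Block B × i ∈ₛ B × j ∈ₛ B)))

-- numerator 2^{4m-4} - 27·2^{3m-4} + 23·2^{2m-1} + 261·2^{m-2} + 403
-- (positive for all m ≥ 4, so truncated subtraction is exact)
λ-numerator : ℕ → ℕ
λ-numerator m =
  (2 ^ℕ (4 *ℕ m ∸ 4) +ℕ 23 *ℕ 2 ^ℕ (2 *ℕ m ∸ 1) +ℕ 261 *ℕ 2 ^ℕ (m ∸ 2) +ℕ 403)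
  ∸ 27 *ℕ 2 ^ℕ (3 *ℕ m ∸ 4)

{-# OPTIONS --safe #-}
module Submission where

-- Put q = 2^m, Q = 2^e, f(x) = x^(1+Q). Indexing the coordinates by the points of 𝔽_q, a set of points of even
-- size supports a codeword iff Σ x = 0 and Σ f(x) = 0, so the affine group acts 2-transitively on the code and
-- q(q-1)λ = 56 A₈, where A_w is the number of codewords of weight w.
--
-- Let N_k be the number of k-tuples of points with Σ x = Σ f(x) = 0. Toggling one point at a time expresses
-- N₂, N₄, N₆, N₈ through A₀, A₂, A₄, A₆, A₈. To compute N_2k, pair up the points: f(x) + f(x+u) runs through
-- the hyperplane f(u)·H, H = {x^Q + x}, since 1 ∈ H. As gcd(m,e) = 2 and 4 ∣ m, the map x ↦ x^Q + x has a kernel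
-- of size 4, and f(u)H = f(v)H iff u/v ∈ 𝔽₁₆; otherwise f(u)H + f(v)H is everything, uniformly covered.
-- Hence convolutions of the indicators of these hyperplanes are known, and N_2k follows by iteration.

-- Toggling a point changes the size of a set by one, so N_2k is a combination of A₀, ..., A_2k in
-- which A_2k has coefficient (2k)!. The system is triangular, and the weights 4 and 6 have to be
-- found on the way to 8. N_2k is the value at zero of the k-th iterate of a single operator on the
-- indicator of zero. Such iterates could become arbitrarily complicated; they do not, because at
-- (s, t) with s ≠ 0 only the hyperplane f(s)·H is distinguished, and at s = 0 only the point t = 0
-- and the sum of all hyperplanes. Five numbers therefore describe each iterate. All of this happens
-- in ℕ. In terms of r = 2^m - 16, the number of points outside 𝔽₁₆, every coefficient that occurs
-- is a polynomial with nonnegative coefficients, although the stated λ has a negative cubic term in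
-- q. The denominator arises from 8! A₈: dividing by 8 · 7 for the marked pair leaves 720 λ, and 720
-- = 16 · 45, where 16 clears the powers of two in the stated formula.

open import Defs
open import Algebra.Bundles using (CommutativeRing)
open import Algebra.Bundles.Raw using (RawRing)
import Algebra.Solver.Ring
open import Algebra.Solver.Ring.AlmostCommutativeRing using (fromCommutativeRing; _-Raw-AlmostCommutative⟶_)
open import Algebra.Structures using (IsCommutativeRing)
open import Data.Bool using (Bool; true; false; if_then_else_; _xor_; _∧_; not; T)
import Data.Bool.Properties as Bool
open import Data.Fin using (Fin; toℕ)
import Data.Fin as Fin
import Data.Fin.Properties as FinP
open import Data.Fin.Subset using (Subset; ∣_∣; _⊆_; ⁅_⁆; _∪_) renaming (_∈_ to _∈ₛ_)
import Data.Fin.Subset.Properties as Sub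
open import Data.List using (List; []; _∷_; [_]; _++_; length; map; filter; applyUpTo; lookup; tabulate; replicate)
open import Data.List.Membership.Propositional using (_∈_)
open import Data.List.Membership.Propositional.Properties using (∈-map⁺; ∈-map⁻; ∈-++⁺ˡ; ∈-++⁺ʳ; ∈-++⁻; ∈-applyUpTo⁺; ∈-applyUpTo⁻; ∈-filter⁺; ∈-filter⁻; ∈-tabulate⁺)
open import Data.List.Membership.Propositional.Properties.WithK using (unique∧set⇒bag)
open import Data.List.Properties using (length-map; length-++; length-applyUpTo; length-tabulate; map-∘)
open import Data.List.Relation.Binary.BagAndSetEquality using (∼bag⇒↭)
open import Data.List.Relation.Binary.Permutation.Propositional using (_↭_; prep; swap; ↭-refl; ↭-sym; ↭-trans; ↭⇒↭ₛ)
import Data.List.Relation.Binary.Permutation.Propositional.Properties as Perm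
import Data.List.Relation.Binary.Permutation.Setoid.Properties as PermS
open import Data.List.Relation.Unary.All using (All; []; _∷_)
import Data.List.Relation.Unary.All as All
import Data.List.Relation.Unary.All.Properties as AllP
open import Data.List.Relation.Unary.AllPairs using ([]; _∷_)
open import Data.List.Relation.Unary.Any using (here; there; index)
open import Data.List.Relation.Unary.Any.Properties using (lookup-index)
open import Data.List.Relation.Unary.Unique.Propositional using (Unique)
import Data.List.Relation.Unary.Unique.Propositional.Properties as UniqueP
open import Data.Maybe using (Maybe; just; nothing)
open import Data.Nat using (ℕ; zero; suc; _≤_; _<_; z≤n; s≤s; _∸_; _+_; _*_; _^_; _/_; _%_; _≡ᵇ_; NonZero)
open import Data.Nat.Divisibility using (_∣_; divides; *-cancelʳ-∣)
open import Data.Nat.DivMod using (m≡m%n+[m/n]*n; m%n<n)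
open import Data.Nat.GCD using (gcd; module Bézout; gcd-GCD; gcd[m,n]∣n)
import Data.Nat.Properties as ℕ
open import Data.Nat.Solver using (module +-*-Solver)
open import Data.Nat.Tactic.RingSolver using (solve-∀)
open import Data.Product using (∃; ∃₂; _×_; _,_; proj₁; proj₂)
open import Data.Product.Properties using (≡-dec)
open import Data.Sum using (_⊎_; inj₁; inj₂)
open import Data.Vec using (Vec; []; _∷_; toList; here)
import Data.Vec as Vec
import Data.Vec.Properties as VecP
open import Function using (_∘_; id)
open import Function.Bundles using (_⇔_; mk⇔; Equivalence; Inverse)
open import Relation.Binary.PropositionalEquality using (_≡_; _≢_; refl; sym; trans; cong; cong₂; subst; setoid; module ≡-Reasoning)
open import Relation.Nullary using (¬_; Dec; yes; no; does; contradiction)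
import Relation.Nullary.Decidable as Dec
open import Relation.Unary using (Decidable)

open ≡-Reasoning

-- Finite sums over lists

Σ[_] : {A : Set} → List A → (A → ℕ) → ℕ
Σ[ [] ] g     = 0
Σ[ x ∷ xs ] g = g x + Σ[ xs ] g

module _ {A : Set} where

  Σ-cong-All : ∀ {xs} {g k : A → ℕ} → All (λ x → g x ≡ k x) xs → Σ[ xs ] g ≡ Σ[ xs ] k
  Σ-cong-All []       = refl
  Σ-cong-All (e ∷ es) = cong₂ _+_ e (Σ-cong-All es)

  Σ-cong : ∀ xs {g k : A → ℕ} → (∀ x → g x ≡ k x) → Σ[ xs ] g ≡ Σ[ xs ] k
  Σ-cong xs e = Σ-cong-All (All.universal e xs)

  Σ-+ : ∀ xs (g k : A → ℕ) → Σ[ xs ] (λ x → g x + k x) ≡ Σ[ xs ] g + Σ[ xs ] k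
  Σ-+ []       g k = refl
  Σ-+ (x ∷ xs) g k = trans (cong (g x + k x +_) (Σ-+ xs g k))
    (solve 4 (λ a b c d → a :+ b :+ (c :+ d) := a :+ c :+ (b :+ d)) refl (g x) (k x) (Σ[ xs ] g) (Σ[ xs ] k))
    where open +-*-Solver

  Σ-* : ∀ xs c (g : A → ℕ) → Σ[ xs ] (λ x → c * g x) ≡ c * Σ[ xs ] g
  Σ-* []       c g = sym (ℕ.*-zeroʳ c)
  Σ-* (x ∷ xs) c g = trans (cong (c * g x +_) (Σ-* xs c g)) (sym (ℕ.*-distribˡ-+ c (g x) _))

  Σ-const : ∀ xs c → Σ[ xs ] (λ (_ : A) → c) ≡ length xs * c
  Σ-const []       c = refl
  Σ-const (x ∷ xs) c = cong (c +_) (Σ-const xs c)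

  Σ-↭ : ∀ {xs ys} (g : A → ℕ) → xs ↭ ys → Σ[ xs ] g ≡ Σ[ ys ] g
  Σ-↭ g _↭_.refl                 = refl
  Σ-↭ g (prep x p)              = cong (g x +_) (Σ-↭ g p)
  Σ-↭ g (swap {xs} {ys} x y p)  = trans (cong (λ s → g x + (g y + s)) (Σ-↭ g p))
    (solve 3 (λ a b c → a :+ (b :+ c) := b :+ (a :+ c)) refl (g x) (g y) (Σ[ ys ] g))
    where open +-*-Solver
  Σ-↭ g (_↭_.trans p p′)            = trans (Σ-↭ g p) (Σ-↭ g p′)

  tally : ∀ {P : A → Set} → Decidable P → List A → ℕ
  tally P? xs = Σ[ xs ] (λ x → if does (P? x) then 1 else 0)

  -- `r` is the number of entries at which `P` fails; passing it in keeps the formula free of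
  -- subtraction.
  Σ-if : ∀ {P : A → Set} (P? : Decidable P) xs {r} a b → length xs ≡ tally P? xs + r →
    Σ[ xs ] (λ x → if does (P? x) then a else b) ≡ tally P? xs * a + r * b
  Σ-if P? [] a b refl = refl
  Σ-if P? (x ∷ xs) {r} a b l with does (P? x)
  ... | true = trans (cong (a +_) (Σ-if P? xs a b (ℕ.suc-injective l))) (sym (ℕ.+-assoc a _ _))
  Σ-if P? (x ∷ xs) {zero}  a b l | false = contradiction (ℕ.≤-reflexive (trans l (ℕ.+-identityʳ _))) (ℕ.<⇒≱ (s≤s (tally≤length xs)))
    where
    tally≤length : ∀ ys → tally P? ys ≤ length ys
    tally≤length []       = z≤n
    tally≤length (y ∷ ys) with does (P? y)
    ... | true  = s≤s (tally≤length ys)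
    ... | false = ℕ.m≤n⇒m≤1+n (tally≤length ys)
  Σ-if P? (x ∷ xs) {suc r} a b l | false = trans (cong (b +_) (Σ-if P? xs a b (ℕ.suc-injective (trans l (ℕ.+-suc _ r)))))
    (solve 3 (λ t b u → b :+ (t :+ u) := t :+ (b :+ u)) refl (tally P? xs * a) b (r * b))
    where open +-*-Solver

  tally-filter : ∀ {P : A → Set} (P? : Decidable P) xs → tally P? xs ≡ length (filter P? xs)
  tally-filter P? []       = refl
  tally-filter P? (x ∷ xs) with does (P? x)
  ... | true  = cong suc (tally-filter P? xs)
  ... | false = tally-filter P? xs

  unique-sameElements⇒↭ : ∀ {xs ys : List A} → Unique xs → Unique ys → (∀ {x} → x ∈ xs ⇔ x ∈ ys) → xs ↭ ys
  unique-sameElements⇒↭ ux uy e = ∼bag⇒↭ (unique∧set⇒bag ux uy e)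

Σ-map : ∀ {A B : Set} (φ : A → B) xs (g : B → ℕ) → Σ[ map φ xs ] g ≡ Σ[ xs ] (g ∘ φ)
Σ-map φ []       g = refl
Σ-map φ (x ∷ xs) g = cong (g (φ x) +_) (Σ-map φ xs g)

Σ-swap : ∀ {A B : Set} (xs : List A) (ys : List B) (g : A → B → ℕ) →
  Σ[ xs ] (λ x → Σ[ ys ] (g x)) ≡ Σ[ ys ] (λ y → Σ[ xs ] (λ x → g x y))
Σ-swap []       ys g = sym (trans (Σ-const ys 0) (ℕ.*-zeroʳ (length ys)))
Σ-swap (x ∷ xs) ys g = trans (cong (Σ[ ys ] (g x) +_) (Σ-swap xs ys g)) (sym (Σ-+ ys (g x) _))

picks : {A : Set} → List A → List (A × List A)
picks []       = []
picks (x ∷ xs) = (x , xs) ∷ map (λ (y , r) → y , x ∷ r) (picks xs)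

length-picks : ∀ {A : Set} (xs : List A) → length (picks xs) ≡ length xs
length-picks []       = refl
length-picks (x ∷ xs) = cong suc (trans (length-map _ (picks xs)) (length-picks xs))

picks-↭ : ∀ {A : Set} (xs : List A) → All (λ (x , r) → x ∷ r ↭ xs) (picks xs)
picks-↭ []       = []
picks-↭ (x ∷ xs) = ↭-refl ∷ AllP.map⁺ (All.map (λ {(y , r)} p → ↭-trans (swap y x ↭-refl) (prep x p)) (picks-↭ xs))

bijection-↭ : ∀ {A : Set} {xs : List A} → Unique xs → (∀ x → x ∈ xs) →
  (φ ψ : A → A) → (∀ x → ψ (φ x) ≡ x) → (∀ x → φ (ψ x) ≡ x) → map φ xs ↭ xs
bijection-↭ {xs = xs} uniq complete φ ψ ψφ φψ = unique-sameElements⇒↭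
  (UniqueP.map⁺ (λ {x} {y} e → trans (sym (ψφ x)) (trans (cong ψ e) (ψφ y))) uniq) uniq
  (λ {x} → mk⇔ (λ _ → complete x) (λ _ → subst (_∈ map φ xs) (φψ x) (∈-map⁺ φ (complete (ψ x)))))

tally-cong : ∀ {A : Set} {P Q : A → Set} (P? : Decidable P) (Q? : Decidable Q) xs →
  (∀ x → P x → Q x) → (∀ x → Q x → P x) → tally P? xs ≡ tally Q? xs
tally-cong P? Q? xs to from = Σ-cong xs same
  where
  same : ∀ x → (if does (P? x) then 1 else 0) ≡ (if does (Q? x) then 1 else 0)
  same x with P? x | Q? x
  ... | yes _ | yes _ = refl
  ... | no _  | no _  = refl
  ... | yes p | no ¬q = contradiction (to x p) ¬q
  ... | no ¬p | yes q = contradiction (from x q) ¬p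

tally-∷ : ∀ {A : Set} {P : A → Set} (P? : Decidable P) x xs → P x → tally P? (x ∷ xs) ≡ suc (tally P? xs)
tally-∷ P? x xs p = cong (λ b → (if b then 1 else 0) + tally P? xs) (Dec.dec-true (P? x) p)

-- Counting subsets by size and syndrome in a group of exponent two

record Syndrome : Set₁ where
  infixl 6 _⊹_
  field
    G       : Set
    _⊹_     : G → G → G
    𝟘       : G
    _≟ᴳ_    : (γ κ : G) → Dec (γ ≡ κ)
    ⊹-assoc : ∀ γ κ μ → (γ ⊹ κ) ⊹ μ ≡ γ ⊹ (κ ⊹ μ)
    ⊹-comm  : ∀ γ κ → γ ⊹ κ ≡ κ ⊹ γ
    ⊹-𝟘     : ∀ γ → γ ⊹ 𝟘 ≡ γ
    ⊹-self  : ∀ γ → γ ⊹ γ ≡ 𝟘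

module Counting (𝕊 : Syndrome) where
  open Syndrome 𝕊

  ⊹-exch : ∀ γ κ μ → (γ ⊹ κ) ⊹ μ ≡ (γ ⊹ μ) ⊹ κ
  ⊹-exch γ κ μ = trans (⊹-assoc γ κ μ) (trans (cong (γ ⊹_) (⊹-comm κ μ)) (sym (⊹-assoc γ μ κ)))

  ⊹-cancel : ∀ γ κ → (γ ⊹ κ) ⊹ κ ≡ γ
  ⊹-cancel γ κ = trans (⊹-assoc γ κ κ) (trans (cong (γ ⊹_) (⊹-self κ)) (⊹-𝟘 γ))

  δ : G → ℕ
  δ γ = if does (γ ≟ᴳ 𝟘) then 1 else 0

  δ-cong : ∀ γ κ → (γ ≡ 𝟘 → κ ≡ 𝟘) → (κ ≡ 𝟘 → γ ≡ 𝟘) → δ γ ≡ δ κ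
  δ-cong γ κ to from with γ ≟ᴳ 𝟘 | κ ≟ᴳ 𝟘
  ... | yes _ | yes _ = refl
  ... | no _  | no _  = refl
  ... | yes p | no ¬q = contradiction (to p) ¬q
  ... | no ¬p | yes q = contradiction (from q) ¬p

  module _ {X : Set} (h : X → G) where

    -- Sets of size w with syndrome γ. Choosing x leaves the target γ - h x, which is γ ⊹ h x in
    -- exponent two. Keeping γ as an argument makes each count a function on the group, to which
    -- `toggle` applies.
    count : List X → ℕ → G → ℕ
    count []       zero    γ = δ γ
    count []       (suc w) γ = 0
    count (x ∷ xs) zero    γ = count xs zero γ
    count (x ∷ xs) (suc w) γ = count xs (suc w) γ + count xs w (γ ⊹ h x)

    count-zero : ∀ xs γ → count xs 0 γ ≡ δ γ
    count-zero []       γ = refl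
    count-zero (x ∷ xs) γ = count-zero xs γ

    count-↭ : ∀ {xs ys} → xs ↭ ys → ∀ w γ → count xs w γ ≡ count ys w γ
    count-↭ _↭_.refl w       γ = refl
    count-↭ (prep x p)   zero    γ = count-↭ p zero γ
    count-↭ (prep x p)   (suc w) γ = cong₂ _+_ (count-↭ p (suc w) γ) (count-↭ p w (γ ⊹ h x))
    count-↭ (swap x y p) zero    γ = count-↭ p zero γ
    count-↭ (swap {xs} {ys} x y p) (suc zero) γ =
      trans (cong₂ _+_ (cong₂ _+_ (count-↭ p 1 γ) (count-↭ p 0 _)) (count-↭ p 0 _))
            (solve 3 (λ a b c → a :+ b :+ c := a :+ c :+ b) refl (count ys 1 γ) (count ys 0 (γ ⊹ h y)) (count ys 0 (γ ⊹ h x)))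
      where open +-*-Solver
    count-↭ (swap {xs} {ys} x y p) (suc (suc w)) γ =
      trans (cong₂ _+_ (cong₂ _+_ (count-↭ p _ γ) (count-↭ p _ _))
                       (cong₂ _+_ (count-↭ p _ _) (trans (count-↭ p w _) (cong (count ys w) (⊹-exch γ (h x) (h y))))))
            (solve 4 (λ a b c d → a :+ b :+ (c :+ d) := a :+ c :+ (b :+ d)) refl
              (count ys (2 + w) γ) (count ys (1 + w) (γ ⊹ h y)) (count ys (1 + w) (γ ⊹ h x)) (count ys w (γ ⊹ h y ⊹ h x)))
      where open +-*-Solver
    count-↭ (_↭_.trans p p′) w γ = trans (count-↭ p w γ) (count-↭ p′ w γ)

    -- Convolution with the multiset of syndromes: k-fold application to `δ` counts k-tuples with
    -- sum γ, repetitions allowed.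
    toggle : List X → (G → ℕ) → G → ℕ
    toggle xs g γ = Σ[ xs ] (λ x → g (γ ⊹ h x))

    toggle-δ : ∀ xs γ → toggle xs δ γ ≡ count xs 1 γ
    toggle-δ []       γ = refl
    toggle-δ (x ∷ xs) γ = trans (cong₂ _+_ (sym (count-zero xs _)) (toggle-δ xs γ)) (ℕ.+-comm (count xs 0 (γ ⊹ h x)) (count xs 1 γ))

    -- Toggling a point turns a (w+1)-set into a (w+2)-set or a w-set; the term w * count xs w γ avoids the subtraction length xs ∸ w.
    toggle-count : ∀ xs w γ →
      toggle xs (count xs (suc w)) γ + w * count xs w γ ≡ (2 + w) * count xs (2 + w) γ + length xs * count xs w γ
    toggle-count [] zero    γ = refl
    toggle-count [] (suc w) γ = trans (ℕ.*-zeroʳ w) (sym (trans (cong (_+ 0) (ℕ.*-zeroʳ w)) refl))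
    toggle-count (x ∷ xs) zero γ = begin
      count xs 1 (γ ⊹ h x) + count xs 0 (γ ⊹ h x ⊹ h x)
        + Σ[ xs ] (λ y → count xs 1 (γ ⊹ h y) + count xs 0 (γ ⊹ h y ⊹ h x)) + 0
        ≡⟨ cong₂ (λ u v → count xs 1 (γ ⊹ h x) + u + v + 0)
             (cong (count xs 0) (⊹-cancel γ (h x)))
             (trans (Σ-+ xs _ _) (cong (toggle xs (count xs 1) γ +_)
               (trans (Σ-cong xs (λ y → trans (cong (count xs 0) (⊹-exch γ (h y) (h x))) (count-zero xs _))) (toggle-δ xs (γ ⊹ h x))))) ⟩
      c₁′ + c₀ + (U + c₁′) + 0
        ≡⟨ solve 3 (λ c₁′ c₀ U → c₁′ :+ c₀ :+ (U :+ c₁′) :+ con 0 := (U :+ con 0) :+ (c₀ :+ con 2 :* c₁′)) refl c₁′ c₀ U ⟩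
      (U + 0) + (c₀ + 2 * c₁′)
        ≡⟨ cong (_+ (c₀ + 2 * c₁′)) (toggle-count xs 0 γ) ⟩
      2 * count xs 2 γ + length xs * c₀ + (c₀ + 2 * c₁′)
        ≡⟨ solve 4 (λ c₂ l c₀ c₁′ → con 2 :* c₂ :+ l :* c₀ :+ (c₀ :+ con 2 :* c₁′) := con 2 :* (c₂ :+ c₁′) :+ (c₀ :+ l :* c₀)) refl (count xs 2 γ) (length xs) c₀ c₁′ ⟩
      2 * (count xs 2 γ + c₁′) + (c₀ + length xs * c₀) ∎
      where
      open +-*-Solver
      c₁′ = count xs 1 (γ ⊹ h x)
      c₀  = count xs 0 γ
      U   = toggle xs (count xs 1) γ
    toggle-count (x ∷ xs) (suc w) γ = begin
      count xs (2 + w) (γ ⊹ h x) + count xs (1 + w) (γ ⊹ h x ⊹ h x)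
        + Σ[ xs ] (λ y → count xs (2 + w) (γ ⊹ h y) + count xs (1 + w) (γ ⊹ h y ⊹ h x)) + (1 + w) * (c₁ + c₀′)
        ≡⟨ cong₂ (λ u v → c₂′ + u + v + (1 + w) * (c₁ + c₀′))
             (cong (count xs (1 + w)) (⊹-cancel γ (h x)))
             (trans (Σ-+ xs _ _) (cong (U +_) (Σ-cong xs (λ y → cong (count xs (1 + w)) (⊹-exch γ (h y) (h x)))))) ⟩
      c₂′ + c₁ + (U + U′) + (1 + w) * (c₁ + c₀′)
        ≡⟨ solve 6 (λ c₂′ c₁ U U′ w c₀′ → c₂′ :+ c₁ :+ (U :+ U′) :+ (con 1 :+ w) :* (c₁ :+ c₀′)
             := (U :+ (con 1 :+ w) :* c₁) :+ (U′ :+ w :* c₀′) :+ (c₂′ :+ c₁ :+ c₀′)) refl c₂′ c₁ U U′ w c₀′ ⟩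
      (U + (1 + w) * c₁) + (U′ + w * c₀′) + (c₂′ + c₁ + c₀′)
        ≡⟨ cong₂ (λ u v → u + v + (c₂′ + c₁ + c₀′)) (toggle-count xs (suc w) γ) (toggle-count xs w (γ ⊹ h x)) ⟩
      ((3 + w) * c₃ + l * c₁) + ((2 + w) * c₂′ + l * c₀′) + (c₂′ + c₁ + c₀′)
        ≡⟨ solve 6 (λ w l c₃ c₁ c₂′ c₀′ → ((con 3 :+ w) :* c₃ :+ l :* c₁) :+ ((con 2 :+ w) :* c₂′ :+ l :* c₀′) :+ (c₂′ :+ c₁ :+ c₀′)
             := (con 3 :+ w) :* (c₃ :+ c₂′) :+ (con 1 :+ l) :* (c₁ :+ c₀′)) refl w l c₃ c₁ c₂′ c₀′ ⟩
      (3 + w) * (c₃ + c₂′) + (1 + l) * (c₁ + c₀′) ∎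
      where
      open +-*-Solver
      l   = length xs
      c₁  = count xs (1 + w) γ
      c₃  = count xs (3 + w) γ
      c₂′ = count xs (2 + w) (γ ⊹ h x)
      c₀′ = count xs w (γ ⊹ h x)
      U   = toggle xs (count xs (2 + w)) γ
      U′  = toggle xs (count xs (1 + w)) (γ ⊹ h x)

    -- Double counting of (w+1)-sets with one marked point.
    count-picks : ∀ xs w γ → Σ[ picks xs ] (λ (x , r) → count r w (γ ⊹ h x)) ≡ suc w * count xs (suc w) γ
    count-picks []       w γ = sym (ℕ.*-zeroʳ w)
    count-picks (x ∷ xs) zero γ = begin
      c₀′ + Σ[ map _ (picks xs) ] _       ≡⟨ cong (c₀′ +_) (trans (Σ-map _ (picks xs) _) (count-picks xs zero γ)) ⟩
      c₀′ + 1 * count xs 1 γ              ≡⟨ solve 2 (λ a b → a :+ con 1 :* b := con 1 :* (b :+ a)) refl c₀′ (count xs 1 γ) ⟩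
      1 * (count xs 1 γ + c₀′)            ∎
      where
      open +-*-Solver
      c₀′ = count xs 0 (γ ⊹ h x)
    count-picks (x ∷ xs) (suc w) γ = begin
      c₁′ + Σ[ map _ (picks xs) ] _
        ≡⟨ cong (c₁′ +_) (trans (Σ-map _ (picks xs) _) (Σ-+ (picks xs) _ _)) ⟩
      c₁′ + (Σ[ picks xs ] (λ (y , r) → count r (suc w) (γ ⊹ h y)) + Σ[ picks xs ] (λ (y , r) → count r w (γ ⊹ h y ⊹ h x)))
        ≡⟨ cong₂ (λ u v → c₁′ + (u + v)) (count-picks xs (suc w) γ)
             (trans (Σ-cong (picks xs) (λ (y , r) → cong (count r w) (⊹-exch γ (h y) (h x)))) (count-picks xs w (γ ⊹ h x))) ⟩
      c₁′ + ((2 + w) * count xs (2 + w) γ + (1 + w) * c₁′)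
        ≡⟨ solve 3 (λ a b w → a :+ ((con 2 :+ w) :* b :+ (con 1 :+ w) :* a) := (con 2 :+ w) :* (b :+ a)) refl c₁′ (count xs (2 + w) γ) w ⟩
      (2 + w) * (count xs (2 + w) γ + c₁′) ∎
      where
      open +-*-Solver
      c₁′ = count xs (1 + w) (γ ⊹ h x)

    -- Listing the subsets of given size and syndrome that contain a given set

    syn : ∀ {n} → Vec X n → Subset n → G
    syn []       []          = 𝟘
    syn (p ∷ ps) (true ∷ B)  = syn ps B ⊹ h p
    syn (p ∷ ps) (false ∷ B) = syn ps B

    -- A position in `R` leaves no choice; any other position branches as in `count`.
    enum : ∀ {n} → Vec X n → Subset n → ℕ → G → List (Subset n)
    enum []       []          zero    γ = if does (γ ≟ᴳ 𝟘) then [] ∷ [] else []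
    enum []       []          (suc w) γ = []
    enum (p ∷ ps) (true ∷ R)  zero    γ = []
    enum (p ∷ ps) (true ∷ R)  (suc w) γ = map (true ∷_) (enum ps R w (γ ⊹ h p))
    enum (p ∷ ps) (false ∷ R) zero    γ = map (false ∷_) (enum ps R zero γ)
    enum (p ∷ ps) (false ∷ R) (suc w) γ = map (false ∷_) (enum ps R (suc w) γ) ++ map (true ∷_) (enum ps R w (γ ⊹ h p))

    private
      ∷-disjoint : ∀ {n} {xs ys : List (Subset n)} {B : Subset (suc n)} → ¬ (B ∈ map (false ∷_) xs × B ∈ map (true ∷_) ys)
      ∷-disjoint (p , q) with ∈-map⁻ (false ∷_) p | ∈-map⁻ (true ∷_) q
      ... | _ , _ , refl | _ , _ , ()

      unique-∷ : ∀ {n} b {xs : List (Subset n)} → Unique xs → Unique (map (b ∷_) xs)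
      unique-∷ b = UniqueP.map⁺ (λ { refl → refl })

    enum-unique : ∀ {n} (ps : Vec X n) R w γ → Unique (enum ps R w γ)
    enum-unique [] [] zero γ with does (γ ≟ᴳ 𝟘)
    ... | true  = [] ∷ []
    ... | false = []
    enum-unique [] [] (suc w) γ = []
    enum-unique (p ∷ ps) (true ∷ R)  zero    γ = []
    enum-unique (p ∷ ps) (true ∷ R)  (suc w) γ = unique-∷ true (enum-unique ps R w _)
    enum-unique (p ∷ ps) (false ∷ R) zero    γ = unique-∷ false (enum-unique ps R zero γ)
    enum-unique (p ∷ ps) (false ∷ R) (suc w) γ =
      UniqueP.++⁺ (unique-∷ false (enum-unique ps R (suc w) γ)) (unique-∷ true (enum-unique ps R w _)) ∷-disjoint

    ∈-enum⁺ : ∀ {n} (ps : Vec X n) R {w} γ B → ∣ B ∣ ≡ w → syn ps B ≡ γ → R ⊆ B → B ∈ enum ps R w γ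
    ∈-enum⁺ [] [] {w} γ [] refl s sub with γ ≟ᴳ 𝟘
    ... | yes _ = here refl
    ... | no ¬z = contradiction (sym s) ¬z
    ∈-enum⁺ (p ∷ ps) (true ∷ R) γ (true ∷ B) refl refl sub =
      ∈-map⁺ (true ∷_) (∈-enum⁺ ps R _ B refl (sym (⊹-cancel _ (h p))) (Sub.drop-∷-⊆ sub))
    ∈-enum⁺ (p ∷ ps) (true ∷ R) γ (false ∷ B) c s sub with () ← sub here
    ∈-enum⁺ (p ∷ ps) (false ∷ R) γ (true ∷ B) refl refl sub =
      ∈-++⁺ʳ (map (false ∷_) (enum ps R _ γ)) (∈-map⁺ (true ∷_) (∈-enum⁺ ps R _ B refl (sym (⊹-cancel _ (h p))) (Sub.drop-∷-⊆ sub)))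
    ∈-enum⁺ (p ∷ ps) (false ∷ R) {zero} γ (false ∷ B) c s sub =
      ∈-map⁺ (false ∷_) (∈-enum⁺ ps R γ B c s (Sub.drop-∷-⊆ sub))
    ∈-enum⁺ (p ∷ ps) (false ∷ R) {suc w} γ (false ∷ B) c s sub =
      ∈-++⁺ˡ (∈-map⁺ (false ∷_) (∈-enum⁺ ps R γ B c s (Sub.drop-∷-⊆ sub)))

    ∈-enum⁻ : ∀ {n} (ps : Vec X n) R w γ {B} → B ∈ enum ps R w γ → ∣ B ∣ ≡ w × syn ps B ≡ γ × R ⊆ B
    private
      with-point : ∀ {n} p (ps : Vec X n) R b w γ → ((b ∷ R) ⊆ (true ∷ R)) → ∀ {B} → B ∈ map (true ∷_) (enum ps R w (γ ⊹ h p)) →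
        ∣ B ∣ ≡ suc w × syn (p ∷ ps) B ≡ γ × (b ∷ R) ⊆ B
      without-point : ∀ {n} p (ps : Vec X n) R w γ {B} → B ∈ map (false ∷_) (enum ps R w γ) →
        ∣ B ∣ ≡ w × syn (p ∷ ps) B ≡ γ × (false ∷ R) ⊆ B
      with-point p ps R b w γ sub q with ∈-map⁻ (true ∷_) q
      ... | B , B∈ , refl with ∈-enum⁻ ps R w _ B∈
      ... | c , s , r = cong suc c , trans (cong (_⊹ h p) s) (⊹-cancel γ (h p)) , λ i → Sub.in⊆in r (sub i)
      without-point p ps R w γ q with ∈-map⁻ (false ∷_) q
      ... | B , B∈ , refl with ∈-enum⁻ ps R w γ B∈
      ... | c , s , r = c , s , Sub.out⊆ r

    ∈-enum⁻ [] [] zero γ q with γ ≟ᴳ 𝟘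
    ∈-enum⁻ [] [] zero γ (here refl) | yes z = refl , sym z , id
    ∈-enum⁻ (p ∷ ps) (true ∷ R)  (suc w) γ q = with-point p ps R true w γ id q
    ∈-enum⁻ (p ∷ ps) (false ∷ R) zero    γ q = without-point p ps R zero γ q
    ∈-enum⁻ (p ∷ ps) (false ∷ R) (suc w) γ q with ∈-++⁻ (map (false ∷_) (enum ps R (suc w) γ)) q
    ... | inj₁ q′ = without-point p ps R (suc w) γ q′
    ... | inj₂ q′ = with-point p ps R false w γ (Sub.out⊆ id) q′

    selected unselected : ∀ {n} → Vec X n → Subset n → List X
    selected []       []          = []
    selected (p ∷ ps) (true ∷ R)  = p ∷ selected ps R
    selected (p ∷ ps) (false ∷ R) = selected ps R
    unselected []       []          = []
    unselected (p ∷ ps) (true ∷ R)  = unselected ps R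
    unselected (p ∷ ps) (false ∷ R) = p ∷ unselected ps R

    length-selected : ∀ {n} (ps : Vec X n) R → length (selected ps R) ≡ ∣ R ∣
    length-selected []       []          = refl
    length-selected (p ∷ ps) (true ∷ R)  = cong suc (length-selected ps R)
    length-selected (p ∷ ps) (false ∷ R) = length-selected ps R

    selected-↭ : ∀ {n} (ps : Vec X n) R → selected ps R ++ unselected ps R ↭ toList ps
    selected-↭ []       []          = ↭-refl
    selected-↭ (p ∷ ps) (true ∷ R)  = prep p (selected-↭ ps R)
    selected-↭ (p ∷ ps) (false ∷ R) = ↭-trans (Perm.shift p (selected ps R) _) (prep p (selected-↭ ps R))

    total : List X → G
    total []       = 𝟘
    total (x ∷ xs) = total xs ⊹ h x

    enum-short : ∀ {n} (ps : Vec X n) R {w} γ → w < ∣ R ∣ → enum ps R w γ ≡ []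
    enum-short (p ∷ ps) (true ∷ R)  {zero}  γ _         = refl
    enum-short (p ∷ ps) (true ∷ R)  {suc w} γ (s≤s w<R) = cong (map (true ∷_)) (enum-short ps R _ w<R)
    enum-short (p ∷ ps) (false ∷ R) {zero}  γ 0<R       = cong (map (false ∷_)) (enum-short ps R γ 0<R)
    enum-short (p ∷ ps) (false ∷ R) {suc w} γ w<R       =
      cong₂ (λ xs ys → map (false ∷_) xs ++ map (true ∷_) ys) (enum-short ps R γ w<R) (enum-short ps R _ (ℕ.<⇒≤ w<R))

    -- The points of `R` are forced, so their syndrome moves into the target and k free points
    -- remain to be chosen. For k = 0, `enum` may still branch on a point outside `R`; `enum-short`
    -- shows that this branch is empty.
    length-enum : ∀ {n} (ps : Vec X n) R k γ →
      length (enum ps R (k + ∣ R ∣) γ) ≡ count (unselected ps R) k (γ ⊹ total (selected ps R))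
    private
      length-enum-tight : ∀ {n} p (ps : Vec X n) R γ →
        length (enum (p ∷ ps) (false ∷ R) ∣ R ∣ γ) ≡ length (enum ps R ∣ R ∣ γ)
      length-enum-tight p ps R γ with ∣ R ∣ in eq
      ... | zero  = length-map _ (enum ps R zero γ)
      ... | suc w = trans (length-++ (map (false ∷_) (enum ps R (suc w) γ)))
        (trans (cong₂ _+_ (length-map _ (enum ps R (suc w) γ))
                 (cong (length ∘ map (true ∷_)) (enum-short ps R (γ ⊹ h p) (subst (w <_) (sym eq) ℕ.≤-refl)))) (ℕ.+-identityʳ _))

    length-enum [] [] zero γ rewrite ⊹-𝟘 γ with does (γ ≟ᴳ 𝟘)
    ... | true  = refl
    ... | false = refl
    length-enum [] [] (suc k) γ = refl
    length-enum (p ∷ ps) (true ∷ R) k γ rewrite ℕ.+-suc k ∣ R ∣ =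
      trans (length-map _ (enum ps R (k + ∣ R ∣) _))
            (trans (length-enum ps R k _) (cong (count (unselected ps R) k)
              (trans (⊹-exch γ (h p) _) (⊹-assoc γ _ (h p)))))
    length-enum (p ∷ ps) (false ∷ R) zero γ = trans (length-enum-tight p ps R γ) (length-enum ps R zero γ)
    length-enum (p ∷ ps) (false ∷ R) (suc k) γ =
      trans (length-++ (map (false ∷_) (enum ps R (suc k + ∣ R ∣) γ)))
        (cong₂ _+_ (trans (length-map _ (enum ps R (suc k + ∣ R ∣) γ)) (length-enum ps R (suc k) γ))
                   (trans (length-map _ (enum ps R (k + ∣ R ∣) _)) (trans (length-enum ps R k _)
                     (cong (count (unselected ps R) k) (⊹-exch γ (h p) _)))))

  -- Invariance of the counts under affine maps

  module _ {X Y : Set} (h : X → G) (h′ : Y → G) (φ : X → Y) (A : G → G) (κ : G)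
    (A-⊹ : ∀ γ μ → A (γ ⊹ μ) ≡ A γ ⊹ A μ) (A-injective : ∀ γ → A γ ≡ 𝟘 → γ ≡ 𝟘)
    (h′-φ : ∀ x → h′ (φ x) ≡ A (h x) ⊹ κ) where

    -- Each of the w chosen points contributes its own translation by κ.
    shift : ℕ → G → G
    shift zero    γ = γ
    shift (suc w) γ = shift w γ ⊹ κ

    shift-⊹ : ∀ w γ μ → shift w (γ ⊹ μ) ≡ shift w γ ⊹ μ
    shift-⊹ zero    γ μ = refl
    shift-⊹ (suc w) γ μ = trans (cong (_⊹ κ) (shift-⊹ w γ μ)) (⊹-exch _ μ κ)

    A-𝟘 : A 𝟘 ≡ 𝟘
    A-𝟘 = trans (cong A (sym (⊹-self 𝟘))) (trans (A-⊹ 𝟘 𝟘) (⊹-self (A 𝟘)))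

    count-affine : ∀ xs w γ → count h′ (map φ xs) w (shift w (A γ)) ≡ count h xs w γ
    count-affine []       zero    γ = δ-cong (A γ) γ (A-injective γ) (λ z → trans (cong A z) A-𝟘)
    count-affine []       (suc w) γ = refl
    count-affine (x ∷ xs) zero    γ = count-affine xs zero γ
    count-affine (x ∷ xs) (suc w) γ = cong₂ _+_ (count-affine xs (suc w) γ)
      (trans (cong (count h′ (map φ xs) w) step) (count-affine xs w (γ ⊹ h x)))
      where
      step : shift w (A γ) ⊹ κ ⊹ h′ (φ x) ≡ shift w (A (γ ⊹ h x))
      step = begin
        shift w (A γ) ⊹ κ ⊹ h′ (φ x)       ≡⟨ cong (shift w (A γ) ⊹ κ ⊹_) (h′-φ x) ⟩
        shift w (A γ) ⊹ κ ⊹ (A (h x) ⊹ κ)  ≡⟨ sym (⊹-assoc _ (A (h x)) κ) ⟩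
        shift w (A γ) ⊹ κ ⊹ A (h x) ⊹ κ    ≡⟨ cong (_⊹ κ) (⊹-exch _ κ (A (h x))) ⟩
        shift w (A γ) ⊹ A (h x) ⊹ κ ⊹ κ    ≡⟨ ⊹-cancel _ κ ⟩
        shift w (A γ) ⊹ A (h x)            ≡⟨ sym (shift-⊹ w (A γ) (A (h x))) ⟩
        shift w (A γ ⊹ A (h x))            ≡⟨ cong (shift w) (sym (A-⊹ γ (h x))) ⟩
        shift w (A (γ ⊹ h x))              ∎

Unique-resp-↭ : ∀ {A : Set} {xs ys : List A} → xs ↭ ys → Unique xs → Unique ys
Unique-resp-↭ {A} p = PermS.Unique-resp-↭ (setoid A) (↭⇒↭ₛ p)

∣pair∣ : ∀ {n} (i j : Fin n) → i ≢ j → ∣ ⁅ i ⁆ ∪ ⁅ j ⁆ ∣ ≡ 2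
∣pair∣ Fin.zero    Fin.zero    i≢j = contradiction refl i≢j
∣pair∣ Fin.zero    (Fin.suc j) i≢j = cong suc (trans (cong ∣_∣ (Sub.∪-identityˡ ⁅ j ⁆)) (Sub.∣⁅x⁆∣≡1 j))
∣pair∣ (Fin.suc i) Fin.zero    i≢j = cong suc (trans (cong ∣_∣ (Sub.∪-identityʳ ⁅ i ⁆)) (Sub.∣⁅x⁆∣≡1 i))
∣pair∣ (Fin.suc i) (Fin.suc j) i≢j = ∣pair∣ i j (i≢j ∘ cong Fin.suc)

-- Univariate polynomials over ℕ; identities are decided on coefficient lists, where large constants stay binary numerals.

infixl 6 _:+:_
infixl 7 _:*:_

data Expr : Set where
  num         : ℕ → Expr
  var         : Expr
  _:+:_ _:*:_ : Expr → Expr → Expr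

⟦_⟧ₑ : Expr → ℕ → ℕ
⟦ num c ⟧ₑ   r = c
⟦ var ⟧ₑ     r = r
⟦ a :+: b ⟧ₑ r = ⟦ a ⟧ₑ r + ⟦ b ⟧ₑ r
⟦ a :*: b ⟧ₑ r = ⟦ a ⟧ₑ r * ⟦ b ⟧ₑ r

horner : List ℕ → ℕ → ℕ
horner []      r = 0
horner (c ∷ p) r = c + r * horner p r

infixl 6 _+ₗ_
infixl 7 _*ₗ_

_+ₗ_ : List ℕ → List ℕ → List ℕ
[]      +ₗ q       = q
(c ∷ p) +ₗ []      = c ∷ p
(c ∷ p) +ₗ (d ∷ q) = c + d ∷ (p +ₗ q)

_*ₗ_ : List ℕ → List ℕ → List ℕ
[]      *ₗ q = []
(c ∷ p) *ₗ q = map (c *_) q +ₗ (0 ∷ (p *ₗ q))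

coefficients : Expr → List ℕ
coefficients (num c)   = c ∷ []
coefficients var       = 0 ∷ 1 ∷ []
coefficients (a :+: b) = coefficients a +ₗ coefficients b
coefficients (a :*: b) = coefficients a *ₗ coefficients b

horner-+ : ∀ p q r → horner (p +ₗ q) r ≡ horner p r + horner q r
horner-+ []      q       r = refl
horner-+ (c ∷ p) []      r = sym (ℕ.+-identityʳ _)
horner-+ (c ∷ p) (d ∷ q) r = trans (cong (λ s → c + d + r * s) (horner-+ p q r))
  (solve 5 (λ c d r x y → c :+ d :+ r :* (x :+ y) := c :+ r :* x :+ (d :+ r :* y)) refl c d r (horner p r) (horner q r))
  where open +-*-Solver hiding (var)

horner-scale : ∀ c p r → horner (map (c *_) p) r ≡ c * horner p r
horner-scale c []      r = sym (ℕ.*-zeroʳ c)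
horner-scale c (d ∷ p) r = trans (cong (λ s → c * d + r * s) (horner-scale c p r))
  (solve 4 (λ c d r x → c :* d :+ r :* (c :* x) := c :* (d :+ r :* x)) refl c d r (horner p r))
  where open +-*-Solver hiding (var)

horner-* : ∀ p q r → horner (p *ₗ q) r ≡ horner p r * horner q r
horner-* []      q r = refl
horner-* (c ∷ p) q r = begin
  horner (map (c *_) q +ₗ (0 ∷ (p *ₗ q))) r        ≡⟨ horner-+ (map (c *_) q) _ r ⟩
  horner (map (c *_) q) r + r * horner (p *ₗ q) r  ≡⟨ cong₂ (λ s t → s + r * t) (horner-scale c q r) (horner-* p q r) ⟩
  c * horner q r + r * (horner p r * horner q r)   ≡⟨ solve 4 (λ c r x y → c :* y :+ r :* (x :* y) := (c :+ r :* x) :* y) refl c r (horner p r) (horner q r) ⟩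
  (c + r * horner p r) * horner q r                ∎
  where open +-*-Solver hiding (var)

horner-coefficients : ∀ e r → ⟦ e ⟧ₑ r ≡ horner (coefficients e) r
horner-coefficients (num c)   r = sym (trans (cong (c +_) (ℕ.*-zeroʳ r)) (ℕ.+-identityʳ c))
horner-coefficients var       r = sym (trans (cong (r *_) (trans (cong suc (ℕ.*-zeroʳ r)) refl)) (ℕ.*-identityʳ r))
horner-coefficients (a :+: b) r = trans (cong₂ _+_ (horner-coefficients a r) (horner-coefficients b r)) (sym (horner-+ (coefficients a) (coefficients b) r))
horner-coefficients (a :*: b) r = trans (cong₂ _*_ (horner-coefficients a r) (horner-coefficients b r)) (sym (horner-* (coefficients a) (coefficients b) r))

agree : List ℕ → List ℕ → Bool
agree []      []      = true
agree []      (d ∷ q) = (0 ≡ᵇ d) ∧ agree [] q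
agree (c ∷ p) []      = (c ≡ᵇ 0) ∧ agree p []
agree (c ∷ p) (d ∷ q) = (c ≡ᵇ d) ∧ agree p q

agree-sound : ∀ p q → T (agree p q) → ∀ r → horner p r ≡ horner q r
agree-sound []      []      t r = refl
agree-sound []      (d ∷ q) t r with Equivalence.to Bool.T-∧ t
... | t₁ , t₂ = trans (sym (ℕ.*-zeroʳ r)) (cong₂ (λ c x → c + r * x) (ℕ.≡ᵇ⇒≡ 0 d t₁) (agree-sound [] q t₂ r))
agree-sound (c ∷ p) []      t r with Equivalence.to Bool.T-∧ t
... | t₁ , t₂ = trans (cong₂ (λ c x → c + r * x) (ℕ.≡ᵇ⇒≡ c 0 t₁) (agree-sound p [] t₂ r)) (ℕ.*-zeroʳ r)
agree-sound (c ∷ p) (d ∷ q) t r with Equivalence.to Bool.T-∧ t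
... | t₁ , t₂ = cong₂ (λ c x → c + r * x) (ℕ.≡ᵇ⇒≡ c d t₁) (agree-sound p q t₂ r)

polynomial-identity : ∀ a b {_ : T (agree (coefficients a) (coefficients b))} r → ⟦ a ⟧ₑ r ≡ ⟦ b ⟧ₑ r
polynomial-identity a b {t} r = trans (horner-coefficients a r) (trans (agree-sound (coefficients a) (coefficients b) t r) (sym (horner-coefficients b r)))

cancel-+ : ∀ a {x y s} → a + x ≡ s → s ≡ a + y → x ≡ y
cancel-+ a e e′ = ℕ.+-cancelˡ-≡ a _ _ (trans e e′)

record Row : Set where
  constructor row
  field
    c₀ c₁ c₂ c₃ c₄ : Expr

open Row

𝕢 : Expr
𝕢 = num 16 :+: var

-- Row k of momentRow holds the parameters of Shape, and row k of countRow the coefficients with respect to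
-- count 0, 2, 4, 6, 8, of the k-th iterate of E ∘ E on δ. Everything is a polynomial in r = 2^m − 16.
momentRow : ℕ → Row
momentRow zero    = row (num 0) (num 0) (num 0) (num 1) (num 0)
momentRow (suc k) = next (momentRow k)
  where
  next : Row → Row
  next (row x y x₀ z w) = row
    (𝕢 :*: x :+: (𝕢 :*: x₀ :+: w :*: (var :*: 𝕢)) :+: ((num 14 :+: var) :*: (𝕢 :*: x) :+: y :*: (var :*: 𝕢)))
    (𝕢 :*: y :+: (z :+: w :*: (num 15 :*: 𝕢)) :+: y :*: (num 14 :*: 𝕢))
    (𝕢 :*: x₀ :+: (num 15 :+: var) :*: (𝕢 :*: x))
    (𝕢 :*: z)
    (𝕢 :*: w :+: y :*: 𝕢)

countRow : ℕ → Row
countRow zero    = row (num 1) (num 0) (num 0) (num 0) (num 0)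
countRow (suc k) = next (countRow k)
  where
  next : Row → Row
  next (row a b c d _) = row
    (𝕢 :*: a :+: (num 15 :+: var) :*: 𝕢 :*: b)
    (num 2 :*: a :+: (num 72 :+: num 5 :*: var) :*: b :+: (num 13 :+: var) :*: (num 14 :+: var) :*: c)
    (num 12 :*: b :+: (num 112 :+: num 9 :*: var) :*: c :+: (num 11 :+: var) :*: (num 12 :+: var) :*: d)
    (num 30 :*: c :+: (num 136 :+: num 13 :*: var) :*: d)
    (num 56 :*: d)

-- N_2k, the value of the iterate at (0, 0): there the indicator of 0 is 1, and each of the 15 + r
-- hyperplanes contributes 4, the size of the kernel of x ↦ x^Q + x.
momentValue : ℕ → Expr
momentValue k = c₂ (momentRow k) :+: (c₃ (momentRow k) :+: c₄ (momentRow k) :*: (num 4 :*: (num 15 :+: var)))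

-- 12, 720 and 40320 times the number of codewords of weight 4, 6 and 8, and 720 λ.
weight₄ weight₆ weight₈ λ-polynomial : Expr
weight₄ = 𝕢 :*: (num 15 :+: var)
weight₆ = weight₄ :*: (𝕢 :*: 𝕢 :+: num 8 :*: 𝕢 :+: num 96)
weight₈ = weight₄ :*: λ-polynomial
λ-polynomial = num 25200 :+: num 2580 :*: var :+: num 424 :*: (var :*: var) :+: num 37 :*: (var :*: var :*: var) :+: var :*: var :*: var :*: var

-- The entries for count 4 in rows 3 and 4, divided by 12, and the entry for count 6 in row 4, divided by 720.
cofactor₃ cofactor₄ cofactor₄′ : Expr
cofactor₃  = num 400 :+: num 30 :*: var
cofactor₄  = num 71232 :+: num 10920 :*: var :+: num 420 :*: (var :*: var)
cofactor₄′ = num 336 :+: num 28 :*: var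

-- Back substitution in the triangular system of moment equations

record Linear (N a b c d e x₂ x₄ x₆ x₈ : ℕ) : Set where
  constructor linear
  field
    linear-equation : a * 1 + (b * x₂ + (c * x₄ + (d * x₆ + e * x₈))) ≡ N

solve₁ : ∀ {N a b c d e x₂ x₄ x₆ x₈} → Linear N a b c d e x₂ x₄ x₆ x₈ → N ≡ a → b ≡ 2 → x₂ ≡ 0
solve₁ {a = a} {b} {x₂ = x₂} (linear eq) N≡a refl = ℕ.*-cancelˡ-≡ x₂ 0 2 (ℕ.m+n≡0⇒m≡0 (2 * x₂)
  (cancel-+ (a * 1) eq (trans N≡a (sym (trans (ℕ.+-identityʳ (a * 1)) (ℕ.*-identityʳ a))))))

-- No weight count is ever isolated by division: the product u · x₄ is determined, and the later
-- rows have coefficients of x₄ that are multiples of the same u.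
solve₂ : ∀ {N a b c d e x₂ x₄ x₆ x₈ u X} → Linear N a b c d e x₂ x₄ x₆ x₈ →
  x₂ ≡ 0 → c ≡ 2 * u → d ≡ 0 → e ≡ 0 → N ≡ a + 2 * X → u * x₄ ≡ X
solve₂ {a = a} {b} {x₄ = x₄} {x₆} {x₈} {u} {X} (linear eq) refl refl refl refl N≡ =
  ℕ.*-cancelˡ-≡ (u * x₄) X 2 (cancel-+ a (trans (sym (split a b u x₄ x₆ x₈)) eq) N≡)
  where
  split : ∀ a b u x₄ x₆ x₈ → a * 1 + (b * 0 + (2 * u * x₄ + (0 * x₆ + 0 * x₈))) ≡ a + 2 * (u * x₄)
  split = solve-∀

solve₃ : ∀ {N a b c c′ d d′ e x₂ x₄ x₆ x₈ u X₄ X₆} → Linear N a b c d e x₂ x₄ x₆ x₈ →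
  x₂ ≡ 0 → c ≡ c′ * u → u * x₄ ≡ X₄ → d ≡ d′ → e ≡ 0 → N ≡ a + c′ * X₄ + X₆ → d′ * x₆ ≡ X₆
solve₃ {a = a} {b} {c′ = c′} {d} {x₄ = x₄} {x₆} {x₈} {u} {X₄} (linear eq) refl refl refl refl refl N≡ =
  cancel-+ (a + c′ * (u * x₄)) (trans (sym (split a b c′ u d x₄ x₆ x₈)) eq) N≡
  where
  split : ∀ a b c′ u d x₄ x₆ x₈ → a * 1 + (b * 0 + (c′ * u * x₄ + (d * x₆ + 0 * x₈))) ≡ a + c′ * (u * x₄) + d * x₆
  split = solve-∀

solve₄ : ∀ {N a b c c′ d d′ e e′ x₂ x₄ x₆ x₈ u v X₄ X₆ X₈} → Linear N a b c d e x₂ x₄ x₆ x₈ →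
  x₂ ≡ 0 → c ≡ c′ * u → u * x₄ ≡ X₄ → d ≡ d′ * v → v * x₆ ≡ X₆ → e ≡ e′ → N ≡ a + c′ * X₄ + d′ * X₆ + X₈ → e′ * x₈ ≡ X₈
solve₄ {a = a} {b} {c′ = c′} {d′ = d′} {e} {x₄ = x₄} {x₆} {x₈} {u} {v} (linear eq) refl refl refl refl refl refl N≡ =
  cancel-+ (a + c′ * (u * x₄) + d′ * (v * x₆)) (trans (sym (split a b c′ u d′ v e x₄ x₆ x₈)) eq) N≡
  where
  split : ∀ a b c′ u d′ v e x₄ x₆ x₈ →
    a * 1 + (b * 0 + (c′ * u * x₄ + (d′ * v * x₆ + e * x₈))) ≡ a + c′ * (u * x₄) + d′ * (v * x₆) + e * x₈
  split = solve-∀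

-- Serves to cancel q (q - 1) between the count of marked sets and the closed form of the weight.
double-counting : ∀ {c x a b Λ v W P} .{{_ : NonZero (a * b)}} → c * x ≡ W → x ≡ a * (b * Λ) → W ≡ v * P → v ≡ a * b → c * Λ ≡ P
double-counting {c} {_} {a} {b} {Λ} {P = P} refl refl W≡ refl = ℕ.*-cancelˡ-≡ (c * Λ) P (a * b) (trans (regroup a b c Λ) W≡)
  where
  regroup : ∀ a b c d → a * b * (c * d) ≡ c * (a * (b * d))
  regroup = solve-∀

-- Powers of two and the stated form of λ

16^k≡1+15l : ∀ k → ∃ λ l → 2 ^ (k * 4) ≡ 1 + l * 15
16^k≡1+15l zero    = 0 , refl
16^k≡1+15l (suc k) with 16^k≡1+15l k
... | l , eq = 1 + l * 16 , (begin
  2 ^ (4 + k * 4)        ≡⟨ ℕ.^-distribˡ-+-* 2 4 (k * 4) ⟩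
  16 * 2 ^ (k * 4)       ≡⟨ cong (16 *_) eq ⟩
  16 * (1 + l * 15)      ≡⟨ expand l ⟩
  1 + (1 + l * 16) * 15  ∎)
  where
  expand : ∀ l → 16 * (1 + l * 15) ≡ 1 + (1 + l * 16) * 15
  expand = solve-∀

2^[b∸a]*2^a : ∀ {a b} → a ≤ b → 2 ^ a * 2 ^ (b ∸ a) ≡ 2 ^ b
2^[b∸a]*2^a {a} {b} a≤b = trans (sym (ℕ.^-distribˡ-+-* 2 a (b ∸ a))) (cong (2 ^_) (ℕ.m+[n∸m]≡n a≤b))

-- Multiplying by 16 removes the shifted exponents: 16 · 23 / 2 = 184, 16 · 261 / 4 = 1044, 16 · 403
-- = 6448 and 16 · 45 = 720. With the cubic term on the left, the truncated subtraction is undone by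
-- `m+n∸n≡m`.
λ-numerator≡ : ∀ m Λ {X} → 4 ≤ m → 2 ^ m ≡ X →
  720 * Λ + 27 * (X * X * X) ≡ X * X * X * X + 184 * (X * X) + 1044 * X + 6448 → 45 * Λ ≡ λ-numerator m
λ-numerator≡ m Λ {X} 4≤m 2^m≡X eq = sym (begin
  a + 23 * b + 261 * c + 403 ∸ 27 * d  ≡⟨ cong (_∸ 27 * d) (sym sum≡) ⟩
  45 * Λ + 27 * d ∸ 27 * d             ≡⟨ ℕ.m+n∸n≡m (45 * Λ) (27 * d) ⟩
  45 * Λ                               ∎)
  where
  a b c d : ℕ
  a = 2 ^ (4 * m ∸ 4)
  b = 2 ^ (2 * m ∸ 1)
  c = 2 ^ (m ∸ 2)
  d = 2 ^ (3 * m ∸ 4)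
  1*m≤ : ∀ k {i} → i ≤ m → i ≤ suc k * m
  1*m≤ k i≤m = ℕ.≤-trans i≤m (ℕ.m≤m+n m (k * m))
  power : ∀ k → 2 ^ (k * m) ≡ X ^ k
  power k = trans (cong (2 ^_) (ℕ.*-comm k m)) (trans (sym (ℕ.^-*-assoc 2 m k)) (cong (_^ k) 2^m≡X))
  16a : 2 ^ 4 * a ≡ X * X * X * X
  16a = trans (2^[b∸a]*2^a (1*m≤ 3 4≤m)) (trans (power 4) (normal X))
    where
    normal : ∀ X → X * (X * (X * (X * 1))) ≡ X * X * X * X
    normal = solve-∀
  16d : 2 ^ 4 * d ≡ X * X * X
  16d = trans (2^[b∸a]*2^a (1*m≤ 2 4≤m)) (trans (power 3) (normal X))
    where
    normal : ∀ X → X * (X * (X * 1)) ≡ X * X * X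
    normal = solve-∀
  2b : 2 ^ 1 * b ≡ X * X
  2b = trans (2^[b∸a]*2^a (1*m≤ 1 (ℕ.≤-trans (s≤s z≤n) 4≤m))) (trans (power 2) (cong (X *_) (ℕ.*-identityʳ X)))
  4c : 2 ^ 2 * c ≡ X
  4c = trans (2^[b∸a]*2^a (ℕ.≤-trans (s≤s (s≤s z≤n)) 4≤m)) 2^m≡X
  sum≡ : 45 * Λ + 27 * d ≡ a + 23 * b + 261 * c + 403
  sum≡ = ℕ.*-cancelˡ-≡ _ _ 16 (begin
    16 * (45 * Λ + 27 * d)                                          ≡⟨ trans (ℕ.*-distribˡ-+ 16 (45 * Λ) (27 * d)) (cong₂ _+_ (sym (ℕ.*-assoc 16 45 Λ)) (exchange 16 27 d)) ⟩
    720 * Λ + 27 * (16 * d)                                         ≡⟨ cong (λ i → 720 * Λ + 27 * i) 16d ⟩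
    720 * Λ + 27 * (X * X * X)                                      ≡⟨ eq ⟩
    X * X * X * X + 184 * (X * X) + 1044 * X + 6448                 ≡⟨ cong (_+ 6448) (cong₂ _+_ (cong₂ _+_ (sym 16a) (cong (184 *_) (sym 2b))) (cong (1044 *_) (sym 4c))) ⟩
    16 * a + 184 * (2 * b) + 1044 * (4 * c) + 6448                  ≡⟨ cong (_+ 6448) (cong₂ _+_ (cong (16 * a +_) (rescale 184 2 16 23 b refl)) (rescale 1044 4 16 261 c refl)) ⟩
    16 * a + 16 * (23 * b) + 16 * (261 * c) + 6448                  ≡⟨ factor 16 a (23 * b) (261 * c) 403 ⟩
    16 * (a + 23 * b + 261 * c + 403)                               ∎)
    where
    exchange : ∀ x y z → x * (y * z) ≡ y * (x * z)
    exchange = solve-∀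
    rescale : ∀ s t u v x → s * t ≡ u * v → s * (t * x) ≡ u * (v * x)
    rescale s t u v x st≡uv = trans (sym (ℕ.*-assoc s t x)) (trans (cong (_* x) st≡uv) (ℕ.*-assoc u v x))
    factor : ∀ u a b c d → u * a + u * b + u * c + u * d ≡ u * (a + b + c + d)
    factor = solve-∀

-- Finite fields of characteristic two

module Field {m : ℕ} (K : GF2^ m) where

  open GF2^ K public renaming (_+_ to infixl 6 _⊞_; _*_ to infixl 7 _·_; _^_ to infixr 8 _↑_; -_ to ⊟_)

  module R = IsCommutativeRing isCommutativeRing

  commutativeRing : CommutativeRing _ _
  commutativeRing = record { isCommutativeRing = isCommutativeRing }

  to : F → Fin (2 ^ m)
  to = Inverse.to size

  from : Fin (2 ^ m) → F
  from = Inverse.from size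

  from-to : ∀ x → from (to x) ≡ x
  from-to x = Inverse.strictlyInverseʳ size x

  to-from : ∀ i → to (from i) ≡ i
  to-from i = Inverse.strictlyInverseˡ size i

  to-injective : ∀ {x y} → to x ≡ to y → x ≡ y
  to-injective {x} {y} e = trans (sym (from-to x)) (trans (cong from e) (from-to y))

  infix 4 _≟_
  abstract
    _≟_ : (x y : F) → Dec (x ≡ y)
    x ≟ y = Dec.map′ to-injective (cong to) (to x FinP.≟ to y)

  no-zero-divisors : ∀ x y → x ≢ 0# → x · y ≡ 0# → y ≡ 0#
  no-zero-divisors x y x≢0 xy≡0 with inverse x x≢0
  ... | z , xz≡1 = begin
    y            ≡⟨ sym (R.*-identityˡ y) ⟩
    1# · y       ≡⟨ cong (_· y) (trans (sym xz≡1) (R.*-comm x z)) ⟩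
    z · x · y    ≡⟨ R.*-assoc z x y ⟩
    z · (x · y)  ≡⟨ cong (z ·_) xy≡0 ⟩
    z · 0#       ≡⟨ R.zeroʳ z ⟩
    0#           ∎

  ·-nonzero : ∀ {x y} → x ≢ 0# → y ≢ 0# → x · y ≢ 0#
  ·-nonzero x≢0 y≢0 e = y≢0 (no-zero-divisors _ _ x≢0 e)

  ↑-nonzero : ∀ {x} k → x ≢ 0# → x ↑ k ≢ 0#
  ↑-nonzero zero    x≢0 e = 0≢1 (sym e)
  ↑-nonzero (suc k) x≢0 e = ·-nonzero x≢0 (↑-nonzero k x≢0) e

  -- Serves to bound the order of a generator from below: its powers together with 0 cover the
  -- field.
  complete⇒length : ∀ {ys} → (∀ x → x ∈ ys) → 2 ^ m ≤ length ys
  complete⇒length {ys} c = FinP.injective⇒≤ {f = λ i → index (c (from i))} λ {i} {j} e →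
    trans (sym (to-from i)) (trans (cong to (begin
      from i                         ≡⟨ lookup-index (c (from i)) ⟩
      lookup ys (index (c (from i))) ≡⟨ cong (lookup ys) e ⟩
      lookup ys (index (c (from j))) ≡⟨ sym (lookup-index (c (from j))) ⟩
      from j                         ∎)) (to-from j))

  private
    sumF : List F → F
    sumF []       = 0#
    sumF (x ∷ xs) = x ⊞ sumF xs

    ⊞-exch : ∀ x y z → x ⊞ (y ⊞ z) ≡ y ⊞ (x ⊞ z)
    ⊞-exch x y z = trans (sym (R.+-assoc x y z)) (trans (cong (_⊞ z) (R.+-comm x y)) (R.+-assoc y x z))

    sumF-↭ : ∀ {xs ys} → xs ↭ ys → sumF xs ≡ sumF ys
    sumF-↭ _↭_.refl             = refl
    sumF-↭ (prep x p)           = cong (x ⊞_) (sumF-↭ p)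
    sumF-↭ (swap x y p)         = trans (cong (λ s → x ⊞ (y ⊞ s)) (sumF-↭ p)) (⊞-exch x y _)
    sumF-↭ (_↭_.trans p p′)     = trans (sumF-↭ p) (sumF-↭ p′)

    multiple : ℕ → F
    multiple zero    = 0#
    multiple (suc k) = 1# ⊞ multiple k

    sumF-shift : ∀ xs → sumF (map (1# ⊞_) xs) ≡ multiple (length xs) ⊞ sumF xs
    sumF-shift []       = sym (R.+-identityˡ 0#)
    sumF-shift (x ∷ xs) = begin
      1# ⊞ x ⊞ sumF (map (1# ⊞_) xs)             ≡⟨ cong (1# ⊞ x ⊞_) (sumF-shift xs) ⟩
      1# ⊞ x ⊞ (multiple (length xs) ⊞ sumF xs)  ≡⟨ R.+-assoc 1# x _ ⟩
      1# ⊞ (x ⊞ (multiple (length xs) ⊞ sumF xs)) ≡⟨ cong (1# ⊞_) (⊞-exch x _ _) ⟩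
      1# ⊞ (multiple (length xs) ⊞ (x ⊞ sumF xs)) ≡⟨ sym (R.+-assoc 1# _ _) ⟩
      1# ⊞ multiple (length xs) ⊞ (x ⊞ sumF xs)  ∎

    multiple-+ : ∀ j k → multiple (j + k) ≡ multiple j ⊞ multiple k
    multiple-+ zero    k = sym (R.+-identityˡ _)
    multiple-+ (suc j) k = trans (cong (1# ⊞_) (multiple-+ j k)) (sym (R.+-assoc 1# _ _))

    multiple-2^ : ∀ k → multiple (2 ^ k) ≡ (1# ⊞ 1#) ↑ k
    multiple-2^ zero    = R.+-identityʳ 1#
    multiple-2^ (suc k) = begin
      multiple (2 ^ k + (2 ^ k + 0))              ≡⟨ cong (λ j → multiple (2 ^ k + j)) (ℕ.+-identityʳ (2 ^ k)) ⟩
      multiple (2 ^ k + 2 ^ k)                    ≡⟨ multiple-+ (2 ^ k) (2 ^ k) ⟩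
      multiple (2 ^ k) ⊞ multiple (2 ^ k)         ≡⟨ cong (λ s → s ⊞ s) (trans (multiple-2^ k) (sym (R.*-identityˡ _))) ⟩
      1# · (1# ⊞ 1#) ↑ k ⊞ 1# · (1# ⊞ 1#) ↑ k     ≡⟨ sym (R.distribʳ _ 1# 1#) ⟩
      (1# ⊞ 1#) · (1# ⊞ 1#) ↑ k                   ∎

  -- Translation by 1 permutes F, so summing all elements gives 2^m · 1 = 0.
  1⊞1≡0 : 1# ⊞ 1# ≡ 0#
  1⊞1≡0 with 1# ⊞ 1# ≟ 0#
  ... | yes e = e
  -- As an element of the field, 2^m is (1 + 1)^m, and a power of a nonzero element is nonzero.
  ... | no ¬e = contradiction power-zero (↑-nonzero m ¬e)
    where
    all : List F
    all = tabulate from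
    unique : Unique all
    unique = UniqueP.tabulate⁺ (λ {i} {j} e → trans (sym (to-from i)) (trans (cong to e) (to-from j)))
    complete : ∀ x → x ∈ all
    complete x = subst (_∈ all) (from-to x) (∈-tabulate⁺ (to x))
    1⊞-bij : ∀ x → (⊟ 1#) ⊞ (1# ⊞ x) ≡ x
    1⊞-bij x = trans (sym (R.+-assoc _ 1# x)) (trans (cong (_⊞ x) (R.-‿inverseˡ 1#)) (R.+-identityˡ x))
    1⊞-bij′ : ∀ x → 1# ⊞ ((⊟ 1#) ⊞ x) ≡ x
    1⊞-bij′ x = trans (sym (R.+-assoc 1# _ x)) (trans (cong (_⊞ x) (R.-‿inverseʳ 1#)) (R.+-identityˡ x))
    s : F
    s = sumF all
    fixed : multiple (length all) ⊞ s ≡ s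
    fixed = trans (sym (sumF-shift all)) (sumF-↭ (bijection-↭ unique complete (1# ⊞_) ((⊟ 1#) ⊞_) 1⊞-bij 1⊞-bij′))
    power-zero : (1# ⊞ 1#) ↑ m ≡ 0#
    power-zero = begin
      (1# ⊞ 1#) ↑ m                    ≡⟨ sym (multiple-2^ m) ⟩
      multiple (2 ^ m)                 ≡⟨ cong multiple (sym (length-tabulate from)) ⟩
      multiple (length all)            ≡⟨ sym (R.+-identityʳ _) ⟩
      multiple (length all) ⊞ 0#       ≡⟨ cong (multiple (length all) ⊞_) (sym (R.-‿inverseʳ s)) ⟩
      multiple (length all) ⊞ (s ⊞ ⊟ s) ≡⟨ sym (R.+-assoc _ s _) ⟩
      multiple (length all) ⊞ s ⊞ ⊟ s  ≡⟨ cong (_⊞ ⊟ s) fixed ⟩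
      s ⊞ ⊟ s                          ≡⟨ R.-‿inverseʳ s ⟩
      0#                               ∎

  x⊞x≡0 : ∀ x → x ⊞ x ≡ 0#
  x⊞x≡0 x = begin
    x ⊞ x            ≡⟨ cong (λ y → y ⊞ y) (sym (R.*-identityˡ x)) ⟩
    1# · x ⊞ 1# · x  ≡⟨ sym (R.distribʳ x 1# 1#) ⟩
    (1# ⊞ 1#) · x    ≡⟨ cong (_· x) 1⊞1≡0 ⟩
    0# · x           ≡⟨ R.zeroˡ x ⟩
    0#               ∎

  ι-xor : ∀ a b → ι (a xor b) ≡ ι a ⊞ ι b
  ι-xor true  true  = sym 1⊞1≡0
  ι-xor true  false = sym (R.+-identityʳ 1#)
  ι-xor false b     = sym (R.+-identityˡ (ι b))

  -- The ring solver with coefficients in 𝔽₂ decides identities of characteristic two.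
  module Solver where
    private
      𝔽₂ : RawRing _ _
      𝔽₂ = record { Carrier = Bool ; _≈_ = _≡_ ; _+_ = _xor_ ; _*_ = _∧_ ; -_ = id ; 0# = false ; 1# = true }

      ι-∧ : ∀ a b → ι (a ∧ b) ≡ ι a · ι b
      ι-∧ true  b = sym (R.*-identityˡ (ι b))
      ι-∧ false b = sym (R.zeroˡ (ι b))

      ι-neg : ∀ a → ι a ≡ ⊟ (ι a)
      ι-neg a = begin
        ι a                     ≡⟨ sym (R.+-identityʳ (ι a)) ⟩
        ι a ⊞ 0#                ≡⟨ cong (ι a ⊞_) (sym (R.-‿inverseʳ (ι a))) ⟩
        ι a ⊞ (ι a ⊞ ⊟ (ι a))   ≡⟨ sym (R.+-assoc _ _ _) ⟩
        ι a ⊞ ι a ⊞ ⊟ (ι a)     ≡⟨ cong (_⊞ ⊟ (ι a)) (x⊞x≡0 (ι a)) ⟩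
        0# ⊞ ⊟ (ι a)            ≡⟨ R.+-identityˡ _ ⟩
        ⊟ (ι a)                 ∎

      morphism : 𝔽₂ -Raw-AlmostCommutative⟶ fromCommutativeRing commutativeRing
      morphism = record { ⟦_⟧ = ι ; +-homo = ι-xor ; *-homo = ι-∧ ; -‿homo = ι-neg ; 0-homo = refl ; 1-homo = refl }

      coefficient≟ : (a b : Bool) → Maybe (ι a ≡ ι b)
      coefficient≟ true  true  = just refl
      coefficient≟ false false = just refl
      coefficient≟ _     _     = nothing

    open Algebra.Solver.Ring 𝔽₂ (fromCommutativeRing commutativeRing) morphism coefficient≟ public
      hiding (_*x+_)

  open Solver using (solve; _:+_; _:*_; _:=_; con)

  ⊞≡0⇒≡ : ∀ x y → x ⊞ y ≡ 0# → x ≡ y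
  ⊞≡0⇒≡ x y e = begin
    x            ≡⟨ solve 2 (λ x y → x := (x :+ y) :+ y) refl x y ⟩
    x ⊞ y ⊞ y    ≡⟨ cong (_⊞ y) e ⟩
    0# ⊞ y       ≡⟨ R.+-identityˡ y ⟩
    y            ∎

  ·-cancelˡ : ∀ x y z → x ≢ 0# → x · y ≡ x · z → y ≡ z
  ·-cancelˡ x y z x≢0 e = ⊞≡0⇒≡ y z (no-zero-divisors x (y ⊞ z) x≢0 (begin
    x · (y ⊞ z)    ≡⟨ R.distribˡ x y z ⟩
    x · y ⊞ x · z  ≡⟨ cong (_⊞ x · z) e ⟩
    x · z ⊞ x · z  ≡⟨ x⊞x≡0 _ ⟩
    0#             ∎))

  ↑-+ : ∀ x j k → x ↑ (j + k) ≡ x ↑ j · x ↑ k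
  ↑-+ x zero    k = sym (R.*-identityˡ _)
  ↑-+ x (suc j) k = trans (cong (x ·_) (↑-+ x j k)) (sym (R.*-assoc x _ _))

  1↑ : ∀ k → 1# ↑ k ≡ 1#
  1↑ zero    = refl
  1↑ (suc k) = trans (R.*-identityˡ _) (1↑ k)

  ·-↑ : ∀ x y k → (x · y) ↑ k ≡ x ↑ k · y ↑ k
  ·-↑ x y zero    = sym (R.*-identityˡ 1#)
  ·-↑ x y (suc k) = trans (cong (x · y ·_) (·-↑ x y k))
    (solve 4 (λ x y u v → x :* y :* (u :* v) := x :* u :* (y :* v)) refl x y (x ↑ k) (y ↑ k))

  ↑-* : ∀ x j k → x ↑ (j * k) ≡ (x ↑ j) ↑ k
  ↑-* x zero    k = sym (1↑ k)
  ↑-* x (suc j) k = trans (↑-+ x k (j * k)) (trans (cong (x ↑ k ·_) (↑-* x j k)) (sym (·-↑ x (x ↑ j) k)))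

  frobenius-⊞ : ∀ k x y → (x ⊞ y) ↑ (2 ^ k) ≡ x ↑ (2 ^ k) ⊞ y ↑ (2 ^ k)
  frobenius-⊞ zero    x y = solve 2 (λ x y → (x :+ y) :* con true := x :* con true :+ y :* con true) refl x y
  frobenius-⊞ (suc k) x y = begin
    (x ⊞ y) ↑ (2 * 2 ^ k)                  ≡⟨ ↑-* (x ⊞ y) 2 (2 ^ k) ⟩
    ((x ⊞ y) ↑ 2) ↑ (2 ^ k)                ≡⟨ cong (_↑ (2 ^ k)) (solve 2 (λ x y → (x :+ y) :* ((x :+ y) :* con true) := x :* (x :* con true) :+ y :* (y :* con true)) refl x y) ⟩
    (x ↑ 2 ⊞ y ↑ 2) ↑ (2 ^ k)              ≡⟨ frobenius-⊞ k (x ↑ 2) (y ↑ 2) ⟩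
    (x ↑ 2) ↑ (2 ^ k) ⊞ (y ↑ 2) ↑ (2 ^ k)  ≡⟨ sym (cong₂ _⊞_ (↑-* x 2 (2 ^ k)) (↑-* y 2 (2 ^ k))) ⟩
    x ↑ (2 * 2 ^ k) ⊞ y ↑ (2 * 2 ^ k)      ∎

  0↑2^ : ∀ k → 0# ↑ (2 ^ k) ≡ 0#
  0↑2^ k with 2 ^ k | ℕ.m^n>0 2 k
  ... | suc _ | _ = R.zeroˡ _

  -- Powers of a generator

  module Generator (α : F) (generates : IsGenerator α) (n₂ : ℕ) (2^m≡ : 2 ^ m ≡ 3 + n₂) where

    -- The form 2^m = 3 + n₂ makes n visibly a successor and lets both 0 and 1 be split off the list
    -- of elements.
    n : ℕ
    n = 2 + n₂

    α≢0 : α ≢ 0#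
    -- A zero generator has only the powers 1 and 0, but the field has at least three elements.
    α≢0 α≡0 = contradiction (subst (_≤ 2) 2^m≡ (complete⇒length {0# ∷ 1# ∷ []} complete)) λ { (s≤s (s≤s ())) }
      where
      complete : ∀ x → x ∈ 0# ∷ 1# ∷ []
      complete x with x ≟ 0#
      ... | yes e = here e
      ... | no ¬e with generates x ¬e
      ... | zero  , 1≡x = there (here (sym 1≡x))
      ... | suc k , e   = here (trans (sym e) (trans (cong (_· α ↑ k) α≡0) (R.zeroˡ _)))

    reduce : ∀ d k → α ↑ suc d ≡ 1# → α ↑ k ≡ α ↑ (k % suc d)
    reduce d k e = begin
      α ↑ k                                          ≡⟨ cong (α ↑_) (m≡m%n+[m/n]*n k (suc d)) ⟩
      α ↑ (k % suc d + k / suc d * suc d)            ≡⟨ ↑-+ α (k % suc d) _ ⟩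
      α ↑ (k % suc d) · α ↑ (k / suc d * suc d)      ≡⟨ cong (λ j → α ↑ (k % suc d) · α ↑ j) (ℕ.*-comm (k / suc d) (suc d)) ⟩
      α ↑ (k % suc d) · α ↑ (suc d * (k / suc d))    ≡⟨ cong (α ↑ (k % suc d) ·_) (trans (↑-* α (suc d) (k / suc d)) (trans (cong (_↑ (k / suc d)) e) (1↑ (k / suc d)))) ⟩
      α ↑ (k % suc d) · 1#                           ≡⟨ R.*-identityʳ _ ⟩
      α ↑ (k % suc d)                                ∎

    -- If α^(d+1) = 1, the exponents up to d already produce every unit, so d + 2 elements cover the
    -- field.
    order-minimal : ∀ d → α ↑ suc d ≡ 1# → n ≤ suc d
    order-minimal d e = ℕ.≤-pred (bound (complete⇒length {0# ∷ applyUpTo (α ↑_) (suc d)} complete))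
      where
      bound : 2 ^ m ≤ suc (length (applyUpTo (α ↑_) (suc d))) → 3 + n₂ ≤ 2 + d
      bound le = ℕ.≤-trans (ℕ.≤-reflexive (sym 2^m≡)) (ℕ.≤-trans le (ℕ.≤-reflexive (cong suc (length-applyUpTo (α ↑_) (suc d)))))
      complete : ∀ x → x ∈ 0# ∷ applyUpTo (α ↑_) (suc d)
      complete x with x ≟ 0#
      ... | yes z = here z
      ... | no ¬z with generates x ¬z
      ... | k , refl = there (subst (_∈ applyUpTo (α ↑_) (suc d)) (sym (reduce d k e)) (∈-applyUpTo⁺ (α ↑_) (m%n<n k (suc d))))

    coincidence : ∀ j d → α ↑ (j + d) ≡ α ↑ j → α ↑ d ≡ 1#
    coincidence j d e = ·-cancelˡ (α ↑ j) (α ↑ d) 1# (↑-nonzero j α≢0)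
      (trans (sym (↑-+ α j d)) (trans e (sym (R.*-identityʳ _))))

    distinct-powers : ∀ {i j} → i < j → j < n → α ↑ i ≢ α ↑ j
    distinct-powers {i} {j} i<j j<n e = ℕ.<⇒≱ j<n (ℕ.≤-trans (order-minimal _ (coincidence i (suc (j ∸ suc i)) (trans (cong (α ↑_) i+d≡j) (sym e)))) d≤j)
      where
      i+d≡j : i + suc (j ∸ suc i) ≡ j
      i+d≡j = trans (ℕ.+-suc i _) (ℕ.m+[n∸m]≡n i<j)
      d≤j : suc (j ∸ suc i) ≤ j
      d≤j = subst (suc (j ∸ suc i) ≤_) i+d≡j (ℕ.m≤n+m _ i)

    -- Pigeonhole on 0, α⁰, …, αⁿ; by order-minimal the coincidence found must be αⁿ = α⁰.
    α↑n≡1 : α ↑ n ≡ 1#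
    α↑n≡1 with FinP.pigeonhole (ℕ.n<1+n (2 ^ m)) pigeon
      where
      pigeon : Fin (suc (2 ^ m)) → Fin (2 ^ m)
      pigeon Fin.zero    = to 0#
      pigeon (Fin.suc k) = to (α ↑ toℕ k)
    ... | Fin.zero  , Fin.suc j , _        , e = contradiction (sym (to-injective e)) (↑-nonzero (toℕ j) α≢0)
    ... | Fin.suc i , Fin.suc j , s≤s i<j  , e = subst (λ d → α ↑ d ≡ 1#) d≡n α↑d≡1
      where
      d : ℕ
      d = suc (toℕ j ∸ suc (toℕ i))
      i+d≡j : toℕ i + d ≡ toℕ j
      i+d≡j = trans (ℕ.+-suc (toℕ i) _) (ℕ.m+[n∸m]≡n i<j)
      α↑d≡1 : α ↑ d ≡ 1#
      α↑d≡1 = coincidence (toℕ i) d (trans (cong (α ↑_) i+d≡j) (sym (to-injective e)))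
      d≤n : d ≤ n
      d≤n = ℕ.≤-pred (ℕ.≤-trans (s≤s (subst (d ≤_) i+d≡j (ℕ.m≤n+m d (toℕ i)))) (subst (toℕ j <_) 2^m≡ (FinP.toℕ<n j)))
      d≡n : d ≡ n
      d≡n = ℕ.≤-antisym d≤n (order-minimal _ α↑d≡1)

    α↑k≡1⇒n∣k : ∀ k → α ↑ k ≡ 1# → n ∣ k
    α↑k≡1⇒n∣k k e with k % n in eq | m≡m%n+[m/n]*n k n | reduce (1 + n₂) k α↑n≡1 | m%n<n k n
    ... | zero  | k≡ | _    | _   = divides (k / n) k≡
    ... | suc d | k≡ | red  | d<n = contradiction (order-minimal d (trans (sym red) e)) (ℕ.<⇒≱ d<n)

    opaque
      units rest elements : List F
      units    = applyUpTo (α ↑_) n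
      rest     = applyUpTo (λ i → α ↑ suc i) (1 + n₂)
      elements = 0# ∷ units

      elements≡ : elements ≡ 0# ∷ units
      elements≡ = refl

      units≡ : units ≡ 1# ∷ rest
      units≡ = refl

      units≡powers : units ≡ applyUpTo (α ↑_) n
      units≡powers = refl

      units-nonzero : All (_≢ 0#) units
      units-nonzero = AllP.applyUpTo⁺₂ (α ↑_) n (λ k → ↑-nonzero k α≢0)

      elements-unique : Unique elements
      elements-unique = All.map (λ x≢0 0≡x → x≢0 (sym 0≡x)) units-nonzero ∷ UniqueP.applyUpTo⁺₁ (α ↑_) n distinct-powers

      rest-proper : All (λ v → v ≢ 0# × v ≢ 1#) rest
      rest-proper = proper elements-unique
        where
        proper : ∀ {a b : F} {xs} → Unique (a ∷ b ∷ xs) → All (λ v → v ≢ a × v ≢ b) xs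
        proper ((_ ∷ a≢) ∷ (b≢ ∷ _)) = All.zipWith (λ (p , q) → (λ e → p (sym e)) , (λ e → q (sym e))) (a≢ , b≢)

      ∈-units : ∀ x → x ≢ 0# → x ∈ units
      ∈-units x ¬z with generates x ¬z
      ... | k , refl = subst (_∈ units) (sym (reduce (1 + n₂) k α↑n≡1)) (∈-applyUpTo⁺ (α ↑_) (m%n<n k n))

      ∈-elements : ∀ x → x ∈ elements
      ∈-elements x with x ≟ 0#
      ... | yes z = here z
      ... | no ¬z = there (∈-units x ¬z)

      length-rest : length rest ≡ 1 + n₂
      length-rest = length-applyUpTo (λ i → α ↑ suc i) (1 + n₂)

    length-units : length units ≡ 2 + n₂
    length-units = trans (cong length units≡) (cong suc length-rest)

    length-elements : length elements ≡ 3 + n₂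
    length-elements = trans (cong length elements≡) (cong suc length-units)

    x↑2^m≡x : ∀ x → x ↑ (2 ^ m) ≡ x
    x↑2^m≡x x with x ≟ 0#
    ... | yes refl = subst (λ k → 0# ↑ k ≡ 0#) (sym 2^m≡) (R.zeroˡ _)
    ... | no ¬z with generates x ¬z
    ... | k , refl = begin
      (α ↑ k) ↑ (2 ^ m)      ≡⟨ cong ((α ↑ k) ↑_) 2^m≡ ⟩
      α ↑ k · (α ↑ k) ↑ n    ≡⟨ cong (α ↑ k ·_) (sym (↑-* α k n)) ⟩
      α ↑ k · α ↑ (k * n)    ≡⟨ cong (λ j → α ↑ k · α ↑ j) (ℕ.*-comm k n) ⟩
      α ↑ k · α ↑ (n * k)    ≡⟨ cong (α ↑ k ·_) (trans (↑-* α n k) (trans (cong (_↑ k) α↑n≡1) (1↑ k))) ⟩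
      α ↑ k · 1#             ≡⟨ R.*-identityʳ _ ⟩
      α ↑ k                  ∎

    -- Away from 0 the equation reads x^(c+1) = 1. Since n = l (c+1), its solutions are the powers
    -- of α^l. The cases c = 2 and c = 14 count 𝔽₄ and 𝔽₁₆.
    tally-fixed : ∀ c l → n ≡ l * suc c → tally (λ x → x ↑ (2 + c) ≟ x) elements ≡ 2 + c
    tally-fixed c l n≡lc = begin
      tally P? elements            ≡⟨ tally-filter P? elements ⟩
      length (filter P? elements)  ≡⟨ Perm.↭-length (unique-sameElements⇒↭ (UniqueP.filter⁺ P? elements-unique) roots-unique (mk⇔ to-root from-root)) ⟩
      length roots                 ≡⟨ cong suc (length-applyUpTo root (suc c)) ⟩
      2 + c                        ∎
      where
      P? = λ x → x ↑ (2 + c) ≟ x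
      root : ℕ → F
      root j = α ↑ (j * l)
      roots : List F
      roots = 0# ∷ applyUpTo root (suc c)
      factor-nonZero : ∀ l → n ≡ l * suc c → NonZero l
      factor-nonZero (suc _) _ = _
      instance
        l-nonZero : NonZero l
        l-nonZero = factor-nonZero l n≡lc
      roots-unique : Unique roots
      roots-unique = AllP.applyUpTo⁺₂ root (suc c) (λ j 0≡ → ↑-nonzero (j * l) α≢0 (sym 0≡))
        ∷ UniqueP.applyUpTo⁺₁ root (suc c) (λ {i} {j} i<j j<c → distinct-powers (ℕ.*-monoˡ-< l i<j)
            (subst (j * l <_) (trans (ℕ.*-comm (suc c) l) (sym n≡lc)) (ℕ.*-monoˡ-< l j<c)))
      to-root : ∀ {x} → x ∈ filter P? elements → x ∈ roots
      to-root {x} x∈ with ∈-filter⁻ P? {xs = elements} x∈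
      ... | x∈e , fix with subst (x ∈_) elements≡ x∈e
      ... | here refl = here refl
      ... | there x∈u with ∈-applyUpTo⁻ (α ↑_) (subst (x ∈_) units≡powers x∈u)
      ... | k , k<n , refl with *-cancelʳ-∣ {l} {k} (suc c) (subst (_∣ k * suc c) n≡lc (α↑k≡1⇒n∣k (k * suc c) (begin
        α ↑ (k * suc c)    ≡⟨ ↑-* α k (suc c) ⟩
        (α ↑ k) ↑ suc c    ≡⟨ ·-cancelˡ (α ↑ k) _ 1# (↑-nonzero k α≢0) (trans fix (sym (R.*-identityʳ _))) ⟩
        1#                 ∎)))
      ... | divides j refl = there (∈-applyUpTo⁺ root (ℕ.*-cancelʳ-< l j (suc c) (subst (j * l <_) (trans n≡lc (ℕ.*-comm l (suc c))) k<n)))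
      from-root : ∀ {x} → x ∈ roots → x ∈ filter P? elements
      from-root (here refl) = ∈-filter⁺ P? (∈-elements 0#) (R.zeroˡ _)
      from-root {x} (there x∈) with ∈-applyUpTo⁻ root x∈
      ... | j , _ , refl = ∈-filter⁺ P? (∈-elements x) (begin
        root j · root j ↑ suc c  ≡⟨ cong (root j ·_) (begin
          root j ↑ suc c           ≡⟨ sym (↑-* α (j * l) (suc c)) ⟩
          α ↑ (j * l * suc c)      ≡⟨ cong (α ↑_) (trans (ℕ.*-assoc j l (suc c)) (trans (cong (j *_) (sym n≡lc)) (ℕ.*-comm j n))) ⟩
          α ↑ (n * j)              ≡⟨ trans (↑-* α n j) (trans (cong (_↑ j) α↑n≡1) (1↑ j)) ⟩
          1#                       ∎) ⟩
        root j · 1#              ≡⟨ R.*-identityʳ _ ⟩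
        root j                   ∎)

-- Division of binary polynomials

coeff-⊕ : ∀ p q i → coeff (p ⊕ q) i ≡ coeff p i xor coeff q i
coeff-⊕ []      q       i       = refl
coeff-⊕ (a ∷ p) []      i       = sym (Bool.xor-identityʳ _)
coeff-⊕ (a ∷ p) (b ∷ q) zero    = refl
coeff-⊕ (a ∷ p) (b ∷ q) (suc i) = coeff-⊕ p q i

BelowDegree : ℕ → Poly₂ → Set
BelowDegree d p = ∀ i → d ≤ i → coeff p i ≡ false

-- From q = t p + s follows a + x q = (x t) p + (a + x s). The new remainder has degree at most d,
-- and if its coefficient at d is 1, adding `p` removes it.
divide : ∀ p d → Deg p d → ∀ q → ∃₂ λ t s → (q ≈ₚ (t ⊛ p ⊕ s)) × BelowDegree d s
divide p d _ [] = [] , [] , (λ _ → refl) , (λ _ _ → refl)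
divide p d (lead , above) (a ∷ q) with divide p d (lead , above) q
... | t , s , q≈ , low with coeff (a ∷ s) d in eq
... | false = false ∷ t , a ∷ s , ≈ , below
  where
  ≈ : (a ∷ q) ≈ₚ ((false ∷ t) ⊛ p ⊕ (a ∷ s))
  ≈ zero    = refl
  ≈ (suc i) = q≈ i
  below : BelowDegree d (a ∷ s)
  below i d≤i with ℕ.m≤n⇒m<n∨m≡n d≤i
  ... | inj₂ refl        = eq
  ... | inj₁ (s≤s d≤i′)  = low _ d≤i′
... | true = true ∷ t , (a ∷ s) ⊕ p , ≈ , below
  where
  cancel : ∀ x y z → y ≡ z → y ≡ (x xor z) xor x
  cancel true  true  _ refl = refl
  cancel true  false _ refl = refl
  cancel false y     _ refl = sym (Bool.xor-identityʳ y)
  shifted : ∀ i → coeff (a ∷ q) i ≡ coeff (false ∷ (t ⊛ p)) i xor coeff (a ∷ s) i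
  shifted zero    = refl
  shifted (suc i) = trans (q≈ i) (coeff-⊕ (t ⊛ p) s i)
  ≈ : (a ∷ q) ≈ₚ ((true ∷ t) ⊛ p ⊕ ((a ∷ s) ⊕ p))
  ≈ i = begin
    coeff (a ∷ q) i                      ≡⟨ cancel (coeff p i) (coeff (a ∷ q) i) (u xor v) (shifted i) ⟩
    (coeff p i xor (u xor v)) xor coeff p i ≡⟨ cong (_xor coeff p i) (sym (Bool.xor-assoc (coeff p i) u v)) ⟩
    ((coeff p i xor u) xor v) xor coeff p i ≡⟨ Bool.xor-assoc (coeff p i xor u) v (coeff p i) ⟩
    (coeff p i xor u) xor (v xor coeff p i) ≡⟨ sym (cong₂ _xor_ (coeff-⊕ p (false ∷ (t ⊛ p)) i) (coeff-⊕ (a ∷ s) p i)) ⟩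
    coeff ((true ∷ t) ⊛ p) i xor coeff ((a ∷ s) ⊕ p) i ≡⟨ sym (coeff-⊕ ((true ∷ t) ⊛ p) _ i) ⟩
    coeff ((true ∷ t) ⊛ p ⊕ ((a ∷ s) ⊕ p)) i ∎
    where
    u = coeff (false ∷ (t ⊛ p)) i
    v = coeff (a ∷ s) i
  below : BelowDegree d ((a ∷ s) ⊕ p)
  below i d≤i with ℕ.m≤n⇒m<n∨m≡n d≤i
  ... | inj₂ refl           = trans (coeff-⊕ (a ∷ s) p i) (cong₂ _xor_ eq lead)
  ... | inj₁ d<i@(s≤s d≤i′) = trans (coeff-⊕ (a ∷ s) p i) (cong₂ _xor_ (low _ d≤i′) (above i d<i))

-- Minimality in `IsMinPoly` concerns exact degrees, whereas division only bounds the degree of the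
-- remainder.
degree-below : ∀ d s → BelowDegree d s → BelowDegree 0 s ⊎ ∃ λ d′ → d′ < d × Deg s d′
degree-below zero    s low = inj₁ low
degree-below (suc d) s low with coeff s d in eq
... | true  = inj₂ (d , ℕ.≤-refl , eq , low)
... | false with degree-below d s low′
  where
  low′ : BelowDegree d s
  low′ i d≤i with ℕ.m≤n⇒m<n∨m≡n d≤i
  ... | inj₁ d<i  = low i d<i
  ... | inj₂ refl = eq
... | inj₁ z                 = inj₁ z
... | inj₂ (d′ , d′<d , deg) = inj₂ (d′ , ℕ.m≤n⇒m≤1+n d′<d , deg)

module Evaluation {m : ℕ} (K : GF2^ m) where
  open Field K
  open Solver using (solve; _:+_; _:*_; _:=_; con)

  eval-zero : ∀ p x → BelowDegree 0 p → eval p x ≡ 0#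
  eval-zero []      x z = refl
  eval-zero (a ∷ p) x z = trans (cong₂ (λ b y → ι b ⊞ x · y) (z 0 z≤n) (eval-zero p x (λ i _ → z (suc i) z≤n)))
    (solve 1 (λ x → con false :+ x :* con false := con false) refl x)

  eval-cong : ∀ p q x → p ≈ₚ q → eval p x ≡ eval q x
  eval-cong []      q       x e = sym (eval-zero q x (λ i _ → sym (e i)))
  eval-cong (a ∷ p) []      x e = eval-zero (a ∷ p) x (λ i _ → e i)
  eval-cong (a ∷ p) (b ∷ q) x e = cong₂ (λ c y → ι c ⊞ x · y) (e 0) (eval-cong p q x (e ∘ suc))

  eval-⊕ : ∀ p q x → eval (p ⊕ q) x ≡ eval p x ⊞ eval q x
  eval-⊕ []      q       x = sym (R.+-identityˡ _)
  eval-⊕ (a ∷ p) []      x = sym (R.+-identityʳ _)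
  eval-⊕ (a ∷ p) (b ∷ q) x = trans (cong₂ (λ y z → y ⊞ x · z) (ι-xor a b) (eval-⊕ p q x))
    (solve 5 (λ a b x u v → a :+ b :+ x :* (u :+ v) := a :+ x :* u :+ (b :+ x :* v)) refl (ι a) (ι b) x (eval p x) (eval q x))

  eval-⊛ : ∀ p q x → eval (p ⊛ q) x ≡ eval p x · eval q x
  eval-⊛ []          q x = sym (R.zeroˡ _)
  eval-⊛ (true ∷ p)  q x = begin
    eval (q ⊕ (false ∷ (p ⊛ q))) x             ≡⟨ eval-⊕ q (false ∷ (p ⊛ q)) x ⟩
    eval q x ⊞ (0# ⊞ x · eval (p ⊛ q) x)       ≡⟨ cong (λ y → eval q x ⊞ (0# ⊞ x · y)) (eval-⊛ p q x) ⟩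
    eval q x ⊞ (0# ⊞ x · (eval p x · eval q x)) ≡⟨ solve 3 (λ x u v → v :+ (con false :+ x :* (u :* v)) := (con true :+ x :* u) :* v) refl x (eval p x) (eval q x) ⟩
    (1# ⊞ x · eval p x) · eval q x             ∎
  eval-⊛ (false ∷ p) q x = trans (cong (λ y → 0# ⊞ x · y) (eval-⊛ p q x))
    (solve 3 (λ x u v → con false :+ x :* (u :* v) := (con false :+ x :* u) :* v) refl x (eval p x) (eval q x))

  eval-∣ₚ : ∀ p q x → p ∣ₚ q → eval p x ≡ 0# → eval q x ≡ 0#
  eval-∣ₚ p q x (t , q≈) e = begin
    eval q x             ≡⟨ eval-cong q (t ⊛ p) x q≈ ⟩
    eval (t ⊛ p) x       ≡⟨ eval-⊛ t p x ⟩
    eval t x · eval p x  ≡⟨ cong (eval t x ·_) e ⟩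
    eval t x · 0#        ≡⟨ R.zeroʳ _ ⟩
    0#                   ∎

  eval-xⁿ+1 : ∀ k x → eval (xⁿ+1 k) x ≡ x ↑ k ⊞ 1#
  eval-xⁿ+1 k x = trans (eval-⊕ (replicate k false ++ (true ∷ [])) (true ∷ []) x)
    (cong₂ _⊞_ (monomial k) (solve 1 (λ x → con true :+ x :* con false := con true) refl x))
    where
    monomial : ∀ k → eval (replicate k false ++ (true ∷ [])) x ≡ x ↑ k
    monomial zero    = solve 1 (λ x → con true :+ x :* con false := con true) refl x
    monomial (suc k) = trans (R.+-identityˡ _) (cong (x ·_) (monomial k))

  minPoly-∣ₚ : ∀ β p q → IsMinPoly β p → eval q β ≡ 0# → p ∣ₚ q
  minPoly-∣ₚ β p q ((d , deg , least) , p[β]≡0) q[β]≡0 with divide p d deg q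
  ... | t , s , q≈ , low with degree-below d s low
  ... | inj₁ z = t , λ i → trans (q≈ i) (trans (coeff-⊕ (t ⊛ p) s i)
                   (trans (cong (coeff (t ⊛ p) i xor_) (z i z≤n)) (Bool.xor-identityʳ _)))
  -- A nonzero remainder would also vanish at β, in smaller degree than the minimal polynomial.
  ... | inj₂ (d′ , d′<d , deg′) = contradiction (least s d′ deg′ s[β]≡0) (ℕ.<⇒≱ d′<d)
    where
    s[β]≡0 : eval s β ≡ 0#
    s[β]≡0 = begin
      eval s β                     ≡⟨ sym (R.+-identityˡ _) ⟩
      0# ⊞ eval s β                ≡⟨ cong (_⊞ eval s β) (sym (eval-∣ₚ p (t ⊛ p) β (t , λ _ → refl) p[β]≡0)) ⟩
      eval (t ⊛ p) β ⊞ eval s β    ≡⟨ sym (eval-⊕ (t ⊛ p) s β) ⟩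
      eval (t ⊛ p ⊕ s) β           ≡⟨ sym (eval-cong q (t ⊛ p ⊕ s) β q≈) ⟩
      eval q β                     ≡⟨ q[β]≡0 ⟩
      0#                           ∎

-- The extended code in terms of syndromes

odd : ℕ → Bool
odd zero    = false
odd (suc k) = not (odd k)

-- Even size forces the last coordinate to be the parity bit; this is how the overall parity check
-- enters.
odd-size : ∀ k c p → odd ∣ Vec.tabulate (extendWith k c p) ∣ ≡ parity c xor p
odd-size zero    c true  = refl
odd-size zero    c false = refl
odd-size (suc k) c p with c Fin.zero
... | true  = trans (cong not (odd-size k (c ∘ Fin.suc) p)) (sym (Bool.xor-assoc true (parity (c ∘ Fin.suc)) p))
... | false = odd-size k (c ∘ Fin.suc) p

extendWith-surjective : ∀ k (B : Subset (suc k)) → ∃₂ λ c p → B ≡ Vec.tabulate (extendWith k c p)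
extendWith-surjective zero    (p ∷ []) = (λ ()) , p , refl
extendWith-surjective (suc k) (b ∷ B) with extendWith-surjective k B
... | c , p , refl = (λ { Fin.zero → b ; (Fin.suc i) → c i }) , p , refl

module Code {m : ℕ} (K : GF2^ m) (α : GF2^.F K) (generates : GF2^.IsGenerator K α) (n₂ : ℕ) (2^m≡ : 2 ^ m ≡ 3 + n₂) (e : ℕ) where
  open Field K
  open Generator α generates n₂ 2^m≡
  open Evaluation K
  open Solver using (solve; _:+_; _:*_; _:=_; con)

  f : F → F
  f x = x ↑ (1 + 2 ^ e)

  h : F → F × F
  h x = x , f x

  f0≡0 : f 0# ≡ 0#
  f0≡0 = R.zeroˡ _

  𝕊 : Syndrome
  𝕊 = record
    { G = F × F ; _⊹_ = λ (a , b) (c , d) → a ⊞ c , b ⊞ d ; 𝟘 = 0# , 0# ; _≟ᴳ_ = ≡-dec _≟_ _≟_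
    ; ⊹-assoc = λ _ _ _ → cong₂ _,_ (R.+-assoc _ _ _) (R.+-assoc _ _ _)
    ; ⊹-comm  = λ _ _ → cong₂ _,_ (R.+-comm _ _) (R.+-comm _ _)
    ; ⊹-𝟘     = λ _ → cong₂ _,_ (R.+-identityʳ _) (R.+-identityʳ _)
    ; ⊹-self  = λ _ → cong₂ _,_ (x⊞x≡0 _) (x⊞x≡0 _)
    }

  open Syndrome 𝕊 public
  open Counting 𝕊 public

  -- Coordinate i < n of the code is the point αⁱ, and the parity coordinate is the point 0.
  points : ∀ k → F → Vec F (suc k)
  points zero    y = 0# ∷ []
  points (suc k) y = y ∷ points k (α · y)

  points-↭ : toList (points n 1#) ↭ elements
  points-↭ = subst (_↭ elements) (sym (toList-points n (α ↑_) (λ _ → refl)))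
    (subst (λ xs → applyUpTo (α ↑_) n ++ [ 0# ] ↭ xs) (sym (trans elements≡ (cong (0# ∷_) units≡powers))) (↭-sym (Perm.∷↭∷ʳ 0# _)))
    where
    toList-points : ∀ k (φ : ℕ → F) → (∀ i → φ (suc i) ≡ α · φ i) → toList (points k (φ 0)) ≡ applyUpTo φ k ++ [ 0# ]
    toList-points zero    φ step = refl
    toList-points (suc k) φ step = cong (φ 0 ∷_) (trans (cong (toList ∘ points k) (sym (step 0))) (toList-points k (φ ∘ suc) (step ∘ suc)))

  -- Horner's scheme: the coordinates belong to the points y, α y, α² y, ..., so the sums are the
  -- values of the codeword polynomial at α and f(α), scaled by y and f(y), because f is
  -- multiplicative. The last bit sits at the point 0 and contributes nothing to either sum.
  syn-extendWith : ∀ k c p y → syn h (points k y) (Vec.tabulate (extendWith k c p))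
    ≡ (y · eval (vecPoly c) α , f y · eval (vecPoly c) (f α))
  syn-extendWith zero c true  y = cong₂ _,_ (trans (R.+-identityʳ 0#) (sym (R.zeroʳ _)))
    (trans (R.+-identityˡ _) (trans f0≡0 (sym (R.zeroʳ _))))
  syn-extendWith zero c false y = cong₂ _,_ (sym (R.zeroʳ _)) (sym (R.zeroʳ _))
  syn-extendWith (suc k) c p y with c Fin.zero | syn-extendWith k (c ∘ Fin.suc) p (α · y)
  ... | b | ih = head b
    where
    u = eval (vecPoly (c ∘ Fin.suc)) α
    v = eval (vecPoly (c ∘ Fin.suc)) (f α)
    ih₂ : f (α · y) · v ≡ f α · f y · v
    ih₂ = cong (_· v) (·-↑ α y (1 + 2 ^ e))
    head : ∀ b → syn h (y ∷ points k (α · y)) (b ∷ Vec.tabulate (extendWith k (c ∘ Fin.suc) p))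
      ≡ (y · (ι b ⊞ α · u) , f y · (ι b ⊞ f α · v))
    head true  = trans (cong (_⊹ h y) ih) (cong₂ _,_
      (solve 3 (λ a y u → a :* y :* u :+ y := y :* (con true :+ a :* u)) refl α y u)
      (trans (cong (_⊞ f y) ih₂) (solve 3 (λ a y u → a :* y :* u :+ y := y :* (con true :+ a :* u)) refl (f α) (f y) v)))
    head false = trans ih (cong₂ _,_
      (solve 3 (λ a y u → a :* y :* u := y :* (con false :+ a :* u)) refl α y u)
      (trans ih₂ (solve 3 (λ a y u → a :* y :* u := y :* (con false :+ a :* u)) refl (f α) (f y) v)))

  f1≡1 : f 1# ≡ 1#
  f1≡1 = 1↑ (1 + 2 ^ e)

  syn-extend : ∀ c p → syn h (points n 1#) (Vec.tabulate (extendWith n c p)) ≡ (eval (vecPoly c) α , eval (vecPoly c) (f α))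
  syn-extend c p = trans (syn-extendWith n c p 1#) (cong₂ _,_ (R.*-identityˡ _) (trans (cong (_· eval (vecPoly c) (f α)) f1≡1) (R.*-identityˡ _)))

  module _ (M₁ M₂ g : Poly₂) (min₁ : IsMinPoly α M₁) (min₂ : IsMinPoly (f α) M₂) (lcm : IsLcm M₁ M₂ g) where

    -- The multiple of x^n + 1 vanishes at β because β^n = 1 and the characteristic is two.
    InCyclicCode⇒root : ∀ c β → eval g β ≡ 0# → β ↑ n ≡ 1# → InCyclicCode n g c → eval (vecPoly c) β ≡ 0#
    InCyclicCode⇒root c β g[β]≡0 β↑n≡1 (a , b , c≈) = begin
      eval (vecPoly c) β                            ≡⟨ eval-cong (vecPoly c) (a ⊛ g ⊕ b ⊛ xⁿ+1 n) β c≈ ⟩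
      eval (a ⊛ g ⊕ b ⊛ xⁿ+1 n) β                   ≡⟨ eval-⊕ (a ⊛ g) (b ⊛ xⁿ+1 n) β ⟩
      eval (a ⊛ g) β ⊞ eval (b ⊛ xⁿ+1 n) β          ≡⟨ cong₂ _⊞_ (eval-∣ₚ g (a ⊛ g) β (a , λ _ → refl) g[β]≡0)
                                                         (eval-∣ₚ (xⁿ+1 n) (b ⊛ xⁿ+1 n) β (b , λ _ → refl)
                                                           (trans (eval-xⁿ+1 n β) (trans (cong (_⊞ 1#) β↑n≡1) 1⊞1≡0))) ⟩
      0# ⊞ 0#                                       ≡⟨ R.+-identityˡ 0# ⟩
      0#                                            ∎

    roots⇒InCyclicCode : ∀ c → eval (vecPoly c) α ≡ 0# → eval (vecPoly c) (f α) ≡ 0# → InCyclicCode n g c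
    roots⇒InCyclicCode c z₁ z₂ with proj₂ (proj₂ (proj₂ lcm)) (vecPoly c) (minPoly-∣ₚ α M₁ (vecPoly c) min₁ z₁) (minPoly-∣ₚ (f α) M₂ (vecPoly c) min₂ z₂)
    -- The codeword polynomial is itself a multiple of `g`, so the cofactor of x^n + 1 is zero.
    ... | t , c≈ = t , [] , λ i → trans (c≈ i) (sym (trans (coeff-⊕ (t ⊛ g) [] i) (Bool.xor-identityʳ _)))

    supportBlock⇔ : ∀ B → SupportBlock n g 8 B ⇔ (∣ B ∣ ≡ 8 × syn h (points n 1#) B ≡ 𝟘)
    supportBlock⇔ B = mk⇔ to-syn from-syn
      where
      to-syn : SupportBlock n g 8 B → ∣ B ∣ ≡ 8 × syn h (points n 1#) B ≡ 𝟘
      to-syn (v , (c , code , v≡) , refl , size≡8) = size≡8 , (begin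
        syn h (points n 1#) (Vec.tabulate v)           ≡⟨ cong (syn h (points n 1#)) (VecP.tabulate-cong v≡) ⟩
        syn h (points n 1#) (Vec.tabulate (extend c))  ≡⟨ syn-extend c (parity c) ⟩
        (eval (vecPoly c) α , eval (vecPoly c) (f α))  ≡⟨ cong₂ _,_
           (InCyclicCode⇒root c α (eval-∣ₚ M₁ g α (proj₁ (proj₂ lcm)) (proj₂ min₁)) α↑n≡1 code)
           (InCyclicCode⇒root c (f α) (eval-∣ₚ M₂ g (f α) (proj₁ (proj₂ (proj₂ lcm))) (proj₂ min₂)) fα↑n≡1 code) ⟩
        (0# , 0#)                                      ∎)
        where
        fα↑n≡1 : f α ↑ n ≡ 1#
        fα↑n≡1 = begin
          (α ↑ (1 + 2 ^ e)) ↑ n  ≡⟨ sym (↑-* α (1 + 2 ^ e) n) ⟩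
          α ↑ ((1 + 2 ^ e) * n)  ≡⟨ cong (α ↑_) (ℕ.*-comm (1 + 2 ^ e) n) ⟩
          α ↑ (n * (1 + 2 ^ e))  ≡⟨ ↑-* α n (1 + 2 ^ e) ⟩
          (α ↑ n) ↑ (1 + 2 ^ e)  ≡⟨ cong f α↑n≡1 ⟩
          f 1#                   ≡⟨ f1≡1 ⟩
          1#                     ∎
      from-syn : ∣ B ∣ ≡ 8 × syn h (points n 1#) B ≡ 𝟘 → SupportBlock n g 8 B
      from-syn (size≡8 , s≡𝟘) with extendWith-surjective n B
      -- The size 8 is even, so the bit `p` must be the parity of `c`.
      ... | c , p , refl with xor-false (parity c) p (trans (sym (odd-size n c p)) (cong odd size≡8))
        where
        xor-false : ∀ a b → a xor b ≡ false → b ≡ a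
        xor-false true  true  _ = refl
        xor-false false false _ = refl
      ... | refl = extend c , (c , roots⇒InCyclicCode c (cong proj₁ roots) (cong proj₂ roots) , (λ _ → refl)) , refl , size≡8
        where
        roots : (eval (vecPoly c) α , eval (vecPoly c) (f α)) ≡ (0# , 0#)
        roots = trans (sym (syn-extend c (parity c))) s≡𝟘

-- Counting codewords by power moments

module Design {m : ℕ} (K : GF2^ m) (α : GF2^.F K) (generates : GF2^.IsGenerator K α) (n₂ : ℕ) (2^m≡ : 2 ^ m ≡ 3 + n₂) (e : ℕ)
  (bézout : Bézout.Identity 2 m e) (2∣e : 2 ∣ e) (r : ℕ) (n₂≡ : n₂ ≡ 13 + r) (l : ℕ) (n≡l*15 : 2 + n₂ ≡ l * 15) where

  open Field K
  open Generator α generates n₂ 2^m≡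
  open Code K α generates n₂ 2^m≡ e
  open Solver using (solve; _:+_; _:*_; _:=_; con)

  Q q : ℕ
  Q = 2 ^ e
  q = 16 + r

  -- Fixed points of Frobenius powers and the map x ↦ x^Q + x

  iterate-fixed : ∀ x a k → x ↑ (2 ^ a) ≡ x → x ↑ (2 ^ (k * a)) ≡ x
  iterate-fixed x a zero    fix = R.*-identityʳ x
  iterate-fixed x a (suc k) fix = begin
    x ↑ (2 ^ (a + k * a))          ≡⟨ cong (x ↑_) (ℕ.^-distribˡ-+-* 2 a (k * a)) ⟩
    x ↑ (2 ^ a * 2 ^ (k * a))      ≡⟨ ↑-* x (2 ^ a) (2 ^ (k * a)) ⟩
    (x ↑ (2 ^ a)) ↑ (2 ^ (k * a))  ≡⟨ cong (_↑ (2 ^ (k * a))) fix ⟩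
    x ↑ (2 ^ (k * a))              ≡⟨ iterate-fixed x a k fix ⟩
    x                              ∎

  -- The Euclidean argument without subtraction: raising to 2^(j b) changes nothing, and together
  -- with 2^d it gives 2^(k a). Both signs of `Bézout.Identity` reduce to it.
  fixed-difference : ∀ x a b d j k → d + j * b ≡ k * a → x ↑ (2 ^ a) ≡ x → x ↑ (2 ^ b) ≡ x → x ↑ (2 ^ d) ≡ x
  fixed-difference x a b d j k eq fixa fixb = begin
    x ↑ (2 ^ d)                    ≡⟨ cong (_↑ (2 ^ d)) (sym (iterate-fixed x b j fixb)) ⟩
    (x ↑ (2 ^ (j * b))) ↑ (2 ^ d)  ≡⟨ sym (↑-* x (2 ^ (j * b)) (2 ^ d)) ⟩
    x ↑ (2 ^ (j * b) * 2 ^ d)      ≡⟨ cong (x ↑_) (sym (ℕ.^-distribˡ-+-* 2 (j * b) d)) ⟩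
    x ↑ (2 ^ (j * b + d))          ≡⟨ cong (λ i → x ↑ (2 ^ i)) (trans (ℕ.+-comm (j * b) d) eq) ⟩
    x ↑ (2 ^ (k * a))              ≡⟨ iterate-fixed x a k fixa ⟩
    x                              ∎

  fixed-bézout : ∀ x d b → Bézout.Identity d m b → x ↑ (2 ^ b) ≡ x → x ↑ (2 ^ d) ≡ x
  fixed-bézout x d b (Bézout.+- j k eq) fix = fixed-difference x m b d k j eq (x↑2^m≡x x) fix
  fixed-bézout x d b (Bézout.-+ j k eq) fix = fixed-difference x b m d j k eq fix (x↑2^m≡x x)

  -- Doubling the identity for 2 = gcd(m, e) writes 4 as a combination of m and 2e. Hence the
  -- solutions of x^(Q²) = x satisfy x^16 = x.
  double-bézout : Bézout.Identity 2 m e → Bézout.Identity 4 m (e + e)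
  double-bézout (Bézout.+- j k eq) = Bézout.+- (j + j) k (begin
    4 + k * (e + e)              ≡⟨ trans (cong (4 +_) (ℕ.*-distribˡ-+ k e e)) (twice (k * e)) ⟩
    (2 + k * e) + (2 + k * e)    ≡⟨ cong₂ _+_ eq eq ⟩
    j * m + j * m                ≡⟨ sym (ℕ.*-distribʳ-+ m j j) ⟩
    (j + j) * m                  ∎)
    where
    twice : ∀ x → 4 + (x + x) ≡ (2 + x) + (2 + x)
    twice = solve-∀
  double-bézout (Bézout.-+ j k eq) = Bézout.-+ (j + j) k (begin
    4 + (j + j) * m              ≡⟨ trans (cong (4 +_) (ℕ.*-distribʳ-+ m j j)) (twice (j * m)) ⟩
    (2 + j * m) + (2 + j * m)    ≡⟨ cong₂ _+_ eq eq ⟩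
    k * e + k * e                ≡⟨ sym (ℕ.*-distribˡ-+ k e e) ⟩
    k * (e + e)                  ∎)
    where
    twice : ∀ x → 4 + (x + x) ≡ (2 + x) + (2 + x)
    twice = solve-∀

  fixedQ⇒fixed4 : ∀ x → x ↑ Q ≡ x → x ↑ 4 ≡ x
  fixedQ⇒fixed4 x = fixed-bézout x 2 e bézout

  fixed4⇒fixedQ : ∀ x → x ↑ 4 ≡ x → x ↑ Q ≡ x
  fixed4⇒fixedQ x fix = subst (λ i → x ↑ (2 ^ i) ≡ x) (sym (_∣_.equality 2∣e)) (iterate-fixed x 2 (_∣_.quotient 2∣e) fix)

  Q*Q≡ : Q * Q ≡ 2 ^ (e + e)
  Q*Q≡ = sym (ℕ.^-distribˡ-+-* 2 e e)

  Fixed : F → Set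
  Fixed x = x ↑ (Q * Q) ≡ x

  fixed? : Decidable Fixed
  fixed? x = x ↑ (Q * Q) ≟ x

  fixed⇒fixed16 : ∀ x → Fixed x → x ↑ 16 ≡ x
  fixed⇒fixed16 x fix = fixed-bézout x 4 (e + e) (double-bézout bézout) (subst (λ i → x ↑ i ≡ x) Q*Q≡ fix)

  fixed16⇒fixed : ∀ x → x ↑ 16 ≡ x → Fixed x
  fixed16⇒fixed x fix = subst (λ i → x ↑ i ≡ x) (sym Q*Q≡) (subst (λ i → x ↑ (2 ^ i) ≡ x) 4k≡ (iterate-fixed x 4 k fix))
    where
    k : ℕ
    k = _∣_.quotient 2∣e
    4k≡ : k * 4 ≡ e + e
    4k≡ = trans (ℕ.*-distribˡ-+ k 2 2) (sym (cong₂ _+_ (_∣_.equality 2∣e) (_∣_.equality 2∣e)))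

  tally-fixedQ : tally (λ x → x ↑ Q ≟ x) elements ≡ 4
  tally-fixedQ = trans (tally-cong (λ x → x ↑ Q ≟ x) (λ x → x ↑ 4 ≟ x) elements fixedQ⇒fixed4 fixed4⇒fixedQ)
    (tally-fixed 2 (l * 5) (trans n≡l*15 (sym (ℕ.*-assoc l 5 3))))

  tally-Fixed : tally fixed? elements ≡ 16
  tally-Fixed = trans (tally-cong fixed? (λ x → x ↑ 16 ≟ x) elements fixed⇒fixed16 fixed16⇒fixed) (tally-fixed 14 l n≡l*15)

  L : F → F
  L x = x ↑ Q ⊞ x

  L-⊞ : ∀ x y → L (x ⊞ y) ≡ L x ⊞ L y
  L-⊞ x y = trans (cong (_⊞ (x ⊞ y)) (frobenius-⊞ e x y))
    (solve 4 (λ x y u v → u :+ v :+ (x :+ y) := (u :+ x) :+ (v :+ y)) refl x y (x ↑ Q) (y ↑ Q))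

  -- ρ generates 𝔽₁₆ over 𝔽₄; dividing it by ρ^Q + ρ ∈ 𝔽₄ gives z with z^Q + z = 1.
  L-hits-1 : ∃ λ z → L z ≡ 1#
  L-hits-1 with inverse (L ρ) Lρ≢0
    where
    ρ : F
    ρ = α ↑ l
    Lρ≢0 : L ρ ≢ 0#
    Lρ≢0 Lρ≡0 = absurd l n≡l*15 (begin
      α ↑ (l * 3)  ≡⟨ ↑-* α l 3 ⟩
      ρ ↑ 3        ≡⟨ ·-cancelˡ ρ (ρ ↑ 3) 1# (↑-nonzero l α≢0) (trans (fixedQ⇒fixed4 ρ (⊞≡0⇒≡ _ _ Lρ≡0)) (sym (R.*-identityʳ ρ))) ⟩
      1#           ∎)
      where
      absurd : ∀ l → 2 + n₂ ≡ l * 15 → ¬ α ↑ (l * 3) ≡ 1#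
      -- An exponent 3l is below the order n = 15l.
      absurd (suc l) n≡ e′ = ℕ.<⇒≱ (ℕ.*-monoʳ-< (suc l) {3} {15} (s≤s (s≤s (s≤s (s≤s z≤n))))) (subst (_≤ suc l * 3) n≡ (order-minimal _ e′))
  ... | y , wy≡1 = ρ · y , (begin
    (ρ · y) ↑ Q ⊞ ρ · y  ≡⟨ cong (_⊞ ρ · y) (trans (·-↑ ρ y Q) (cong (ρ ↑ Q ·_) y↑Q≡y)) ⟩
    ρ ↑ Q · y ⊞ ρ · y    ≡⟨ sym (R.distribʳ y _ ρ) ⟩
    w · y                ≡⟨ wy≡1 ⟩
    1#                   ∎)
    where
    ρ w : F
    ρ = α ↑ l
    w = L ρ
    w↑Q≡w : w ↑ Q ≡ w
    w↑Q≡w = begin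
      w ↑ Q                   ≡⟨ frobenius-⊞ e (ρ ↑ Q) ρ ⟩
      (ρ ↑ Q) ↑ Q ⊞ ρ ↑ Q     ≡⟨ cong (_⊞ ρ ↑ Q) (trans (sym (↑-* ρ Q Q)) (fixed16⇒fixed ρ ρ↑16≡ρ)) ⟩
      ρ ⊞ ρ ↑ Q               ≡⟨ R.+-comm _ _ ⟩
      w                       ∎
      where
      ρ↑16≡ρ : ρ ↑ 16 ≡ ρ
      ρ↑16≡ρ = trans (cong (ρ ·_) (trans (sym (↑-* α l 15)) (trans (cong (α ↑_) (sym n≡l*15)) α↑n≡1))) (R.*-identityʳ ρ)
    y↑Q≡y : y ↑ Q ≡ y
    y↑Q≡y = ·-cancelˡ w (y ↑ Q) y (λ w≡0 → 0≢1 (trans (sym (R.zeroˡ y)) (trans (cong (_· y) (sym w≡0)) wy≡1))) (begin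
      w · y ↑ Q        ≡⟨ cong (_· y ↑ Q) (sym w↑Q≡w) ⟩
      w ↑ Q · y ↑ Q    ≡⟨ sym (·-↑ w y Q) ⟩
      (w · y) ↑ Q      ≡⟨ cong (_↑ Q) wy≡1 ⟩
      1# ↑ Q           ≡⟨ 1↑ Q ⟩
      1#               ≡⟨ sym wy≡1 ⟩
      w · y            ∎)

  frobenius-root : ∀ c → ∃ λ d → d ↑ Q ≡ c
  frobenius-root c = c ↑ (2 ^ j) , (begin
    (c ↑ (2 ^ j)) ↑ (2 ^ e)  ≡⟨ sym (↑-* c (2 ^ j) (2 ^ e)) ⟩
    c ↑ (2 ^ j * 2 ^ e)      ≡⟨ cong (c ↑_) (sym (ℕ.^-distribˡ-+-* 2 j e)) ⟩
    c ↑ (2 ^ (j + e))        ≡⟨ cong (λ i → c ↑ (2 ^ i)) (exponent m 2^m≡) ⟩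
    c ↑ (2 ^ (e * m))        ≡⟨ iterate-fixed c m e (x↑2^m≡x c) ⟩
    c                        ∎)
    where
    j : ℕ
    -- This is the (m-1)-fold iterate of x ↦ x^Q; one more application gives x^(2^(e m)) = x.
    j = e * (m ∸ 1)
    exponent : ∀ m → 2 ^ m ≡ 3 + n₂ → e * (m ∸ 1) + e ≡ e * m
    exponent (suc m) _ = trans (ℕ.+-comm (e * m) e) (sym (ℕ.*-suc e m))

  f-· : ∀ x y → f (x · y) ≡ f x · f y
  f-· x y = ·-↑ x y (1 + Q)

  f-⊞ : ∀ x y → f (x ⊞ y) ≡ (x ⊞ y) · (x ↑ Q ⊞ y ↑ Q)
  f-⊞ x y = cong ((x ⊞ y) ·_) (frobenius-⊞ e x y)

  f-nonzero : ∀ {x} → x ≢ 0# → f x ≢ 0#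
  f-nonzero = ↑-nonzero (1 + Q)

  -- Comparing with f(v) = v · v^Q shows that f(v) is fixed by x ↦ x^Q exactly when v^(Q²) = v. This
  -- is how 𝔽₁₆, not 𝔽₄, decides which hyperplanes coincide.
  f↑Q : ∀ v → f v ↑ Q ≡ v ↑ Q · v ↑ (Q * Q)
  f↑Q v = trans (·-↑ v (v ↑ Q) Q) (cong (v ↑ Q ·_) (sym (↑-* v Q Q)))

  Fixed⇒f : ∀ v → Fixed v → f v ↑ Q ≡ f v
  Fixed⇒f v fix = trans (f↑Q v) (trans (cong (v ↑ Q ·_) fix) (R.*-comm _ v))

  f⇒Fixed : ∀ v → v ≢ 0# → f v ↑ Q ≡ f v → Fixed v
  f⇒Fixed v v≢0 fix = ·-cancelˡ (v ↑ Q) _ v (↑-nonzero Q v≢0) (trans (sym (f↑Q v)) (trans fix (R.*-comm v _)))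

  Fixed-0 : Fixed 0#
  Fixed-0 = fixed16⇒fixed 0# (R.zeroˡ _)

  Fixed-1 : Fixed 1#
  Fixed-1 = 1↑ (Q * Q)

  Fixed-⊞ : ∀ x y → Fixed x → Fixed y → Fixed (x ⊞ y)
  Fixed-⊞ x y fx fy = begin
    (x ⊞ y) ↑ (Q * Q)                ≡⟨ cong ((x ⊞ y) ↑_) Q*Q≡ ⟩
    (x ⊞ y) ↑ (2 ^ (e + e))          ≡⟨ frobenius-⊞ (e + e) x y ⟩
    x ↑ (2 ^ (e + e)) ⊞ y ↑ (2 ^ (e + e)) ≡⟨ cong₂ (λ i j → x ↑ i ⊞ y ↑ j) (sym Q*Q≡) (sym Q*Q≡) ⟩
    x ↑ (Q * Q) ⊞ y ↑ (Q * Q)        ≡⟨ cong₂ _⊞_ fx fy ⟩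
    x ⊞ y                            ∎

  Fixed-quotient : ∀ x y → y ≢ 0# → Fixed y → Fixed (x · y) → Fixed x
  Fixed-quotient x y y≢0 fy fxy = ·-cancelˡ y _ x y≢0 (begin
    y · x ↑ (Q * Q)            ≡⟨ trans (R.*-comm y _) (cong (x ↑ (Q * Q) ·_) (sym fy)) ⟩
    x ↑ (Q * Q) · y ↑ (Q * Q)  ≡⟨ trans (sym (·-↑ x y (Q * Q))) fxy ⟩
    x · y                      ≡⟨ R.*-comm x y ⟩
    y · x                      ∎)

  translate-↭ : ∀ c → map (_⊞ c) elements ↭ elements
  translate-↭ c = bijection-↭ elements-unique ∈-elements (_⊞ c) (_⊞ c) cancel cancel
    where
    cancel : ∀ x → x ⊞ c ⊞ c ≡ x
    cancel x = solve 2 (λ x c → x :+ c :+ c := x) refl x c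

  scale-↭ : ∀ c → c ≢ 0# → map (_· c) elements ↭ elements
  scale-↭ c c≢0 with inverse c c≢0
  ... | d , cd≡1 = bijection-↭ elements-unique ∈-elements (_· c) (_· d)
    (λ x → trans (R.*-assoc x c d) (trans (cong (x ·_) cd≡1) (R.*-identityʳ x)))
    (λ x → trans (R.*-assoc x d c) (trans (cong (x ·_) (trans (R.*-comm d c) cd≡1)) (R.*-identityʳ x)))

  -- Summation over the field and along the cosets of a·H

  ΣF : (F → ℕ) → ℕ
  ΣF = Σ[ elements ]

  ΣF-const : ∀ c → ΣF (λ _ → c) ≡ q * c
  ΣF-const c = trans (Σ-const elements c) (cong (_* c) (trans length-elements (cong (3 +_) n₂≡)))

  ΣF-translate : ∀ c g → ΣF (λ x → g (x ⊞ c)) ≡ ΣF g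
  ΣF-translate c g = trans (sym (Σ-map (_⊞ c) elements g)) (Σ-↭ g (translate-↭ c))

  ΣF-scale : ∀ c g → c ≢ 0# → ΣF (λ x → g (x · c)) ≡ ΣF g
  ΣF-scale c g c≢0 = trans (sym (Σ-map (_· c) elements g)) (Σ-↭ g (scale-↭ c c≢0))

  Σ-units-scale : ∀ c g → c ≢ 0# → Σ[ units ] (λ x → g (x · c)) ≡ Σ[ units ] g
  Σ-units-scale c g c≢0 = trans (sym (Σ-map (_· c) units g)) (Σ-↭ g (Perm.drop-∷
    (subst (λ z → z ∷ map (_· c) units ↭ 0# ∷ units) (R.zeroˡ c) (subst (λ xs → map (_· c) xs ↭ xs) elements≡ (scale-↭ c c≢0)))))

  ΣF-split : ∀ g → ΣF g ≡ g 0# + Σ[ units ] g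
  ΣF-split g = cong (λ xs → Σ[ xs ] g) elements≡

  Σ-units-split : ∀ g → Σ[ units ] g ≡ g 1# + Σ[ rest ] g
  Σ-units-split g = cong (λ xs → Σ[ xs ] g) units≡

  -- The sum of g over the coset t + a·H, where for a ≠ 0 each point is taken four times, the size
  -- of the kernel of `L`. Leaving it unnormalised avoids fractions and produces the factors q
  -- below.
  P : F → (F → ℕ) → F → ℕ
  P a g t = ΣF (λ x → g (t ⊞ a · L x))

  P-cong : ∀ a {g k} t → (∀ t → g t ≡ k t) → P a g t ≡ P a k t
  P-cong a t g≡k = Σ-cong elements (λ x → g≡k _)

  P-const : ∀ a c t → P a (λ _ → c) t ≡ q * c
  P-const a c t = ΣF-const c

  P-+ : ∀ a g k t → P a (λ t → g t + k t) t ≡ P a g t + P a k t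
  P-+ a g k t = Σ-+ elements _ _

  P-* : ∀ a c g t → P a (λ t → c * g t) t ≡ c * P a g t
  P-* a c g t = Σ-* elements c _

  P-Σ : ∀ a xs (g : F → F → ℕ) t → P a (λ t → Σ[ xs ] (λ u → g u t)) t ≡ Σ[ xs ] (λ u → P a (g u) t)
  P-Σ a xs g t = Σ-swap elements xs _

  P-comm : ∀ a b g t → P a (P b g) t ≡ P b (P a g) t
  P-comm a b g t = trans (Σ-swap elements elements _) (Σ-cong elements (λ y → Σ-cong elements (λ x → cong g
    (solve 3 (λ t u v → t :+ u :+ v := t :+ v :+ u) refl t (a · L x) (b · L y)))))

  P-zero : ∀ g t → P 0# g t ≡ q * g t
  P-zero g t = trans (Σ-cong elements (λ x → cong g (solve 2 (λ t y → t :+ con false :* y := t) refl t (L x)))) (ΣF-const (g t))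

  P-idem : ∀ a g t → P a (P a g) t ≡ q * P a g t
  P-idem a g t = trans (Σ-cong elements absorb) (ΣF-const (P a g t))
    where
    absorb : ∀ x → P a g (t ⊞ a · L x) ≡ P a g t
    absorb x = trans (sym (ΣF-translate x _)) (Σ-cong elements (λ y → cong g (begin
      t ⊞ a · L x ⊞ a · L (y ⊞ x)      ≡⟨ cong (λ u → t ⊞ a · L x ⊞ a · u) (L-⊞ y x) ⟩
      t ⊞ a · L x ⊞ a · (L y ⊞ L x)    ≡⟨ solve 4 (λ t a u v → t :+ a :* u :+ a :* (v :+ u) := t :+ a :* v) refl t a (L x) (L y) ⟩
      t ⊞ a · L y                      ∎)))

  -- Multiplication by such ζ commutes with `L`, so it maps H onto itself.
  P-scale : ∀ ζ a g t → ζ ≢ 0# → ζ ↑ Q ≡ ζ → P (ζ · a) g t ≡ P a g t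
  P-scale ζ a g t ζ≢0 fix = trans (Σ-cong elements (λ x → cong (λ u → g (t ⊞ u)) (begin
      ζ · a · (x ↑ Q ⊞ x)              ≡⟨ solve 4 (λ z a x y → z :* a :* (y :+ x) := a :* (y :* z :+ x :* z)) refl ζ a x (x ↑ Q) ⟩
      a · (x ↑ Q · ζ ⊞ x · ζ)          ≡⟨ cong (λ u → a · (x ↑ Q · u ⊞ x · ζ)) (sym fix) ⟩
      a · (x ↑ Q · ζ ↑ Q ⊞ x · ζ)      ≡⟨ cong (λ u → a · (u ⊞ x · ζ)) (sym (·-↑ x ζ Q)) ⟩
      a · L (x · ζ)                    ∎)))
    (ΣF-scale ζ (λ x → g (t ⊞ a · L x)) ζ≢0)

  -- With c = d^Q and y replaced by y + d x, the sum c L(x) + L(y) becomes L(y) + (c + d) x.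
  P-transversal : ∀ c b g t → b ≢ 0# → c ↑ Q ≢ c → P (c · b) (P b g) t ≡ q * ΣF g
  P-transversal c b g t b≢0 c-moved with frobenius-root c
  ... | d , d↑Q≡c = begin
    ΣF (λ x → ΣF (λ y → g (t ⊞ c · b · L x ⊞ b · L y)))
      ≡⟨ Σ-cong elements (λ x → trans (sym (ΣF-translate (d · x) _)) (Σ-cong elements (λ y → cong g (substituted x y)))) ⟩
    ΣF (λ x → ΣF (λ y → g (x · (b · (c ⊞ d)) ⊞ (t ⊞ b · L y))))
      ≡⟨ Σ-swap elements elements _ ⟩
    ΣF (λ y → ΣF (λ x → g (x · (b · (c ⊞ d)) ⊞ (t ⊞ b · L y))))
      ≡⟨ Σ-cong elements (λ y → trans (ΣF-scale (b · (c ⊞ d)) (λ x → g (x ⊞ (t ⊞ b · L y))) (·-nonzero b≢0 c⊞d≢0)) (ΣF-translate _ g)) ⟩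
    ΣF (λ _ → ΣF g)
      ≡⟨ ΣF-const (ΣF g) ⟩
    q * ΣF g ∎
    where
    c⊞d≢0 : c ⊞ d ≢ 0#
    c⊞d≢0 z = c-moved (trans (cong (_↑ Q) (⊞≡0⇒≡ c d z)) d↑Q≡c)
    substituted : ∀ x y → t ⊞ c · b · L x ⊞ b · L (y ⊞ d · x) ≡ x · (b · (c ⊞ d)) ⊞ (t ⊞ b · L y)
    substituted x y = begin
      t ⊞ c · b · L x ⊞ b · ((y ⊞ d · x) ↑ Q ⊞ (y ⊞ d · x))
        ≡⟨ cong (λ u → t ⊞ c · b · L x ⊞ b · (u ⊞ (y ⊞ d · x))) (begin
             (y ⊞ d · x) ↑ Q        ≡⟨ frobenius-⊞ e y (d · x) ⟩
             y ↑ Q ⊞ (d · x) ↑ Q    ≡⟨ cong (y ↑ Q ⊞_) (trans (·-↑ d x Q) (cong (_· x ↑ Q) d↑Q≡c)) ⟩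
             y ↑ Q ⊞ c · x ↑ Q      ∎) ⟩
      t ⊞ c · b · (x ↑ Q ⊞ x) ⊞ b · (y ↑ Q ⊞ c · x ↑ Q ⊞ (y ⊞ d · x))
        ≡⟨ solve 8 (λ t b c d x y u v → t :+ c :* b :* (u :+ x) :+ b :* (v :+ c :* u :+ (y :+ d :* x))
             := x :* (b :* (c :+ d)) :+ (t :+ b :* (v :+ y))) refl t b c d x y (x ↑ Q) (y ↑ Q) ⟩
      x · (b · (c ⊞ d)) ⊞ (t ⊞ b · L y) ∎

  -- The two hyperplanes coincide, so the second summation only repeats the first q times.
  P-pair-fixed : ∀ v s g t → v ≢ 0# → Fixed v → P (f (v · s)) (P (f s) g) t ≡ q * P (f s) g t
  P-pair-fixed v s g t v≢0 fix = trans (cong (λ a → P a (P (f s) g) t) (f-· v s))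
    (trans (P-scale (f v) (f s) (P (f s) g) t (f-nonzero v≢0) (Fixed⇒f v fix)) (P-idem (f s) g t))

  P-pair-moved : ∀ v s g t → v ≢ 0# → s ≢ 0# → ¬ Fixed v → P (f (v · s)) (P (f s) g) t ≡ q * ΣF g
  P-pair-moved v s g t v≢0 s≢0 moved = trans (cong (λ a → P a (P (f s) g) t) (f-· v s))
    (P-transversal (f v) (f s) g t (f-nonzero s≢0) (λ fix → moved (f⇒Fixed v v≢0 fix)))

  E : (F × F → ℕ) → F × F → ℕ
  E = toggle h elements

  -- In terms of u = x + y the first entry depends on u alone, and the inner sum over x lets f(x) +
  -- f(x + u) run through its hyperplane.
  E² : ∀ g s t → E (E g) (s , t) ≡ ΣF (λ u → P (f u) (λ t′ → g (s ⊞ u , t′)) t)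
  E² g s t = begin
    ΣF (λ x → ΣF (λ y → g (s ⊞ x ⊞ y , t ⊞ f x ⊞ f y)))
      ≡⟨ Σ-cong elements (λ x → trans (sym (ΣF-translate x _)) (Σ-cong elements (λ u → cong g (cong₂ _,_
           (solve 3 (λ s x u → s :+ x :+ (u :+ x) := s :+ u) refl s x u)
           (trans (cong (λ w → t ⊞ f x ⊞ w) (f-⊞ u x))
             (solve 5 (λ t u x a b → t :+ x :* b :+ (u :+ x) :* (a :+ b) := t :+ (u :* a :+ (u :* b :+ x :* a))) refl t u x (u ↑ Q) (x ↑ Q))))))) ⟩
    ΣF (λ x → ΣF (λ u → g (s ⊞ u , t ⊞ (f u ⊞ (u · x ↑ Q ⊞ x · u ↑ Q)))))
      ≡⟨ Σ-swap elements elements _ ⟩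
    ΣF (λ u → ΣF (λ x → g (s ⊞ u , t ⊞ (f u ⊞ (u · x ↑ Q ⊞ x · u ↑ Q)))))
      ≡⟨ Σ-cong elements (λ u → polar u (λ t′ → g (s ⊞ u , t′))) ⟩
    ΣF (λ u → P (f u) (λ t′ → g (s ⊞ u , t′)) t) ∎
    where
    z : F
    z = proj₁ L-hits-1
    -- For u ≠ 0, replacing x by x u turns f(u) + u x^Q + x u^Q into f(u) (1 + L(x)), and
    -- translating x by z with L(z) = 1 absorbs the 1. For u = 0 both sides are constant sums.
    polar : ∀ u (k : F → ℕ) → ΣF (λ x → k (t ⊞ (f u ⊞ (u · x ↑ Q ⊞ x · u ↑ Q)))) ≡ P (f u) k t
    polar u k with u ≟ 0#
    ... | yes refl = Σ-cong elements (λ x → cong (λ w → k (t ⊞ w)) (begin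
      f 0# ⊞ (0# · x ↑ Q ⊞ x · 0# ↑ Q)  ≡⟨ cong₂ (λ a b → a ⊞ (0# · x ↑ Q ⊞ x · b)) f0≡0 (0↑2^ e) ⟩
      0# ⊞ (0# · x ↑ Q ⊞ x · 0#)        ≡⟨ solve 3 (λ x a c → con false :+ (con false :* a :+ x :* con false) := con false :* c) refl x (x ↑ Q) (L x) ⟩
      0# · L x                          ≡⟨ cong (_· L x) (sym f0≡0) ⟩
      f 0# · L x                        ∎))
    ... | no u≢0 = begin
      ΣF (λ x → k (t ⊞ (f u ⊞ (u · x ↑ Q ⊞ x · u ↑ Q))))
        ≡⟨ sym (ΣF-scale u _ u≢0) ⟩
      ΣF (λ x → k (t ⊞ (f u ⊞ (u · (x · u) ↑ Q ⊞ x · u · u ↑ Q))))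
        ≡⟨ Σ-cong elements (λ x → cong (λ w → k (t ⊞ w)) (trans (cong (λ w → f u ⊞ (u · w ⊞ x · u · u ↑ Q)) (·-↑ x u Q))
             (solve 4 (λ u x a b → u :* a :+ (u :* (b :* a) :+ x :* u :* a) := u :* a :* (con true :+ (b :+ x))) refl u x (u ↑ Q) (x ↑ Q)))) ⟩
      ΣF (λ x → k (t ⊞ f u · (1# ⊞ L x)))
        ≡⟨ sym (ΣF-translate z _) ⟩
      ΣF (λ x → k (t ⊞ f u · (1# ⊞ L (x ⊞ z))))
        ≡⟨ Σ-cong elements (λ x → cong (λ w → k (t ⊞ f u · w)) (trans (cong (1# ⊞_) (trans (L-⊞ x z) (cong (L x ⊞_) (proj₂ L-hits-1))))
             (solve 1 (λ a → con true :+ (a :+ con true) := a) refl (L x)))) ⟩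
      P (f u) k t ∎

  δ₀ : F → ℕ
  δ₀ t = if does (t ≟ 0#) then 1 else 0

  -- For s ≠ 0 this is four times the indicator of f(s)·H.
  p : F → F → ℕ
  p s = P (f s) δ₀

  -- The contribution of all hyperplanes together; it appears at s = 0, where none of them is
  -- singled out.
  D : F → ℕ
  D t = Σ[ units ] (λ u → p u t)

  ΣFδ₀ : ΣF δ₀ ≡ 1
  ΣFδ₀ = trans (ΣF-split δ₀) (cong₂ _+_ (cong (λ b → if b then 1 else 0) (Dec.dec-true (0# ≟ 0#) refl))
    (trans (Σ-cong-All (All.map (λ {x} x≢0 → cong (λ b → if b then 1 else 0) (Dec.dec-false (x ≟ 0#) x≢0)) units-nonzero))
      (trans (Σ-const units 0) (ℕ.*-zeroʳ (length units)))))

  length-units′ : length units ≡ 15 + r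
  length-units′ = trans length-units (cong (2 +_) n₂≡)

  length-rest′ : length rest ≡ 14 + r
  length-rest′ = trans length-rest (cong (1 +_) n₂≡)

  D0 : D 0# ≡ 4 * (15 + r)
  D0 = begin
    Σ[ units ] (λ u → p u 0#)  ≡⟨ Σ-cong-All (All.map (λ {u} u≢0 → kernel u u≢0) units-nonzero) ⟩
    Σ[ units ] (λ _ → 4)       ≡⟨ Σ-const units 4 ⟩
    length units * 4           ≡⟨ trans (cong (_* 4) length-units′) (ℕ.*-comm (15 + r) 4) ⟩
    4 * (15 + r)               ∎
    where
    kernel : ∀ u → u ≢ 0# → p u 0# ≡ 4
    kernel u u≢0 = trans (tally-cong (λ x → 0# ⊞ f u · L x ≟ 0#) (λ x → x ↑ Q ≟ x) elements
      (λ x z → ⊞≡0⇒≡ _ _ (no-zero-divisors (f u) (L x) (f-nonzero u≢0) (trans (sym (R.+-identityˡ _)) z)))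
      (λ x fix → trans (cong (λ w → 0# ⊞ f u · (w ⊞ x)) fix) (solve 2 (λ a x → con false :+ a :* (x :+ x) := con false) refl (f u) x)))
      tally-fixedQ

  tally-units : tally fixed? units ≡ 15
  tally-units = ℕ.suc-injective (trans (sym (tally-∷ fixed? 0# units Fixed-0)) (trans (cong (tally fixed?) (sym elements≡)) tally-Fixed))

  tally-rest : tally fixed? rest ≡ 14
  tally-rest = ℕ.suc-injective (trans (sym (tally-∷ fixed? 1# rest Fixed-1)) (trans (cong (tally fixed?) (sym units≡)) tally-units))

  -- Put u = v s. The 15 nonzero v in 𝔽₁₆ give the hyperplane of s itself; each of the r others
  -- spreads uniformly and gives q.
  P-D : ∀ s t → s ≢ 0# → P (f s) D t ≡ 15 * (q * p s t) + r * q
  P-D s t s≢0 = begin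
    P (f s) D t
      ≡⟨ P-Σ (f s) units p t ⟩
    Σ[ units ] (λ u → P (f s) (p u) t)
      ≡⟨ sym (Σ-units-scale s _ s≢0) ⟩
    Σ[ units ] (λ v → P (f s) (p (v · s)) t)
      ≡⟨ Σ-cong-All (All.map (λ {v} v≢0 → trans (P-comm (f s) (f (v · s)) δ₀ t) (term v v≢0)) units-nonzero) ⟩
    Σ[ units ] (λ v → if does (fixed? v) then q * p s t else q)
      ≡⟨ Σ-if fixed? units (q * p s t) q (trans length-units′ (cong (_+ r) (sym tally-units))) ⟩
    tally fixed? units * (q * p s t) + r * q
      ≡⟨ cong (λ i → i * (q * p s t) + r * q) tally-units ⟩
    15 * (q * p s t) + r * q ∎
    where
    term : ∀ v → v ≢ 0# → P (f (v · s)) (p s) t ≡ (if does (fixed? v) then q * p s t else q)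
    term v v≢0 with fixed? v
    ... | yes fix  = P-pair-fixed v s δ₀ t v≢0 fix
    ... | no moved = trans (P-pair-moved v s δ₀ t v≢0 s≢0 moved) (trans (cong (q *_) ΣFδ₀) (ℕ.*-identityʳ q))

  -- With w = 1 + v and u = v / w, the hyperplanes belong to u (w s) and w s, so the ratio u
  -- decides, and u lies in 𝔽₁₆ exactly when v does. For the 14 values of v in 𝔽₁₆ other than 0 and
  -- 1, the hyperplane of w s is again that of s.
  Σ-rest : ∀ s t → s ≢ 0# → Σ[ rest ] (λ v → P (f (v · s)) (p (s ⊞ v · s)) t) ≡ 14 * (q * p s t) + r * q
  Σ-rest s t s≢0 = begin
    Σ[ rest ] (λ v → P (f (v · s)) (p (s ⊞ v · s)) t)
      ≡⟨ Σ-cong-All (All.map (λ {v} (v≢0 , v≢1) → term v v≢0 v≢1) rest-proper) ⟩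
    Σ[ rest ] (λ v → if does (fixed? v) then q * p s t else q)
      ≡⟨ Σ-if fixed? rest (q * p s t) q (trans length-rest′ (cong (_+ r) (sym tally-rest))) ⟩
    tally fixed? rest * (q * p s t) + r * q
      ≡⟨ cong (λ i → i * (q * p s t) + r * q) tally-rest ⟩
    14 * (q * p s t) + r * q ∎
    where
    term : ∀ v → v ≢ 0# → v ≢ 1# → P (f (v · s)) (p (s ⊞ v · s)) t ≡ (if does (fixed? v) then q * p s t else q)
    term v v≢0 v≢1 with inverse (1# ⊞ v) (λ z → v≢1 (sym (⊞≡0⇒≡ 1# v z)))
    ... | y , wy≡1 = trans (cong₂ (λ a b → P (f a) (p b) t) vs≡ ws≡) split
      where
      w u : F
      w = 1# ⊞ v
      u = v · y
      w≢0 : w ≢ 0#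
      w≢0 z = v≢1 (sym (⊞≡0⇒≡ 1# v z))
      y≢0 : y ≢ 0#
      y≢0 z = 0≢1 (trans (sym (R.zeroʳ w)) (trans (cong (w ·_) (sym z)) wy≡1))
      u≢0 : u ≢ 0#
      u≢0 = ·-nonzero v≢0 y≢0
      ws≡ : s ⊞ v · s ≡ w · s
      ws≡ = solve 2 (λ s v → s :+ v :* s := (con true :+ v) :* s) refl s v
      uw≡v : u · w ≡ v
      uw≡v = trans (R.*-assoc v y w) (trans (cong (v ·_) (trans (R.*-comm y w) wy≡1)) (R.*-identityʳ v))
      vs≡ : v · s ≡ u · (w · s)
      vs≡ = trans (cong (_· s) (sym uw≡v)) (R.*-assoc u w s)
      fixed-w : Fixed v → Fixed w
      fixed-w = Fixed-⊞ 1# v Fixed-1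
      -- u = v/(1+v) determines v = u/(1+u).
      fixed-v : Fixed u → Fixed v
      fixed-v fu = Fixed-quotient v (1# ⊞ u) (λ z → 0≢1 (begin
          0#                    ≡⟨ sym (x⊞x≡0 w) ⟩
          w ⊞ w                 ≡⟨ cong (w ⊞_) (trans (sym (R.*-identityˡ w)) (cong (_· w) (⊞≡0⇒≡ 1# u z))) ⟩
          w ⊞ u · w             ≡⟨ cong (w ⊞_) uw≡v ⟩
          1# ⊞ v ⊞ v            ≡⟨ solve 1 (λ v → con true :+ v :+ v := con true) refl v ⟩
          1#                    ∎)) (Fixed-⊞ 1# u Fixed-1 fu) (subst Fixed (begin
          u                     ≡⟨ solve 2 (λ u v → u := u :* (con true :+ v) :+ u :* v) refl u v ⟩
          u · w ⊞ u · v         ≡⟨ cong (_⊞ u · v) uw≡v ⟩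
          v ⊞ u · v             ≡⟨ solve 2 (λ u v → v :+ u :* v := v :* (con true :+ u)) refl u v ⟩
          v · (1# ⊞ u)          ∎) fu)
      split : P (f (u · (w · s))) (p (w · s)) t ≡ (if does (fixed? v) then q * p s t else q)
      split with fixed? v
      ... | yes fv = trans (P-pair-fixed u (w · s) δ₀ t u≢0 (Fixed-quotient u w w≢0 (fixed-w fv) (subst Fixed (sym uw≡v) fv)))
        (cong (q *_) (trans (cong (λ a → P a δ₀ t) (f-· w s)) (P-scale (f w) (f s) δ₀ t (f-nonzero w≢0) (Fixed⇒f w (fixed-w fv)))))
      ... | no ¬fv = trans (P-pair-moved u (w · s) δ₀ t u≢0 (·-nonzero w≢0 s≢0) (¬fv ∘ fixed-v)) (trans (cong (q *_) ΣFδ₀) (ℕ.*-identityʳ q))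

  -- Iterating E ∘ E on δ never leaves the functions of this shape.
  record Shape (g : F × F → ℕ) (x y x₀ z w : ℕ) : Set where
    field
      off : ∀ s t → s ≢ 0# → g (s , t) ≡ x + y * p s t
      on  : ∀ t → g (0# , t) ≡ x₀ + (z * δ₀ t + w * D t)

  open Shape

  Shape-δ : Shape δ 0 0 0 1 0
  Shape-δ .off s t s≢0 = cong (λ b → if b then 1 else 0) (Dec.dec-false ((s , t) ≟ᴳ 𝟘) (s≢0 ∘ cong proj₁))
  Shape-δ .on t = trans δ≡δ₀ (sym (trans (ℕ.+-identityʳ (1 * δ₀ t)) (ℕ.*-identityˡ (δ₀ t))))
    where
    δ≡δ₀ : δ (0# , t) ≡ δ₀ t
    δ≡δ₀ with (0# , t) ≟ᴳ 𝟘 | t ≟ 0#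
    ... | yes _ | yes _ = refl
    ... | no _  | no _  = refl
    ... | yes a | no b  = contradiction (cong proj₂ a) b
    ... | no a  | yes b = contradiction (cong (0# ,_) b) a

  -- For s ≠ 0 put u = v s: v = 0 stays at s and gives a factor q, v = 1 lands on the line s = 0,
  -- and the other 14 + r values stay off that line. For s = 0 every unit u leads off the line, to
  -- its own hyperplane.
  Shape-E² : ∀ {g x y x₀ z w} x′ y′ x₀′ z′ w′ → Shape g x y x₀ z w →
    x′ ≡ q * x + (q * x₀ + w * (r * q)) + ((14 + r) * (q * x) + y * (r * q)) →
    y′ ≡ q * y + (z + w * (15 * q)) + y * (14 * q) →
    x₀′ ≡ q * x₀ + (15 + r) * (q * x) → z′ ≡ q * z → w′ ≡ q * w + y * q →
    Shape (E (E g)) x′ y′ x₀′ z′ w′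
  Shape-E² {g} {x} {y} {x₀} {z} {w} _ _ _ _ _ S refl refl refl refl refl .off s t s≢0 = begin
    E (E g) (s , t)
      ≡⟨ E² g s t ⟩
    ΣF (λ u → P (f u) (λ t′ → g (s ⊞ u , t′)) t)
      ≡⟨ sym (ΣF-scale s _ s≢0) ⟩
    ΣF (λ v → P (f (v · s)) (λ t′ → g (s ⊞ v · s , t′)) t)
      ≡⟨ trans (ΣF-split _) (cong (P (f (0# · s)) (λ t′ → g (s ⊞ 0# · s , t′)) t +_) (Σ-units-split _)) ⟩
    P (f (0# · s)) (λ t′ → g (s ⊞ 0# · s , t′)) t
      + (P (f (1# · s)) (λ t′ → g (s ⊞ 1# · s , t′)) t
        + Σ[ rest ] (λ v → P (f (v · s)) (λ t′ → g (s ⊞ v · s , t′)) t))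
      ≡⟨ cong₂ _+_ term₀ (cong₂ _+_ term₁ terms) ⟩
    q * (x + y * pₛ) + (q * x₀ + (z * pₛ + w * (15 * (q * pₛ) + r * q)) + ((14 + r) * (q * x) + y * (14 * (q * pₛ) + r * q)))
      ≡⟨ collect q r x y x₀ z w pₛ ⟩
    q * x + (q * x₀ + w * (r * q)) + ((14 + r) * (q * x) + y * (r * q)) + (q * y + (z + w * (15 * q)) + y * (14 * q)) * pₛ ∎
    where
    collect : ∀ q r x y x₀ z w p →
      q * (x + y * p) + (q * x₀ + (z * p + w * (15 * (q * p) + r * q)) + ((14 + r) * (q * x) + y * (14 * (q * p) + r * q)))
      ≡ q * x + (q * x₀ + w * (r * q)) + ((14 + r) * (q * x) + y * (r * q)) + (q * y + (z + w * (15 * q)) + y * (14 * q)) * p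
    collect = solve-∀
    pₛ : ℕ
    pₛ = p s t
    term₀ : P (f (0# · s)) (λ t′ → g (s ⊞ 0# · s , t′)) t ≡ q * (x + y * pₛ)
    term₀ = trans (cong₂ (λ a b → P a (λ t′ → g (b , t′)) t) (trans (cong f (R.zeroˡ s)) f0≡0) (solve 1 (λ s → s :+ con false :* s := s) refl s))
      (trans (P-zero (λ t′ → g (s , t′)) t) (cong (q *_) (S .off s t s≢0)))
    term₁ : P (f (1# · s)) (λ t′ → g (s ⊞ 1# · s , t′)) t ≡ q * x₀ + (z * pₛ + w * (15 * (q * pₛ) + r * q))
    term₁ = begin
      P (f (1# · s)) (λ t′ → g (s ⊞ 1# · s , t′)) t
        ≡⟨ cong₂ (λ a b → P a (λ t′ → g (b , t′)) t) (cong f (R.*-identityˡ s)) (solve 1 (λ s → s :+ con true :* s := con false) refl s) ⟩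
      P (f s) (λ t′ → g (0# , t′)) t
        ≡⟨ P-cong (f s) t (S .on) ⟩
      P (f s) (λ t → x₀ + (z * δ₀ t + w * D t)) t
        ≡⟨ trans (P-+ (f s) (λ _ → x₀) (λ t → z * δ₀ t + w * D t) t) (cong₂ _+_ (P-const (f s) x₀ t) (trans (P-+ (f s) (λ t → z * δ₀ t) (λ t → w * D t) t)
             (cong₂ _+_ (P-* (f s) z δ₀ t) (trans (P-* (f s) w D t) (cong (w *_) (P-D s t s≢0)))))) ⟩
      q * x₀ + (z * pₛ + w * (15 * (q * pₛ) + r * q)) ∎
    terms : Σ[ rest ] (λ v → P (f (v · s)) (λ t′ → g (s ⊞ v · s , t′)) t) ≡ (14 + r) * (q * x) + y * (14 * (q * pₛ) + r * q)
    terms = begin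
      Σ[ rest ] (λ v → P (f (v · s)) (λ t′ → g (s ⊞ v · s , t′)) t)
        ≡⟨ Σ-cong-All (All.map (λ {v} (_ , v≢1) → term v v≢1) rest-proper) ⟩
      Σ[ rest ] (λ v → q * x + y * P (f (v · s)) (p (s ⊞ v · s)) t)
        ≡⟨ trans (Σ-+ rest _ _) (cong₂ _+_ (trans (Σ-const rest (q * x)) (cong (_* (q * x)) length-rest′))
             (trans (Σ-* rest y _) (cong (y *_) (Σ-rest s t s≢0)))) ⟩
      (14 + r) * (q * x) + y * (14 * (q * pₛ) + r * q) ∎
      where
      term : ∀ v → v ≢ 1# → P (f (v · s)) (λ t′ → g (s ⊞ v · s , t′)) t ≡ q * x + y * P (f (v · s)) (p (s ⊞ v · s)) t
      term v v≢1 = trans (P-cong (f (v · s)) t (λ t → S .off (s ⊞ v · s) t sum≢0))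
        (trans (P-+ (f (v · s)) (λ _ → x) (λ t → y * p (s ⊞ v · s) t) t) (cong₂ _+_ (P-const (f (v · s)) x t) (P-* (f (v · s)) y (p (s ⊞ v · s)) t)))
        where
        sum≢0 : s ⊞ v · s ≢ 0#
        sum≢0 z = ·-nonzero (λ w≡0 → v≢1 (sym (⊞≡0⇒≡ 1# v w≡0))) s≢0 (trans (solve 2 (λ s v → (con true :+ v) :* s := s :+ v :* s) refl s v) z)
  Shape-E² {g} {x} {y} {x₀} {z} {w} _ _ _ _ _ S refl refl refl refl refl .on t = begin
    E (E g) (0# , t)
      ≡⟨ trans (E² g 0# t) (ΣF-split _) ⟩
    P (f 0#) (λ t′ → g (0# ⊞ 0# , t′)) t + Σ[ units ] (λ u → P (f u) (λ t′ → g (0# ⊞ u , t′)) t)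
      ≡⟨ cong₂ _+_ term₀ terms ⟩
    q * (x₀ + (z * δ₀ t + w * D t)) + ((15 + r) * (q * x) + y * (q * D t))
      ≡⟨ collect q r x y x₀ z w (δ₀ t) (D t) ⟩
    q * x₀ + (15 + r) * (q * x) + (q * z * δ₀ t + (q * w + y * q) * D t) ∎
    where
    collect : ∀ q r x y x₀ z w δ d →
      q * (x₀ + (z * δ + w * d)) + ((15 + r) * (q * x) + y * (q * d)) ≡ q * x₀ + (15 + r) * (q * x) + (q * z * δ + (q * w + y * q) * d)
    collect = solve-∀
    term₀ : P (f 0#) (λ t′ → g (0# ⊞ 0# , t′)) t ≡ q * (x₀ + (z * δ₀ t + w * D t))
    term₀ = trans (cong₂ (λ a b → P a (λ t′ → g (b , t′)) t) f0≡0 (R.+-identityˡ 0#)) (trans (P-zero (λ t′ → g (0# , t′)) t) (cong (q *_) (S .on t)))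
    terms : Σ[ units ] (λ u → P (f u) (λ t′ → g (0# ⊞ u , t′)) t) ≡ (15 + r) * (q * x) + y * (q * D t)
    terms = begin
      Σ[ units ] (λ u → P (f u) (λ t′ → g (0# ⊞ u , t′)) t)
        ≡⟨ Σ-cong-All (All.map (λ {u} u≢0 → term u u≢0) units-nonzero) ⟩
      Σ[ units ] (λ u → q * x + y * (q * p u t))
        ≡⟨ trans (Σ-+ units _ _) (cong₂ _+_ (trans (Σ-const units (q * x)) (cong (_* (q * x)) length-units′))
             (trans (Σ-* units y _) (cong (y *_) (Σ-* units q _)))) ⟩
      (15 + r) * (q * x) + y * (q * D t) ∎
      where
      term : ∀ u → u ≢ 0# → P (f u) (λ t′ → g (0# ⊞ u , t′)) t ≡ q * x + y * (q * p u t)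
      term u u≢0 = begin
        P (f u) (λ t′ → g (0# ⊞ u , t′)) t   ≡⟨ P-cong (f u) t (λ t′ → trans (cong (λ b → g (b , t′)) (R.+-identityˡ u)) (S .off u t′ u≢0)) ⟩
        P (f u) (λ t → x + y * p u t) t      ≡⟨ P-+ (f u) (λ _ → x) (λ t → y * p u t) t ⟩
        P (f u) (λ _ → x) t + P (f u) (λ t → y * p u t) t ≡⟨ cong₂ _+_ (P-const (f u) x t) (trans (P-* (f u) y (p u) t) (cong (y *_) (P-idem (f u) δ₀ t))) ⟩
        q * x + y * (q * p u t)              ∎

  -- Even moments in terms of the numbers of sets of each size

  C : ℕ → F × F → ℕ
  C = count h elements

  E-cong : ∀ {g k} → (∀ γ → g γ ≡ k γ) → ∀ γ → E g γ ≡ E k γ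
  E-cong g≡k γ = Σ-cong elements (λ x → g≡k _)

  E-+ : ∀ a g k γ → E (λ γ → a * g γ + k γ) γ ≡ a * E g γ + E k γ
  E-+ a g k γ = trans (Σ-+ elements _ _) (cong (_+ E k γ) (Σ-* elements a _))

  E-* : ∀ a g γ → E (λ γ → a * g γ) γ ≡ a * E g γ
  E-* a g γ = Σ-* elements a _

  E²-+ : ∀ a g k γ → E (E (λ γ → a * g γ + k γ)) γ ≡ a * E (E g) γ + E (E k) γ
  E²-+ a g k γ = trans (E-cong (E-+ a g k) γ) (E-+ a (E g) (E k) γ)

  E²-* : ∀ a g γ → E (E (λ γ → a * g γ)) γ ≡ a * E (E g) γ
  E²-* a g γ = trans (E-cong (E-* a g) γ) (E-* a (E g) γ)

  -- A set of size w + 2 is reached by toggling any of its own points, a set of size w by toggling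
  -- any of the k = q - w points outside it.
  E-C : ∀ w k γ → q ≡ w + k → E (C (suc w)) γ ≡ (2 + w) * C (2 + w) γ + k * C w γ
  E-C w k γ q≡ = ℕ.+-cancelʳ-≡ (w * C w γ) _ _ (begin
    E (C (suc w)) γ + w * C w γ                           ≡⟨ toggle-count h elements w γ ⟩
    (2 + w) * C (2 + w) γ + length elements * C w γ       ≡⟨ cong (λ i → (2 + w) * C (2 + w) γ + i * C w γ) (trans length-elements (trans (cong (3 +_) n₂≡) q≡)) ⟩
    (2 + w) * C (2 + w) γ + (w + k) * C w γ               ≡⟨ regroup w k (C (2 + w) γ) (C w γ) ⟩
    (2 + w) * C (2 + w) γ + k * C w γ + w * C w γ         ∎)
    where
    regroup : ∀ w k x y → (2 + w) * x + (w + k) * y ≡ (2 + w) * x + k * y + w * y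
    regroup = solve-∀

  E²-C : ∀ w k γ → q ≡ 2 + w + k → E (E (C (2 + w))) γ
    ≡ (3 + w) * ((4 + w) * C (4 + w) γ + k * C (2 + w) γ) + (1 + k) * ((2 + w) * C (2 + w) γ + (2 + k) * C w γ)
  E²-C w k γ q≡ = begin
    E (E (C (2 + w))) γ
      ≡⟨ E-cong (λ γ → E-C (1 + w) (1 + k) γ (trans q≡ (cong suc (sym (ℕ.+-suc w k))))) γ ⟩
    E (λ γ → (3 + w) * C (3 + w) γ + (1 + k) * C (1 + w) γ) γ
      ≡⟨ trans (E-+ (3 + w) (C (3 + w)) (λ γ → (1 + k) * C (1 + w) γ) γ) (cong ((3 + w) * E (C (3 + w)) γ +_) (E-* (1 + k) (C (1 + w)) γ)) ⟩
    (3 + w) * E (C (3 + w)) γ + (1 + k) * E (C (1 + w)) γ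
      ≡⟨ cong₂ (λ i j → (3 + w) * i + (1 + k) * j) (E-C (2 + w) k γ q≡)
           (E-C w (2 + k) γ (trans q≡ (trans (cong suc (sym (ℕ.+-suc w k))) (sym (ℕ.+-suc w (suc k)))))) ⟩
    (3 + w) * ((4 + w) * C (4 + w) γ + k * C (2 + w) γ) + (1 + k) * ((2 + w) * C (2 + w) γ + (2 + k) * C w γ) ∎

  -- Separate from `E²-C` because nothing lies below the empty set: `C 0` is `δ`, and one toggle
  -- gives `C 1` alone.
  E²-C0 : ∀ γ → E (E (C 0)) γ ≡ 2 * C 2 γ + (16 + r) * C 0 γ
  E²-C0 γ = trans (E-cong (λ γ → trans (E-cong (count-zero h elements) γ) (toggle-δ h elements γ)) γ) (E-C 0 q γ refl)

  -- Opaque, so that the large numerals in the values are never unfolded.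
  opaque
    ⟦_⟧ : Expr → ℕ
    ⟦ a ⟧ = ⟦ a ⟧ₑ r

    ⟦num⟧ : ∀ c → ⟦ num c ⟧ ≡ c
    ⟦num⟧ c = refl

    ⟦+⟧ : ∀ a b → ⟦ a :+: b ⟧ ≡ ⟦ a ⟧ + ⟦ b ⟧
    ⟦+⟧ a b = refl

    ⟦*⟧ : ∀ a b → ⟦ a :*: b ⟧ ≡ ⟦ a ⟧ * ⟦ b ⟧
    ⟦*⟧ a b = refl

    identity : ∀ a b {_ : T (agree (coefficients a) (coefficients b))} → ⟦ a ⟧ ≡ ⟦ b ⟧
    identity a b {t} = polynomial-identity a b {t} r

  record Expansion (g : F × F → ℕ) (a b c d e : ℕ) : Set where
    field
      expand : ∀ γ → g γ ≡ a * C 0 γ + (b * C 2 γ + (c * C 4 γ + (d * C 6 γ + e * C 8 γ)))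

  open Expansion

  -- The last coefficient starts at 0, so size 10 never appears. The mixed coefficients collect both
  -- orders of adding and removing a point, as in 72 + 5r = 3 (14 + r) + 2 (15 + r).
  Expansion-E² : ∀ {g a b c d} a′ b′ c′ d′ e′ → Expansion g a b c d 0 →
    a′ ≡ (16 + r) * a + (15 + r) * (16 + r) * b → b′ ≡ 2 * a + (72 + 5 * r) * b + (13 + r) * (14 + r) * c →
    c′ ≡ 12 * b + (112 + 9 * r) * c + (11 + r) * (12 + r) * d → d′ ≡ 30 * c + (136 + 13 * r) * d → e′ ≡ 56 * d →
    Expansion (E (E g)) a′ b′ c′ d′ e′
  Expansion-E² {g} {a} {b} {c} {d} _ _ _ _ _ X refl refl refl refl refl .expand γ = begin
    E (E g) γ
      ≡⟨ E-cong (E-cong (λ γ → trans (X .expand γ) (drop-zero (a * C 0 γ) (b * C 2 γ) (c * C 4 γ) (d * C 6 γ) (C 8 γ)))) γ ⟩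
    E (E (λ γ → a * C 0 γ + (b * C 2 γ + (c * C 4 γ + d * C 6 γ)))) γ
      ≡⟨ trans (E²-+ a (C 0) (λ γ → b * C 2 γ + (c * C 4 γ + d * C 6 γ)) γ) (cong (a * E (E (C 0)) γ +_)
           (trans (E²-+ b (C 2) (λ γ → c * C 4 γ + d * C 6 γ) γ) (cong (b * E (E (C 2)) γ +_)
             (trans (E²-+ c (C 4) (λ γ → d * C 6 γ) γ) (cong (c * E (E (C 4)) γ +_) (E²-* d (C 6) γ)))))) ⟩
    a * E (E (C 0)) γ + (b * E (E (C 2)) γ + (c * E (E (C 4)) γ + d * E (E (C 6)) γ))
      ≡⟨ cong₂ (λ i j → a * i + j) (E²-C0 γ) (cong₂ (λ i j → b * i + j) (E²-C 0 (14 + r) γ refl)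
           (cong₂ (λ i j → c * i + d * j) (E²-C 2 (12 + r) γ refl) (E²-C 4 (10 + r) γ refl))) ⟩
    a * (2 * C 2 γ + (16 + r) * C 0 γ)
      + (b * (3 * (4 * C 4 γ + (14 + r) * C 2 γ) + (15 + r) * (2 * C 2 γ + (16 + r) * C 0 γ))
        + (c * (5 * (6 * C 6 γ + (12 + r) * C 4 γ) + (13 + r) * (4 * C 4 γ + (14 + r) * C 2 γ))
          + d * (7 * (8 * C 8 γ + (10 + r) * C 6 γ) + (11 + r) * (6 * C 6 γ + (12 + r) * C 4 γ))))
      ≡⟨ collect r a b c d (C 0 γ) (C 2 γ) (C 4 γ) (C 6 γ) (C 8 γ) ⟩
    ((16 + r) * a + (15 + r) * (16 + r) * b) * C 0 γ
      + ((2 * a + (72 + 5 * r) * b + (13 + r) * (14 + r) * c) * C 2 γ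
        + ((12 * b + (112 + 9 * r) * c + (11 + r) * (12 + r) * d) * C 4 γ
          + ((30 * c + (136 + 13 * r) * d) * C 6 γ + 56 * d * C 8 γ))) ∎
    where
    drop-zero : ∀ s t u v x → s + (t + (u + (v + 0 * x))) ≡ s + (t + (u + v))
    drop-zero = solve-∀
    collect : ∀ r a b c d x₀ x₂ x₄ x₆ x₈ →
      a * (2 * x₂ + (16 + r) * x₀)
        + (b * (3 * (4 * x₄ + (14 + r) * x₂) + (15 + r) * (2 * x₂ + (16 + r) * x₀))
          + (c * (5 * (6 * x₆ + (12 + r) * x₄) + (13 + r) * (4 * x₄ + (14 + r) * x₂))
            + d * (7 * (8 * x₈ + (10 + r) * x₆) + (11 + r) * (6 * x₆ + (12 + r) * x₄))))
      ≡ ((16 + r) * a + (15 + r) * (16 + r) * b) * x₀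
        + ((2 * a + (72 + 5 * r) * b + (13 + r) * (14 + r) * c) * x₂
          + ((12 * b + (112 + 9 * r) * c + (11 + r) * (12 + r) * d) * x₄
            + ((30 * c + (136 + 13 * r) * d) * x₆ + 56 * d * x₈)))
    collect = solve-∀


  moment : ℕ → F × F → ℕ
  moment zero    = δ
  moment (suc k) = E (E (moment k))

  opaque
    unfolding ⟦_⟧

    shape : ∀ k → let R = momentRow k in Shape (moment k) ⟦ c₀ R ⟧ ⟦ c₁ R ⟧ ⟦ c₂ R ⟧ ⟦ c₃ R ⟧ ⟦ c₄ R ⟧
    shape zero    = Shape-δ
    shape (suc k) = Shape-E² _ _ _ _ _ (shape k) refl refl refl refl refl

  moment-𝟘 : ∀ k → moment k 𝟘 ≡ ⟦ momentValue k ⟧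
  moment-𝟘 k = trans (shape k .on 0#) (trans (cong₂ (λ i j → ⟦ c₂ (momentRow k) ⟧ + (i + ⟦ c₄ (momentRow k) ⟧ * j))
    (trans (cong (⟦ c₃ (momentRow k) ⟧ *_) (cong (λ b → if b then 1 else 0) (Dec.dec-true (0# ≟ 0#) refl))) (ℕ.*-identityʳ _)) (trans D0 value)) total≡)
    where
    opaque
      unfolding ⟦_⟧
      value : 4 * (15 + r) ≡ ⟦ num 4 :*: (num 15 :+: var) ⟧
      value = refl
      total≡ : ⟦ c₂ (momentRow k) ⟧ + (⟦ c₃ (momentRow k) ⟧ + ⟦ c₄ (momentRow k) ⟧ * ⟦ num 4 :*: (num 15 :+: var) ⟧) ≡ ⟦ momentValue k ⟧
      total≡ = refl

  Expanded : ℕ → Set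
  Expanded k = let R = countRow k in Expansion (moment k) ⟦ c₀ R ⟧ ⟦ c₁ R ⟧ ⟦ c₂ R ⟧ ⟦ c₃ R ⟧ ⟦ c₄ R ⟧

  opaque
    unfolding ⟦_⟧

    expanded-zero : Expanded 0
    expanded-zero .expand γ = trans (sym (count-zero h elements γ)) (one (C 0 γ) (C 2 γ) (C 4 γ) (C 6 γ) (C 8 γ))
      where
      one : ∀ a b c d e → a ≡ 1 * a + (0 * b + (0 * c + (0 * d + 0 * e)))
      one = solve-∀

    expanded-suc : ∀ k → ⟦ c₄ (countRow k) ⟧ ≡ 0 → Expanded k → Expanded (suc k)
    expanded-suc k z X = Expansion-E² {a = ⟦ c₀ R ⟧} {⟦ c₁ R ⟧} {⟦ c₂ R ⟧} {⟦ c₃ R ⟧} ⟦ c₀ R′ ⟧ ⟦ c₁ R′ ⟧ ⟦ c₂ R′ ⟧ ⟦ c₃ R′ ⟧ ⟦ c₄ R′ ⟧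
      (subst (Expansion (moment k) ⟦ c₀ R ⟧ ⟦ c₁ R ⟧ ⟦ c₂ R ⟧ ⟦ c₃ R ⟧) z X) refl refl refl refl refl
      where
      R R′ : Row
      R  = countRow k
      R′ = countRow (suc k)

  Equation : ℕ → Set
  Equation k = let R = countRow k in
    Linear ⟦ momentValue k ⟧ ⟦ c₀ R ⟧ ⟦ c₁ R ⟧ ⟦ c₂ R ⟧ ⟦ c₃ R ⟧ ⟦ c₄ R ⟧ (C 2 𝟘) (C 4 𝟘) (C 6 𝟘) (C 8 𝟘)

  equation : ∀ k → Expanded k → Equation k
  equation k X = linear (trans (cong (λ i → ⟦ c₀ R ⟧ * i + (⟦ c₁ R ⟧ * C 2 𝟘 + (⟦ c₂ R ⟧ * C 4 𝟘 + (⟦ c₃ R ⟧ * C 6 𝟘 + ⟦ c₄ R ⟧ * C 8 𝟘)))) (sym C0≡1))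
    (trans (sym (X .expand 𝟘)) (moment-𝟘 k)))
    where
    R = countRow k
    C0≡1 : C 0 𝟘 ≡ 1
    C0≡1 = trans (count-zero h elements 𝟘) (cong (λ b → if b then 1 else 0) (Dec.dec-true (𝟘 ≟ᴳ 𝟘) refl))

  vanishes : ∀ a {_ : T (agree (coefficients a) (coefficients (num 0)))} → ⟦ a ⟧ ≡ 0
  vanishes a {t} = trans (identity a (num 0) {t}) (⟦num⟧ 0)

  expanded₁ : Expanded 1
  expanded₁ = expanded-suc 0 (⟦num⟧ 0) expanded-zero
  expanded₂ : Expanded 2
  expanded₂ = expanded-suc 1 (vanishes (c₄ (countRow 1))) expanded₁
  expanded₃ : Expanded 3
  expanded₃ = expanded-suc 2 (vanishes (c₄ (countRow 2))) expanded₂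
  expanded₄ : Expanded 4
  expanded₄ = expanded-suc 3 (vanishes (c₄ (countRow 3))) expanded₃

  ⟦*num⟧ : ∀ a c → ⟦ a :*: num c ⟧ ≡ ⟦ a ⟧ * c
  ⟦*num⟧ a c = trans (⟦*⟧ a (num c)) (cong (⟦ a ⟧ *_) (⟦num⟧ c))

  ⟦+*⟧ : ∀ a b c → ⟦ a :+: b :*: c ⟧ ≡ ⟦ a ⟧ + ⟦ b ⟧ * ⟦ c ⟧
  ⟦+*⟧ a b c = trans (⟦+⟧ a (b :*: c)) (cong (⟦ a ⟧ +_) (⟦*⟧ b c))

  -- The pairs of equal points already account for all of N₂ = q.
  C2≡0 : C 2 𝟘 ≡ 0
  C2≡0 = solve₁ (equation 1 expanded₁) (identity (momentValue 1) (c₀ (countRow 1)))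
    (trans (identity (c₁ (countRow 1)) (num 2)) (⟦num⟧ 2))

  12*C4 : 12 * C 4 𝟘 ≡ ⟦ weight₄ ⟧
  12*C4 = solve₂ {u = 12} (equation 2 expanded₂) C2≡0 (trans (identity (c₂ (countRow 2)) (num 2 :*: num 12)) (trans (⟦*num⟧ (num 2) 12) (cong (_* 12) (⟦num⟧ 2))))
    (vanishes (c₃ (countRow 2))) (vanishes (c₄ (countRow 2)))
    (trans (identity (momentValue 2) (c₀ (countRow 2) :+: num 2 :*: weight₄)) (trans (⟦+*⟧ _ (num 2) weight₄) (cong (λ i → ⟦ c₀ (countRow 2) ⟧ + i * ⟦ weight₄ ⟧) (⟦num⟧ 2))))

  720*C6 : 720 * C 6 𝟘 ≡ ⟦ weight₆ ⟧
  720*C6 = solve₃ {c′ = ⟦ cofactor₃ ⟧} {u = 12} (equation 3 expanded₃) C2≡0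
    (trans (identity (c₂ (countRow 3)) (cofactor₃ :*: num 12)) (⟦*num⟧ cofactor₃ 12)) 12*C4
    (trans (identity (c₃ (countRow 3)) (num 720)) (⟦num⟧ 720)) (vanishes (c₄ (countRow 3)))
    (trans (identity (momentValue 3) (c₀ (countRow 3) :+: cofactor₃ :*: weight₄ :+: weight₆))
      (trans (⟦+⟧ _ weight₆) (cong (_+ ⟦ weight₆ ⟧) (⟦+*⟧ _ cofactor₃ weight₄))))

  -- The coefficient is 8! = 720 · 56; the factor 56 = 8 · 7 is kept apart to meet the count of
  -- marked pairs.
  720*56*C8 : 720 * (56 * C 8 𝟘) ≡ ⟦ weight₈ ⟧
  720*56*C8 = trans (sym (ℕ.*-assoc 720 56 (C 8 𝟘)))
    (solve₄ {c′ = ⟦ cofactor₄ ⟧} {d′ = ⟦ cofactor₄′ ⟧} {u = 12} {v = 720} (equation 4 expanded₄) C2≡0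
      (trans (identity (c₂ (countRow 4)) (cofactor₄ :*: num 12)) (⟦*num⟧ cofactor₄ 12)) 12*C4
      (trans (identity (c₃ (countRow 4)) (cofactor₄′ :*: num 720)) (⟦*num⟧ cofactor₄′ 720)) 720*C6
      (trans (identity (c₄ (countRow 4)) (num 720 :*: num 56)) (trans (⟦*num⟧ (num 720) 56) (cong (_* 56) (⟦num⟧ 720))))
      (trans (identity (momentValue 4) (c₀ (countRow 4) :+: cofactor₄ :*: weight₄ :+: cofactor₄′ :*: weight₆ :+: weight₈))
        (trans (⟦+⟧ _ weight₈) (cong (_+ ⟦ weight₈ ⟧) (trans (⟦+*⟧ _ cofactor₄′ weight₆)
          (cong (_+ ⟦ cofactor₄′ ⟧ * ⟦ weight₆ ⟧) (⟦+*⟧ _ cofactor₄ weight₄)))))))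

  -- Two-transitivity of the affine group and the number of blocks through a pair

  Λ : ℕ
  Λ = count h rest 6 (h 0# ⊹ h 1#)

  -- The affine map x ↦ (a+b)x + a sends (0,1) to (a,b) and acts affinely on syndromes.
  Λ-constant : ∀ a b xs → a ∷ b ∷ xs ↭ elements → count h xs 6 (h a ⊹ h b) ≡ Λ
  Λ-constant a b xs p = begin
    count h xs 6 (h a ⊹ h b)                   ≡⟨ count-↭ h (↭-sym φrest↭xs) 6 _ ⟩
    count h (map φ rest) 6 (h a ⊹ h b)         ≡⟨ cong (count h (map φ rest) 6) syndrome≡ ⟩
    count h (map φ rest) 6 (shift h h φ A (h a) A-⊹ A-injective h-φ 6 (A (h 0# ⊹ h 1#)))
      ≡⟨ count-affine h h φ A (h a) A-⊹ A-injective h-φ rest 6 (h 0# ⊹ h 1#) ⟩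
    Λ                                          ∎
    where
    c : F
    c = a ⊞ b
    φ : F → F
    φ x = x · c ⊞ a
    a≢b : a ≢ b
    a≢b = head≢ (Unique-resp-↭ (↭-sym p) elements-unique)
      where
      head≢ : ∀ {x y : F} {zs} → Unique (x ∷ y ∷ zs) → x ≢ y
      head≢ ((x≢y ∷ _) ∷ _) = x≢y
    c≢0 : c ≢ 0#
    c≢0 z = a≢b (⊞≡0⇒≡ a b z)
    -- In f(x c + a) = f(x) f(c) + x c a^Q + x^Q c^Q a + f(a) the cross terms are additive in x, so
    -- they belong to the linear part.
    A : F × F → F × F
    A (s , t) = s · c , t · f c ⊞ (s · c · a ↑ Q ⊞ s ↑ Q · c ↑ Q · a)
    A-⊹ : ∀ γ μ → A (γ ⊹ μ) ≡ A γ ⊹ A μ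
    A-⊹ (s , t) (s′ , t′) = cong₂ _,_ (R.distribʳ c s s′)
      (trans (cong (λ u → (t ⊞ t′) · f c ⊞ ((s ⊞ s′) · c · a ↑ Q ⊞ u · c ↑ Q · a)) (frobenius-⊞ e s s′))
        (solve 11 (λ t t′ s s′ u u′ a c k l j → (t :+ t′) :* k :+ ((s :+ s′) :* c :* l :+ (u :+ u′) :* j :* a)
            := t :* k :+ (s :* c :* l :+ u :* j :* a) :+ (t′ :* k :+ (s′ :* c :* l :+ u′ :* j :* a))) refl
          t t′ s s′ (s ↑ Q) (s′ ↑ Q) a c (f c) (a ↑ Q) (c ↑ Q)))
    A-injective : ∀ γ → A γ ≡ 𝟘 → γ ≡ 𝟘
    A-injective (s , t) z = cong₂ _,_ s≡0 (no-zero-divisors (f c) t (f-nonzero c≢0) (begin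
      f c · t                                                   ≡⟨ R.*-comm (f c) t ⟩
      t · f c                                                   ≡⟨ solve 5 (λ x a c l j → x := x :+ (con false :* c :* l :+ con false :* j :* a)) refl (t · f c) a c (a ↑ Q) (c ↑ Q) ⟩
      t · f c ⊞ (0# · c · a ↑ Q ⊞ 0# · c ↑ Q · a)               ≡⟨ cong₂ (λ u v → t · f c ⊞ (u · c · a ↑ Q ⊞ v · c ↑ Q · a)) (sym s≡0) (sym (trans (cong (_↑ Q) s≡0) (0↑2^ e))) ⟩
      t · f c ⊞ (s · c · a ↑ Q ⊞ s ↑ Q · c ↑ Q · a)             ≡⟨ cong proj₂ z ⟩
      0#                                                        ∎))
      where
      s≡0 : s ≡ 0#
      s≡0 = no-zero-divisors c s c≢0 (trans (R.*-comm c s) (cong proj₁ z))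
    h-φ : ∀ x → h (φ x) ≡ A (h x) ⊹ h a
    h-φ x = cong (φ x ,_) (begin
      f (x · c ⊞ a)                                    ≡⟨ f-⊞ (x · c) a ⟩
      (x · c ⊞ a) · ((x · c) ↑ Q ⊞ a ↑ Q)              ≡⟨ cong (λ u → (x · c ⊞ a) · (u ⊞ a ↑ Q)) (·-↑ x c Q) ⟩
      (x · c ⊞ a) · (x ↑ Q · c ↑ Q ⊞ a ↑ Q)            ≡⟨ solve 6 (λ x c a u j l → (x :* c :+ a) :* (u :* j :+ l)
                                                            := x :* u :* (c :* j) :+ (x :* c :* l :+ u :* j :* a) :+ a :* l) refl x c a (x ↑ Q) (c ↑ Q) (a ↑ Q) ⟩
      f x · f c ⊞ (x · c · a ↑ Q ⊞ x ↑ Q · c ↑ Q · a) ⊞ f a ∎)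
    φ0 : φ 0# ≡ a
    φ0 = solve 2 (λ a c → con false :* c :+ a := a) refl a c
    φ1 : φ 1# ≡ b
    φ1 = solve 2 (λ a b → con true :* (a :+ b) :+ a := b) refl a b
    φ-↭ : map φ elements ↭ elements
    φ-↭ = ↭-trans (subst (_↭ map (_⊞ a) (map (_· c) elements)) (sym (map-∘ elements)) ↭-refl)
      (↭-trans (Perm.map⁺ (_⊞ a) (scale-↭ c c≢0)) (translate-↭ a))
    φrest↭xs : map φ rest ↭ xs
    φrest↭xs = Perm.drop-∷ (Perm.drop-∷ (↭-trans
      (subst (λ ys → ys ↭ elements) (cong₂ (λ u v → u ∷ v ∷ map φ rest) φ0 φ1)
        (subst (λ ys → map φ ys ↭ elements) (trans elements≡ (cong (0# ∷_) units≡)) φ-↭)) (↭-sym p)))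
    -- The pair and the six other points each contribute an even number of translations by κ, and
    -- these cancel.
    syndrome≡ : h a ⊹ h b ≡ shift h h φ A (h a) A-⊹ A-injective h-φ 6 (A (h 0# ⊹ h 1#))
    syndrome≡ = begin
      h a ⊹ h b                            ≡⟨ cong₂ _⊹_ (trans (cong h (sym φ0)) (h-φ 0#)) (trans (cong h (sym φ1)) (h-φ 1#)) ⟩
      A₀ ⊹ κ ⊹ (A₁ ⊹ κ)                    ≡⟨ trans (sym (⊹-assoc (A₀ ⊹ κ) A₁ κ)) (trans (cong (_⊹ κ) (⊹-exch A₀ κ A₁)) (⊹-cancel (A₀ ⊹ A₁) κ)) ⟩
      A₀ ⊹ A₁                              ≡⟨ sym (A-⊹ (h 0#) (h 1#)) ⟩
      A₀₁                                  ≡⟨ sym (trans (⊹-cancel (A₀₁ ⊹ κ ⊹ κ ⊹ κ ⊹ κ) κ) (trans (⊹-cancel (A₀₁ ⊹ κ ⊹ κ) κ) (⊹-cancel A₀₁ κ))) ⟩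
      A₀₁ ⊹ κ ⊹ κ ⊹ κ ⊹ κ ⊹ κ ⊹ κ          ∎
      where
      κ   = h a
      A₀  = A (h 0#)
      A₁  = A (h 1#)
      A₀₁ = A (h 0# ⊹ h 1#)

  -- Counts the 8-sets of syndrome zero with an ordered pair of marked points, once by sets and once
  -- by pairs.
  56*C8≡ : 56 * C 8 𝟘 ≡ (16 + r) * ((15 + r) * Λ)
  56*C8≡ = begin
    56 * C 8 𝟘                                                                   ≡⟨ ℕ.*-assoc 7 8 (C 8 𝟘) ⟩
    7 * (8 * C 8 𝟘)                                                              ≡⟨ cong (7 *_) (sym (count-picks h elements 7 𝟘)) ⟩
    7 * Σ[ picks elements ] (λ (a , xs) → count h xs 7 (𝟘 ⊹ h a))                ≡⟨ sym (Σ-* (picks elements) 7 _) ⟩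
    Σ[ picks elements ] (λ (a , xs) → 7 * count h xs 7 (𝟘 ⊹ h a))                ≡⟨ Σ-cong-All (All.map (λ {(a , xs)} p → inner a xs p) (picks-↭ elements)) ⟩
    Σ[ picks elements ] (λ _ → (15 + r) * Λ)                                     ≡⟨ Σ-const (picks elements) _ ⟩
    length (picks elements) * ((15 + r) * Λ)                                     ≡⟨ cong (_* ((15 + r) * Λ)) (trans (length-picks elements) (trans length-elements (cong (3 +_) n₂≡))) ⟩
    (16 + r) * ((15 + r) * Λ)                                                    ∎
    where
    inner : ∀ a xs → a ∷ xs ↭ elements → 7 * count h xs 7 (𝟘 ⊹ h a) ≡ (15 + r) * Λ
    inner a xs p = begin
      7 * count h xs 7 (𝟘 ⊹ h a)                                        ≡⟨ sym (count-picks h xs 6 (𝟘 ⊹ h a)) ⟩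
      Σ[ picks xs ] (λ (b , ys) → count h ys 6 (𝟘 ⊹ h a ⊹ h b))         ≡⟨ Σ-cong-All (All.map (λ {(b , ys)} p′ → trans
            (cong (λ γ → count h ys 6 (γ ⊹ h b)) (trans (⊹-comm 𝟘 (h a)) (⊹-𝟘 (h a)))) (Λ-constant a b ys (↭-trans (prep a p′) p))) (picks-↭ xs)) ⟩
      Σ[ picks xs ] (λ _ → Λ)                                           ≡⟨ Σ-const (picks xs) Λ ⟩
      length (picks xs) * Λ                                             ≡⟨ cong (_* Λ) (trans (length-picks xs) (ℕ.suc-injective (trans (Perm.↭-length p) (trans length-elements (cong (3 +_) n₂≡))))) ⟩
      (15 + r) * Λ                                                      ∎

  opaque
    unfolding ⟦_⟧
    ⟦𝕢⟧ : ⟦ 𝕢 ⟧ ≡ 16 + r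
    ⟦𝕢⟧ = refl
    ⟦weight₄⟧ : ⟦ weight₄ ⟧ ≡ (16 + r) * (15 + r)
    ⟦weight₄⟧ = refl

  720*Λ : 720 * Λ ≡ ⟦ λ-polynomial ⟧
  720*Λ = double-counting {720} {56 * C 8 𝟘} {16 + r} {15 + r} {Λ} {⟦ weight₄ ⟧} 720*56*C8 56*C8≡ (⟦*⟧ weight₄ λ-polynomial) ⟦weight₄⟧

  -- Passes from r back to q = 16 + r, the variable of the stated formula, where the cubic
  -- coefficient is negative and therefore moves to the left.
  720*Λ+27q³ : 720 * Λ + 27 * (⟦ 𝕢 ⟧ * ⟦ 𝕢 ⟧ * ⟦ 𝕢 ⟧)
    ≡ ⟦ 𝕢 ⟧ * ⟦ 𝕢 ⟧ * ⟦ 𝕢 ⟧ * ⟦ 𝕢 ⟧ + 184 * (⟦ 𝕢 ⟧ * ⟦ 𝕢 ⟧) + 1044 * ⟦ 𝕢 ⟧ + 6448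
  720*Λ+27q³ = trans (cong₂ _+_ 720*Λ (sym (num* 27 (𝕢 :*: 𝕢 :*: 𝕢) cube)))
    (trans (sym (⟦+⟧ λ-polynomial _)) (trans (identity _ (𝕢 :*: 𝕢 :*: 𝕢 :*: 𝕢 :+: num 184 :*: (𝕢 :*: 𝕢) :+: num 1044 :*: 𝕢 :+: num 6448))
      (trans (⟦+⟧ _ (num 6448)) (cong₂ _+_ (trans (⟦+⟧ _ (num 1044 :*: 𝕢)) (cong₂ _+_ (trans (⟦+⟧ _ (num 184 :*: (𝕢 :*: 𝕢)))
        (cong₂ _+_ (trans (⟦*⟧ _ 𝕢) (cong (_* ⟦ 𝕢 ⟧) cube)) (num* 184 (𝕢 :*: 𝕢) (⟦*⟧ 𝕢 𝕢)))) (num* 1044 𝕢 refl))) (⟦num⟧ 6448)))))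
    where
    num* : ∀ c a {x} → ⟦ a ⟧ ≡ x → ⟦ num c :*: a ⟧ ≡ c * x
    num* c a a≡x = trans (⟦*⟧ (num c) a) (cong₂ _*_ (⟦num⟧ c) a≡x)
    cube : ⟦ 𝕢 :*: 𝕢 :*: 𝕢 ⟧ ≡ ⟦ 𝕢 ⟧ * ⟦ 𝕢 ⟧ * ⟦ 𝕢 ⟧
    cube = trans (⟦*⟧ (𝕢 :*: 𝕢) 𝕢) (cong (_* ⟦ 𝕢 ⟧) (⟦*⟧ 𝕢 𝕢))

  -- The design formed by the supports of weight 8

  design : ∀ M₁ M₂ g → IsMinPoly α M₁ → IsMinPoly (f α) M₂ → IsLcm M₁ M₂ g → Is2Design (1 + n) 8 Λ (SupportBlock n g 8)
  design M₁ M₂ g min₁ min₂ lcm = (λ B (_ , _ , _ , size≡8) → size≡8) , through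
    where
    through : ∀ i j → i ≢ j → ∃ λ xs → Unique xs × length xs ≡ Λ × (∀ B → (B ∈ xs) ⇔ (SupportBlock n g 8 B × i ∈ₛ B × j ∈ₛ B))
    through i j i≢j = enum h (points n 1#) R 8 𝟘 , enum-unique h (points n 1#) R 8 𝟘 , number , λ B → mk⇔ (⇒ B) (⇐ B)
      where
      R : Subset (1 + n)
      R = ⁅ i ⁆ ∪ ⁅ j ⁆
      ⇒ : ∀ B → B ∈ enum h (points n 1#) R 8 𝟘 → SupportBlock n g 8 B × i ∈ₛ B × j ∈ₛ B
      ⇒ B B∈ with ∈-enum⁻ h (points n 1#) R 8 𝟘 B∈
      ... | size≡8 , syn≡𝟘 , R⊆B = Equivalence.from (supportBlock⇔ M₁ M₂ g min₁ min₂ lcm B) (size≡8 , syn≡𝟘)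
        , R⊆B (Sub.x∈p∪q⁺ (inj₁ (Sub.x∈⁅x⁆ i))) , R⊆B (Sub.x∈p∪q⁺ (inj₂ (Sub.x∈⁅x⁆ j)))
      ⇐ : ∀ B → SupportBlock n g 8 B × i ∈ₛ B × j ∈ₛ B → B ∈ enum h (points n 1#) R 8 𝟘
      ⇐ B (block , i∈B , j∈B) with Equivalence.to (supportBlock⇔ M₁ M₂ g min₁ min₂ lcm B) block
      ... | size≡8 , syn≡𝟘 = ∈-enum⁺ h (points n 1#) R 𝟘 B size≡8 syn≡𝟘 R⊆B
        where
        R⊆B : ∀ {x} → x ∈ₛ R → x ∈ₛ B
        R⊆B x∈R with Sub.x∈p∪q⁻ ⁅ i ⁆ ⁅ j ⁆ x∈R
        ... | inj₁ x∈i = subst (_∈ₛ B) (sym (Sub.x∈⁅y⁆⇒x≡y i x∈i)) i∈B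
        ... | inj₂ x∈j = subst (_∈ₛ B) (sym (Sub.x∈⁅y⁆⇒x≡y j x∈j)) j∈B
      number : length (enum h (points n 1#) R 8 𝟘) ≡ Λ
      number = begin
        -- Of the eight points two are forced, so six remain free.
        length (enum h (points n 1#) R 8 𝟘)               ≡⟨ cong (λ k → length (enum h (points n 1#) R (6 + k) 𝟘)) (sym ∣R∣≡2) ⟩
        length (enum h (points n 1#) R (6 + ∣ R ∣) 𝟘)      ≡⟨ length-enum h (points n 1#) R 6 𝟘 ⟩
        count h (unselected h (points n 1#) R) 6 (𝟘 ⊹ total h (selected h (points n 1#) R))
          ≡⟨ pair (selected h (points n 1#) R) (unselected h (points n 1#) R) (trans (length-selected h (points n 1#) R) ∣R∣≡2)
               (↭-trans (selected-↭ h (points n 1#) R) points-↭) ⟩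
        Λ ∎
        where
        ∣R∣≡2 : ∣ R ∣ ≡ 2
        ∣R∣≡2 = ∣pair∣ i j i≢j
        pair : ∀ xs ys → length xs ≡ 2 → xs ++ ys ↭ elements → count h ys 6 (𝟘 ⊹ total h xs) ≡ Λ
        pair (a ∷ b ∷ []) ys refl p = trans (cong (count h ys 6) (begin
          𝟘 ⊹ (𝟘 ⊹ h b ⊹ h a)   ≡⟨ trans (⊹-comm 𝟘 _) (⊹-𝟘 _) ⟩
          𝟘 ⊹ h b ⊹ h a         ≡⟨ cong (_⊹ h a) (trans (⊹-comm 𝟘 (h b)) (⊹-𝟘 (h b))) ⟩
          h b ⊹ h a             ≡⟨ ⊹-comm (h b) (h a) ⟩
          h a ⊹ h b             ∎)) (Λ-constant a b ys p)

module _ (m e : ℕ) (K : GF2^ m) (α : GF2^.F K) (generates : GF2^.IsGenerator K α) (M₁ M₂ g : Poly₂)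
  (min₁ : GF2^.IsMinPoly K α M₁) (min₂ : GF2^.IsMinPoly K (GF2^._^_ K α (1 + 2 ^ e)) M₂) (lcm : IsLcm M₁ M₂ g)
  (bézout : Bézout.Identity 2 m e) (2∣e : 2 ∣ e) (4≤m : 4 ≤ m) where

  extendedCodeDesign : ∀ n₂ r l → 2 ^ m ≡ 3 + n₂ → n₂ ≡ 13 + r → 2 + n₂ ≡ l * 15 →
    ∃ λ lam → (45 * lam ≡ λ-numerator m) × Is2Design (1 + (2 ^ m ∸ 1)) 8 lam (SupportBlock (2 ^ m ∸ 1) g 8)
  extendedCodeDesign n₂ r l 2^m≡ n₂≡ n≡l*15 =
    Λ , λ-numerator≡ m Λ 4≤m (trans 2^m≡ (trans (cong (3 +_) n₂≡) (sym ⟦𝕢⟧))) 720*Λ+27q³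
    , subst (λ n → Is2Design (1 + n) 8 Λ (SupportBlock n g 8)) (sym (cong (_∸ 1) 2^m≡)) (design M₁ M₂ g min₁ min₂ lcm)
    where open Design K α generates n₂ 2^m≡ e bézout 2∣e r n₂≡ l n≡l*15

theorem3p10 : (m e : ℕ) → 0 < m → 4 ∣ m → 2 ≤ e → e ≤ m / 2 → gcd m e ≡ 2 →
    (K : GF2^ m) → (α : GF2^.F K) → GF2^.IsGenerator K α →
    (M₁ M₂ g : Poly₂) →
    GF2^.IsMinPoly K α M₁ →
    GF2^.IsMinPoly K (GF2^._^_ K α (1 + 2 ^ e)) M₂ →
    IsLcm M₁ M₂ g →
    ∃ λ lam → (45 * lam ≡ λ-numerator m)
      × Is2Design (1 + (2 ^ m ∸ 1)) 8 lam (SupportBlock (2 ^ m ∸ 1) g 8)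
theorem3p10 m e 0<m (divides zero refl) _ _ _ = contradiction 0<m λ ()
theorem3p10 m e 0<m (divides (suc k) m≡) _ _ gcd≡2 K α generates M₁ M₂ g min₁ min₂ lcm =
  extendedCodeDesign m e K α generates M₁ M₂ g min₁ min₂ lcm
    (subst (λ d → Bézout.Identity d m e) gcd≡2 (Bézout.identity (gcd-GCD m e)))
    (subst (_∣ e) gcd≡2 (gcd[m,n]∣n m e)) 4≤m
    -- The witnesses are n₂ = 2^m - 3, r = 2^m - 16 and l = (2^m - 1) / 15, which is an integer
    -- since 2^m is a power of 16.
    (2 ^ m ∸ 3) (2 ^ m ∸ 16) (proj₁ (16^k≡1+15l (suc k))) 2^m≡
    (ℕ.+-cancelˡ-≡ 3 _ _ (trans (sym 2^m≡) (sym (ℕ.m+[n∸m]≡n 16≤2^m))))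
    (ℕ.suc-injective (trans (sym 2^m≡) (trans (cong (2 ^_) m≡) (proj₂ (16^k≡1+15l (suc k))))))
  where
  4≤m : 4 ≤ m
  4≤m = subst (4 ≤_) (sym m≡) (ℕ.m≤m+n 4 (k * 4))
  16≤2^m : 16 ≤ 2 ^ m
  16≤2^m = ℕ.^-monoʳ-≤ 2 4≤m
  2^m≡ : 2 ^ m ≡ 3 + (2 ^ m ∸ 3)
  2^m≡ = sym (ℕ.m+[n∸m]≡n (ℕ.≤-trans (s≤s (s≤s (s≤s z≤n))) 16≤2^m))
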